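{- Let $q$ be a prime power, let $s\ge 1$ be an integer, let $F$ be a global function field with full constant field $\mathbb{F}_q$ and genus $g$, and let $P_\infty,P_1,\ldots,P_s$ be $s+1$ distinct places of $F$ with $\deg(P_\infty)=1$. Put $e_i=\deg(P_i)$ for $1\le i\le s$ and $\boldsymbol{e}=(e_1,\ldots,e_s)$. Then the matrices $C^{(1)},\ldots,C^{(s)}\in\mathbb{F}_q^{\mathbb{N}\times\mathbb{N}_0}$ given by the columnwise construction (described in the context) from $F,P_\infty,P_1,\ldots,P_s$ generate, by the digital method, a $(u,\boldsymbol{e},s)$-sequence in base $q$ with $u=g$.
   Context: **Columnwise construction.** For a divisor $D$ of $F$ let $\mathcal{L}(D)=\{f\in F^*:\mathrm{div}(f)+D\ge 0\}\cup\{0\}$ be the Riemann-Roch space and $\ell(D)$ its dimension over $\mathbb{F}_q$. The gap numbers of $P_\infty$ are the $g$ positive integers $n$ with $\ell(nP_\infty)=\ell((n-1)P_\infty)$. Let $n_0<n_1<n_2<\cdots$ be the elements of $\mathbb{N}_0$ that are not gap numbers of $P_\infty$, in increasing order. For each $r\ge 0$ choose any $y_r\in\mathcal{L}(n_rP_\infty)\setminus\mathcal{L}((n_r-1)P_\infty)$. For $1\le i\le s$ choose a local parameter $z_i$ at $P_i$ (i.e. $\nu_{P_i}(z_i)=1$); since $\nu_{P_i}(y_r)\ge 0$, the local expansion of $y_r$ at $P_i$ is $y_r=\sum_{k=0}^\infty\beta^{(i)}_{k,r}z_i^k$ with $\beta^{(i)}_{k,r}\in\mathbb{F}_{q^{e_i}}$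 (the residue class field of $P_i$; the expansion takes place in the completion of $F$ at $P_i$, identified with $\mathbb{F}_{q^{e_i}}((z_i))$). Using a fixed ordered basis of $\mathbb{F}_{q^{e_i}}/\mathbb{F}_q$, identify $\beta^{(i)}_{k,r}$ with a column vector $\boldsymbol{b}^{(i)}_{k,r}\in\mathbb{F}_q^{e_i}$. Column $r$ ($r\ge 0$) of $C^{(i)}=(c^{(i)}_{j,r})_{j\ge1,r\ge0}$ is the concatenation of $\boldsymbol{b}^{(i)}_{0,r},\boldsymbol{b}^{(i)}_{1,r},\boldsymbol{b}^{(i)}_{2,r},\ldots$; i.e. $c^{(i)}_{ke_i+h,r}$ is the $h$th coordinate of $\boldsymbol{b}^{(i)}_{k,r}$ for $k\ge0$, $1\le h\le e_i$. **Digital method.** Let $Z_q=\{0,1,\ldots,q-1\}\subset\mathbb{Z}$. Choose bijections $\psi_r:Z_q\to\mathbb{F}_q$ ($r\ge0$) with $\psi_r(0)=0$ for all sufficiently large $r$, and bijections $\lambda_{i,j}:\mathbb{F}_q\to Z_q$ ($1\le i\le s$, $j\ge1$); these choices are arbitrary. For $n\ge0$ with base-$q$ expansion $n=\sum_{r\ge0}z_r(n)q^r$, put $y^{(i)}_{n,j}=\sum_{r\ge0}c^{(i)}_{j,r}\psi_r(z_r(n))\in\mathbb{F}_q$ and $x^{(i)}_n=\sum_{j\ge1}\lambda_{i,j}(y^{(i)}_{n,j})q^{ -j}$. The sequence generated by $C^{(1)},\ldots,C^{(s)}$ is $\boldsymbol{x}_n=(x_n^{(1)},\ldots,x_n^{(s)})$,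 $n\ge0$. **Nets and sequences.** Point sets are counted with multiplicity: for a point set $\mathcal{P}$ (finite indexed family), $A(J;\mathcal{P})$ is the number of indices $n$ with $\boldsymbol{x}_n\in J$. Let $b\ge2$, $s\ge1$, $0\le u\le m$ be integers, $\boldsymbol{e}=(e_1,\ldots,e_s)\in\mathbb{N}^s$. A *$(u,m,\boldsymbol{e},s)$-net in base $b$* is a point set $\mathcal{P}$ of $b^m$ points in $[0,1)^s$ such that $A(J;\mathcal{P})=b^m\,\mathrm{Vol}(J)$ for every interval $J=\prod_{i=1}^s[a_ib^{ -d_i},(a_i+1)b^{ -d_i})$ with integers $d_i\ge0$, $0\le a_i<b^{d_i}$, $e_i\mid d_i$ for $1\le i\le s$, and $\mathrm{Vol}(J)\ge b^{u-m}$. For an integer $u\ge0$, a sequence $\boldsymbol{x}_0,\boldsymbol{x}_1,\ldots$ in $[0,1]^s$ is a *$(u,\boldsymbol{e},s)$-sequence in base $b$* if for all integers $k\ge0$ and $m>u$ the points $[\boldsymbol{x}_n]_{b,m}$, $kb^m\le n<(k+1)b^m$, form a $(u,m,\boldsymbol{e},s)$-net in base $b$. Here $[\boldsymbol{x}_n]_{b,m}$ is the coordinatewise $m$-digit truncation in base $b$, taken with respect to the given digit expansion of each coordinate (for the digital method: $\sum_{j\ge1}\lambda_{i,j}(y^{(i)}_{n,j})q^{ -j}$ is truncated to $\sum_{j=1}^m$). -}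

module Defs where

open import Level using (Level; _⊔_; suc)
open import Algebra.Apartness.Bundles using (HeytingField; HeytingCommutativeRing)
open import Algebra.Bundles using (CommutativeRing; Semiring)
open import Algebra.Morphism.Structures using (IsRingHomomorphism)
import Algebra.Definitions.RawSemiring as RawSemiringDefs
open import Data.Fin.Base using (Fin; toℕ)
open import Data.Fin.Properties using (all?)
open import Data.Integer.Base as ℤ using (ℤ; +_; 0ℤ; 1ℤ)
open import Data.List.Base using (List; []; _∷_; length; filter; allFin)
open import Data.List.Relation.Unary.All using (All)
open import Data.List.Relation.Unary.AllPairs using (AllPairs; []; _∷_)
import Data.List.Relation.Unary.All as All
open import Data.Nat.Base as ℕ
  using (ℕ; NonZero; NonTrivial; nonTrivial⇒nonZero; _≤_; _<_; _∸_; _^_)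
open import Data.Nat.Divisibility using (_∣_)
open import Data.Nat.DivMod using (_mod_)
open import Data.Nat.Primality using (Prime)
open import Data.Nat.Properties using (m^n≢0)
open import Data.Product.Base using (Σ; ∃; _×_; _,_; proj₁; proj₂)
open import Data.Rational.Base as ℚ using (ℚ; 0ℚ; 1ℚ)
import Data.Rational.Properties as ℚ
open import Data.Vec.Functional using (Vector)
open import Function.Bundles using (Bijection; _⇔_)
open import Relation.Binary.PropositionalEquality using (_≡_; setoid)
open import Relation.Binary.Construct.Add.Supremum.NonStrict ℤ._≤_
  using () renaming (_≤⁺_ to _≤∞_)
open import Relation.Nullary using (¬_; Dec; _×-dec_)
open import Relation.Nullary.Construct.Add.Supremum using (_⁺; [_]; ⊤⁺)
open import Relation.Unary using (Pred)

IsPrimePower : ℕ → Set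
IsPrimePower q = ∃ λ p → ∃ λ k → Prime p × 1 ≤ k × q ≡ p ^ k

Eventually : ∀ {ℓ} → (ℕ → Set ℓ) → Set ℓ
Eventually A = ∃ λ N → ∀ n → N ≤ n → A n

ℤ∞ : Set
ℤ∞ = ℤ ⁺

infixl 6 _+∞_
infixl 7 _⊓∞_

_+∞_ : ℤ∞ → ℤ∞ → ℤ∞
[ m ] +∞ [ n ] = [ m ℤ.+ n ]
[ m ] +∞ ⊤⁺    = ⊤⁺
⊤⁺    +∞ n     = ⊤⁺

_⊓∞_ : ℤ∞ → ℤ∞ → ℤ∞
[ m ] ⊓∞ [ n ] = [ m ℤ.⊓ n ]
[ m ] ⊓∞ ⊤⁺    = [ m ]
⊤⁺    ⊓∞ n     = n

commutativeRing : ∀ {c ℓ₁ ℓ₂} → HeytingField c ℓ₁ ℓ₂ → CommutativeRing c ℓ₁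
commutativeRing E =
  HeytingCommutativeRing.commutativeRing (HeytingField.heytingCommutativeRing E)

record FieldExtension (c ℓ₁ ℓ₂ : Level) : Set (suc (c ⊔ ℓ₁ ⊔ ℓ₂)) where
  field
    constantField        : HeytingField c ℓ₁ ℓ₂
    functionField        : HeytingField c ℓ₁ ℓ₂
    ι                    : HeytingField.Carrier constantField → HeytingField.Carrier functionField
    ι-isRingHomomorphism : IsRingHomomorphism
      (CommutativeRing.rawRing (commutativeRing constantField))
      (CommutativeRing.rawRing (commutativeRing functionField)) ι

  module K where
    open CommutativeRing (commutativeRing constantField) public
    open HeytingField constantField public using (_#_)

  module F where
    open CommutativeRing (commutativeRing functionField) public
    open HeytingField functionField public using (_#_)
    open RawSemiringDefs (Semiring.rawSemiring semiring) public using (sum) renaming (_^_ to _^F_)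

  open F using (_≈_; _#_; _*_; _^F_; 0#; sum)

  combination : ∀ {n} → Vector K.Carrier n → Vector F.Carrier n → F.Carrier
  combination a b = sum λ i → ι (a i) * b i

  -- A polynomial over K is its vector of coefficients, constant term first.
  eval : ∀ {n} → Vector K.Carrier n → F.Carrier → F.Carrier
  eval p x = combination p (λ i → x ^F toℕ i)

  IsAlgebraic : Pred F.Carrier (c ⊔ ℓ₁ ⊔ ℓ₂)
  IsAlgebraic f = ∃ λ n → Σ (Vector K.Carrier n) λ p →
    (∃ λ i → p i K.# K.0#) × eval p f ≈ 0#

  -- Membership in the subfield K(x), as a quotient of polynomials in x.
  RationalIn : F.Carrier → Pred F.Carrier (c ⊔ ℓ₁ ⊔ ℓ₂)
  RationalIn x h = ∃ λ m → ∃ λ n →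
    Σ (Vector K.Carrier m) λ num → Σ (Vector K.Carrier n) λ den →
    eval den x # 0# × eval den x * h ≈ eval num x

  IsFiniteOver : F.Carrier → Set (c ⊔ ℓ₁ ⊔ ℓ₂)
  IsFiniteOver x = ∃ λ n → Σ (Vector F.Carrier n) λ b → ∀ f →
    Σ (Vector F.Carrier n) λ h → (∀ i → RationalIn x (h i)) × f ≈ sum (λ i → h i * b i)

record GlobalFunctionField (q : ℕ) (c ℓ₁ ℓ₂ : Level) : Set (suc (c ⊔ ℓ₁ ⊔ ℓ₂)) where
  field
    extension : FieldExtension c ℓ₁ ℓ₂

  open FieldExtension extension public

  field
    cardinality        : Bijection (setoid (Fin q)) K.setoid
    finiteOverRational : ∃ λ x → ¬ IsAlgebraic x × IsFiniteOver x
    fullConstantField  : ∀ f → IsAlgebraic f → ∃ λ a → ι a F.≈ f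

module FunctionFieldTheory {q c ℓ₁ ℓ₂} (G : GlobalFunctionField q c ℓ₁ ℓ₂) where

  open GlobalFunctionField G public
  open F using (_≈_; _+_; _*_; _-_; _^F_; 0#; sum)

  -- A basis of V / W, where W ⊆ V are K-subspaces of F.
  record IsBasis {v w n} (V : Pred F.Carrier v) (W : Pred F.Carrier w)
                 (b : Vector F.Carrier n) : Set (c ⊔ ℓ₁ ⊔ v ⊔ w) where
    field
      contained   : ∀ i → V (b i)
      independent : ∀ a → W (combination a b) → ∀ i → a i K.≈ K.0#
      spanning    : ∀ {f} → V f → ∃ λ a → W (f - combination a b)

  HasDimension : ∀ {v w} → Pred F.Carrier v → Pred F.Carrier w → ℕ → Set (c ⊔ ℓ₁ ⊔ v ⊔ w)
  HasDimension V W n = Σ (Vector F.Carrier n) (IsBasis V W)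

  -- A place is given by its normalized valuation, so that equality of places
  -- is _≈ᴾ_ below.
  record Place : Set (c ⊔ ℓ₁ ⊔ ℓ₂) where
    field
      ν         : F.Carrier → ℤ∞
      ν-cong    : ∀ {f g} → f ≈ g → ν f ≡ ν g
      ν-∞       : ∀ {f} → (ν f ≡ ⊤⁺) ⇔ (f ≈ 0#)
      ν-*       : ∀ f g → ν (f * g) ≡ ν f +∞ ν g
      ν-+       : ∀ f g → (ν f ⊓∞ ν g) ≤∞ ν (f + g)
      ν-trivial : ∀ {a} → a K.# K.0# → ν (ι a) ≡ [ 0ℤ ]
      ν-normal  : ∃ λ t → ν t ≡ [ 1ℤ ]

  open Place public using (ν)

  _≈ᴾ_ : Place → Place → Set c
  P ≈ᴾ Q = ∀ f → ν P f ≡ ν Q f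

  𝒪 𝔪 : Place → Pred F.Carrier _
  𝒪 P f = [ 0ℤ ] ≤∞ ν P f
  𝔪 P f = [ 1ℤ ] ≤∞ ν P f

  HasDegree : Place → ℕ → Set (c ⊔ ℓ₁)
  HasDegree P = HasDimension (𝒪 P) (𝔪 P)

  -- A finite formal sum of pairwise distinct places; places that are not
  -- listed have coefficient 0, and listed coefficients may also be 0.
  record Divisor : Set (c ⊔ ℓ₁ ⊔ ℓ₂) where
    field
      terms    : List (Place × ℤ)
      distinct : AllPairs (λ s t → ¬ (proj₁ s ≈ᴾ proj₁ t)) terms

  open Divisor public using (terms)

  data TotalDegree : List (Place × ℤ) → ℤ → Set (c ⊔ ℓ₁ ⊔ ℓ₂) where
    []  : TotalDegree [] 0ℤ
    _∷_ : ∀ {P n d ts t} → HasDegree P d → TotalDegree ts t →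
          TotalDegree ((P , n) ∷ ts) (n ℤ.* + d ℤ.+ t)

  HasDivisorDegree : Divisor → ℤ → Set (c ⊔ ℓ₁ ⊔ ℓ₂)
  HasDivisorDegree D = TotalDegree (terms D)

  infixr 7 _·_
  _·_ : ℤ → Place → Divisor
  n · P = record { terms = (P , n) ∷ [] ; distinct = All.[] ∷ [] }

  -- The Riemann-Roch space; it contains 0 because ν P 0 = ⊤⁺ for all P.
  ℒ : Divisor → Pred F.Carrier (c ⊔ ℓ₁ ⊔ ℓ₂)
  ℒ D f =
    All (λ t → [ ℤ.- proj₂ t ] ≤∞ ν (proj₁ t) f) (terms D) ×
    (∀ Q → All (λ t → ¬ (Q ≈ᴾ proj₁ t)) (terms D) → [ 0ℤ ] ≤∞ ν Q f)

  Hasℓ : Divisor → ℕ → Set (c ⊔ ℓ₁ ⊔ ℓ₂)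
  Hasℓ D = HasDimension (ℒ D) (_≈ 0#)

  -- The genus is the maximum of deg D - ℓ(D) + 1 over all divisors D.
  record IsGenus (g : ℕ) : Set (c ⊔ ℓ₁ ⊔ ℓ₂) where
    field
      upperBound : ∀ D {d l} → HasDivisorDegree D d → Hasℓ D l → d ℤ.- + l ℤ.+ 1ℤ ℤ.≤ + g
      attained   : ∃ λ D → ∃ λ d → ∃ λ l →
                   HasDivisorDegree D d × Hasℓ D l × d ℤ.- + l ℤ.+ 1ℤ ≡ + g

  IsGap : Place → ℕ → Set (c ⊔ ℓ₁ ⊔ ℓ₂)
  IsGap P n = 0 < n × ∃ λ l → Hasℓ (+ n · P) l × Hasℓ ((+ n ℤ.- 1ℤ) · P) l

  -- The completion of F at P consists of the Cauchy sequences modulo the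
  -- sequences converging to 0, with pointwise operations.
  module Completion (P : Place) where

    Sequence : Set c
    Sequence = ℕ → F.Carrier

    IsCauchy : Pred Sequence _
    IsCauchy α = ∀ M → ∃ λ N → ∀ m n → N ≤ m → N ≤ n → [ M ] ≤∞ ν P (α m - α n)

    -- The extension of ν P to the completion takes a value ≥ M at α.
    ν̂≥ : ℤ → Pred Sequence _
    ν̂≥ M α = Eventually λ n → [ M ] ≤∞ ν P (α n)

    _≃_ : Sequence → Sequence → Set
    α ≃ β = ∀ M → ν̂≥ M (λ n → α n - β n)

    const : F.Carrier → Sequence
    const f _ = f

    ConvergesTo : (ℕ → Sequence) → Sequence → Set
    ConvergesTo S α = ∀ M → Eventually λ N → ν̂≥ M (λ n → α n - S N n)

    -- The embedding of the residue class field as a field of coefficients: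
    -- a homomorphism of K-algebras from 𝒪 P / 𝔪 P to the completion that is
    -- a section of the residue class map.  There is exactly one, because the
    -- finite residue class field is separable over K (Hensel's lemma).  With
    -- a local parameter z, it identifies the completion with the field of
    -- Laurent series in z over the residue class field.
    record CoefficientField : Set (c ⊔ ℓ₁) where
      field
        σ       : F.Carrier → Sequence
        cauchy  : ∀ {a} → 𝒪 P a → IsCauchy (σ a)
        cong    : ∀ {a b} → 𝒪 P a → 𝒪 P b → 𝔪 P (a - b) → σ a ≃ σ b
        +-homo  : ∀ {a b} → 𝒪 P a → 𝒪 P b → σ (a + b) ≃ (λ n → σ a n + σ b n)
        *-homo  : ∀ {a b} → 𝒪 P a → 𝒪 P b → σ (a * b) ≃ (λ n → σ a n * σ b n)
        ι-homo  : ∀ a → σ (ι a) ≃ const (ι a)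
        section : ∀ {a} → 𝒪 P a → ν̂≥ 1ℤ (λ n → σ a n - a)

      partialSum : F.Carrier → (ℕ → F.Carrier) → ℕ → Sequence
      partialSum z β N n = sum {N} λ k → σ (β (toℕ k)) n * (z ^F toℕ k)

      IsLocalExpansion : (z y : F.Carrier) → (ℕ → F.Carrier) → Set
      IsLocalExpansion z y β =
        ConvergesTo (partialSum z β) (const y)

  record ColumnwiseConstruction {s} (P∞ : Place) (P : Fin s → Place) (e : Fin s → ℕ)
                                : Set (c ⊔ ℓ₁ ⊔ ℓ₂) where
    field
      nonGap            : ℕ → ℕ
      nonGap-increasing : ∀ {r r′} → r < r′ → nonGap r < nonGap r′
      nonGap-sound      : ∀ r → ¬ IsGap P∞ (nonGap r)
      nonGap-complete   : ∀ n → ¬ IsGap P∞ n → ∃ λ r → nonGap r ≡ n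

      y  : ℕ → F.Carrier
      y∈ : ∀ r → ℒ (+ nonGap r · P∞) (y r)
      y∉ : ∀ r → ¬ ℒ ((+ nonGap r ℤ.- 1ℤ) · P∞) (y r)

      z       : Fin s → F.Carrier
      z-local : ∀ i → ν (P i) (z i) ≡ [ 1ℤ ]

      coefficientField : ∀ i → Completion.CoefficientField (P i)

      -- Residue classes are given by representatives in the valuation ring.
      β         : Fin s → ℕ → ℕ → F.Carrier
      β∈𝒪       : ∀ i k r → 𝒪 (P i) (β i k r)
      expansion : ∀ i r → Completion.CoefficientField.IsLocalExpansion
                            (coefficientField i) (z i) (y r) (λ k → β i k r)

      basis         : ∀ i → Vector F.Carrier (e i)
      basis-isBasis : ∀ i → IsBasis (𝒪 (P i)) (𝔪 (P i)) (basis i)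

      coordinates         : ∀ i → ℕ → ℕ → Vector K.Carrier (e i)
      coordinates-correct : ∀ i k r →
        𝔪 (P i) (β i k r - combination (coordinates i k r) (basis i))

      -- Rows are numbered from 0: row j here is row j + 1 of C⁽ⁱ⁾.
      matrix         : Fin s → ℕ → ℕ → K.Carrier
      matrix-entries : ∀ i k (h : Fin (e i)) r →
        matrix i (k ℕ.* e i ℕ.+ toℕ h) r K.≈ coordinates i k r h

module NetsAndSequences (b : ℕ) .{{_ : NonTrivial b}} where

  open RawSemiringDefs ℚ.+-*-rawSemiring using (sum; product)

  fromℕ : ℕ → ℚ
  fromℕ n = (+ n) ℚ./ 1

  infixl 7 _/b^_
  _/b^_ : ℕ → ℕ → ℚ
  a /b^ d = ((+ a) ℚ./ (b ^ d)) {{m^n≢0 b d {{nonTrivial⇒nonZero b}}}}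

  record Interval {s} (e : Fin s → ℕ) : Set where
    field
      d   : Fin s → ℕ
      a   : Fin s → ℕ
      a<  : ∀ i → a i < b ^ d i
      e∣d : ∀ i → e i ∣ d i

    volume : ℚ
    volume = product λ i → 1 /b^ d i

    Contains : (Fin s → ℚ) → Set
    Contains x = ∀ i → a i /b^ d i ℚ.≤ x i × x i ℚ.< ℕ.suc (a i) /b^ d i

    contains? : ∀ x → Dec (Contains x)
    contains? x = all? λ i →
      (a i /b^ d i ℚ.≤? x i) ×-dec (x i ℚ.<? ℕ.suc (a i) /b^ d i)

    count : ∀ {N} → (Fin N → Fin s → ℚ) → ℕ
    count {N} x = length (filter (λ n → contains? (x n)) (allFin N))

  IsNet : ∀ {s} (u m : ℕ) → (Fin s → ℕ) → (Fin (b ^ m) → Fin s → ℚ) → Set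
  IsNet u m e x =
    u ≤ m ×
    (∀ n i → 0ℚ ℚ.≤ x n i × x n i ℚ.< 1ℚ) ×
    (∀ (J : Interval e) → let open Interval J in
      1 /b^ (m ∸ u) ℚ.≤ volume → fromℕ (count x) ≡ fromℕ (b ^ m) ℚ.* volume)

  -- Digit j (counted from 0) has weight b^-(j+1).
  truncate : ℕ → (ℕ → Fin b) → ℚ
  truncate m x = sum {m} λ j → toℕ (x (toℕ j)) /b^ ℕ.suc (toℕ j)

  -- A point of [0,1]^s is given by a digit expansion of each coordinate, on
  -- which its truncations depend.
  IsSequence : ∀ {s} → ℕ → (Fin s → ℕ) → (ℕ → Fin s → ℕ → Fin b) → Set
  IsSequence u e x = ∀ k m → u < m →
    IsNet u m e (λ n i → truncate m (x (k ℕ.* b ^ m ℕ.+ toℕ n) i))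

module DigitalMethod {q c ℓ₁ ℓ₂} .{{_ : NonTrivial q}} (G : GlobalFunctionField q c ℓ₁ ℓ₂) where

  open GlobalFunctionField G
  open RawSemiringDefs (Semiring.rawSemiring K.semiring) using (sum)

  private instance
    q≢0 : NonZero q
    q≢0 = nonTrivial⇒nonZero q

  record DigitMaps (s : ℕ) : Set (c ⊔ ℓ₁) where
    field
      ψ      : ℕ → Bijection (setoid (Fin q)) K.setoid
      bound  : ℕ
      ψ-zero : ∀ r → bound ≤ r → Bijection.to (ψ r) (0 mod q) K.≈ K.0#
      Λ      : Fin s → ℕ → Bijection K.setoid (setoid (Fin q))

  digit : ℕ → ℕ → Fin q
  digit r n = (ℕ._/_ n (q ^ r) {{m^n≢0 q r}}) mod q

  module _ {s} (maps : DigitMaps s) (C : Fin s → ℕ → ℕ → K.Carrier) where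
    open DigitMaps maps

    -- The terms with r ≥ bound + n vanish: q ^ r > n, so that digit r n = 0.
    output : ℕ → Fin s → ℕ → K.Carrier
    output n i j =
      sum {bound ℕ.+ n} λ r → C i j (toℕ r) K.* Bijection.to (ψ (toℕ r)) (digit (toℕ r) n)

    generatedSequence : ℕ → Fin s → ℕ → Fin q
    generatedSequence n i j = Bijection.to (Λ i j) (output n i j)

{-# OPTIONS --safe #-}
-- Write V for the span of y_0, …, y_(m-1), which is ℒ(n P∞) for n = n_(m-1).
-- The net property says that the Σ d_i rows belonging to an interval are
-- independent on the first m columns, i.e. that no nontrivial linear form φ in
-- the expansion coefficients of order < f_i = d_i / e_i at the P_i vanishes on V.
-- Assume that φ does vanish there. One of the Σ d_i ≤ m - g conditions for
-- belonging to the space W of the x ∈ V with ν_(P_i)(x) ≥ f_i is then redundant,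
-- so that dim W ≥ g + 1.
--
-- Then φ vanishes at all y_r: for the first exception y_R, the pole orders of W
-- provide g + 1 numbers p with p ≤ n_R, and as there are at most g gaps, some
-- n_R - p is a pole number n_r. So x y_r has the pole order of y_R for some
-- x ∈ W, hence φ(x y_r) ≠ 0, although x y_r satisfies ν_(P_i)(x y_r) ≥ f_i.
-- This replaces the duality part of the Riemann-Roch theorem.
--
-- But φ cannot vanish on all functions with poles at P∞ only. Let h ∈ W be
-- nonzero and O = Σ ν_(P_i)(h) P_i. Multiplication by h^j maps ℒ(j O) to such
-- functions, and the relation φ gives dim ℒ(j O) ≤ dim ℒ((j - 1) O) + deg O - 1.
-- For j = g + 1 this contradicts the definition of the genus.
--
-- Constructively, nonzero functions are invertible and dimensions exist only up
-- to double negation. This suffices, since equality in K and in F is decidable.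
module Submission where

-- In classical terms, W = ℒ(D) with D = n P∞ - Σ f_i P_i. A special divisor lies, up to linear
-- equivalence, below a canonical one, whose space has dimension g. So ℓ(D) ≥ g + 1 makes D and n P∞
-- nonspecial, hence ℓ(n P∞) - ℓ(D) = Σ d_i, and no condition can be redundant. The genus, however,
-- is given as the maximum of deg D - ℓ(D) + 1, which is Riemann's inequality only. The relation φ
-- itself therefore plays the part of a differential: multiplying it by g + 1 independent elements
-- of W is what exceeds the genus, and comparing pole orders at the rational place P∞ turns this
-- into a count of gaps. A second obstacle is that the digits in the matrices refer to a coefficient
-- field inside the completion, whose elements need not lie in F. The arguments about φ take place
-- in F, with bases that approximate the coefficient fields up to the finitely many digits at stake.

open import Defs
open import Algebra.Apartness.Bundles using (HeytingField)
open import Algebra.Bundles using (CommutativeRing)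
open import Algebra.Bundles.Raw using (RawRing)
import Algebra.Definitions.RawSemiring as RawSemiringDefs
open import Algebra.Morphism.Structures using (IsRingHomomorphism)
import Algebra.Properties.AbelianGroup
import Algebra.Properties.CommutativeMonoid.Sum as MonoidSum
import Algebra.Properties.Ring as RingProperties
import Algebra.Properties.Semiring.Mult
import Algebra.Properties.Semiring.Sum as SemiringSum
import Algebra.Solver.Ring
open import Algebra.Solver.Ring.AlmostCommutativeRing using (fromCommutativeRing; _-Raw-AlmostCommutative⟶_)
open import Data.Empty using (⊥)
open import Data.Fin.Base as Fin using (Fin; zero; suc; toℕ; punchIn; punchOut; combine; remQuot; splitAt; _↑ˡ_; _↑ʳ_)
import Data.Fin.Properties as Fin
open import Data.Integer.Base as ℤ using (ℤ; +_; 0ℤ; 1ℤ)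
import Data.Integer.Properties as ℤ
open import Data.List.Base as List using (List; []; _∷_; length; filter)
open import Data.List.Relation.Unary.All as All using (All; []; _∷_)
import Data.List.Relation.Unary.All.Properties as All
open import Data.List.Relation.Unary.AllPairs using (AllPairs; []; _∷_)
import Data.List.Relation.Unary.AllPairs.Properties as AllPairs
open import Data.List.Relation.Unary.Any using (Any; here; there)
open import Data.Maybe.Base using (just; nothing)
open import Data.Nat.Base as ℕ using (ℕ; zero; suc; _≤_; _<_; _∸_; z≤n; s≤s; _^_; NonZero; NonTrivial; nonTrivial⇒nonZero)
import Data.Nat.Divisibility as ℕ
import Data.Nat.DivMod as ℕ
import Data.Nat.Properties as ℕ
open import Data.Nat.Solver using (module +-*-Solver)
open import Data.Product.Base using (Σ; ∃; _×_; _,_; proj₁; proj₂)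
open import Data.Rational.Base as ℚ using (ℚ; 0ℚ; 1ℚ)
import Data.Rational.Properties as ℚ
open import Data.Rational.Unnormalised.Base as ℚᵘ using (mkℚᵘ; *≤*; *<*)
import Data.Rational.Unnormalised.Properties as ℚᵘ
open import Data.Sum.Base as Sum using (_⊎_; inj₁; inj₂)
open import Data.Unit.Base using (⊤)
open import Data.Vec.Functional as Vector using (Vector; insertAt) renaming (_∷_ to _◂_)
import Data.Vec.Functional.Properties as Vector
open import Function.Base using (_∘_; id)
open import Function.Bundles using (Bijection; Equivalence)
open import Level using (Level; _⊔_)
open import Relation.Binary.Construct.Add.Supremum.NonStrict ℤ._≤_ using ([_]; _≤⊤⁺; [≤]-injective; ≤⁺-trans; ≤⁺-dec) renaming (_≤⁺_ to _≤∞_)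
open import Relation.Binary.Definitions using (WeaklyDecidable)
open import Relation.Binary.PropositionalEquality as ≡ using (_≡_; _≢_)
import Relation.Binary.Reasoning.Setoid as SetoidReasoning
open import Relation.Nullary using (¬_; Dec; yes; no; contradiction)
open import Relation.Nullary.Construct.Add.Supremum using ([_]; ⊤⁺)
open import Relation.Nullary.Decidable using (map′; ¬?; decidable-stable)
open import Relation.Unary using (Pred; Decidable)

-- Polynomial identities in commutative rings

-- The solver needs coefficients with a computing equality; formal differences
-- of natural numbers provide them in every commutative ring.
module RingSolver {c ℓ} (R : CommutativeRing c ℓ) where
  open CommutativeRing R
  open Algebra.Properties.AbelianGroup +-abelianGroup using (⁻¹-∙-comm; ⁻¹-anti-homo‿-)
  open RingProperties ring using (-‿distribˡ-*; -‿distribʳ-*; -0#≈0#; x[y-z]≈xy-xz; [y-z]x≈yx-zx)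
  open Algebra.Properties.Semiring.Mult semiring
    using (×-homo-+; ×1-homo-*; ×-congˡ) renaming (_×_ to _·1×_)
  open SetoidReasoning setoid

  private
    ⟪_⟫ : ℕ → Carrier
    ⟪ n ⟫ = n ·1× 1#

    interchange : ∀ w x y z → (w + x) - (y + z) ≈ (w - y) + (x - z)
    interchange w x y z = begin
      (w + x) - (y + z)       ≈⟨ +-congˡ (⁻¹-∙-comm y z) ⟨
      (w + x) + (- y + - z)   ≈⟨ +-assoc w x _ ⟩
      w + (x + (- y + - z))   ≈⟨ +-congˡ (+-assoc x _ _) ⟨
      w + ((x + - y) + - z)   ≈⟨ +-congˡ (+-congʳ (+-comm x (- y))) ⟩
      w + ((- y + x) + - z)   ≈⟨ +-congˡ (+-assoc _ x _) ⟩
      w + (- y + (x + - z))   ≈⟨ +-assoc w _ _ ⟨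
      (w - y) + (x - z)       ∎

    differences : RawRing _ _
    differences = record
      { Carrier = ℕ × ℕ
      ; _≈_ = λ (a , b) (c , d) → a ℕ.+ d ≡ c ℕ.+ b
      ; _+_ = λ (a , b) (c , d) → a ℕ.+ c , b ℕ.+ d
      ; _*_ = λ (a , b) (c , d) → a ℕ.* c ℕ.+ b ℕ.* d , a ℕ.* d ℕ.+ b ℕ.* c
      ; -_  = λ (a , b) → b , a
      ; 0#  = 0 , 0
      ; 1#  = 1 , 0
      }

    module D = RawRing differences

    ⟦_⟧ : D.Carrier → Carrier
    ⟦ a , b ⟧ = ⟪ a ⟫ - ⟪ b ⟫

    ⟦⟧-homo-+ : ∀ x y → ⟦ x D.+ y ⟧ ≈ ⟦ x ⟧ + ⟦ y ⟧
    ⟦⟧-homo-+ (a , b) (c , d) =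
      trans (+-cong (×-homo-+ 1# a c) (-‿cong (×-homo-+ 1# b d)))
            (interchange ⟪ a ⟫ ⟪ c ⟫ ⟪ b ⟫ ⟪ d ⟫)

    ⟪⟫-homo : ∀ a b c d → ⟪ a ℕ.* b ℕ.+ c ℕ.* d ⟫ ≈ ⟪ a ⟫ * ⟪ b ⟫ + ⟪ c ⟫ * ⟪ d ⟫
    ⟪⟫-homo a b c d =
      trans (×-homo-+ 1# (a ℕ.* b) (c ℕ.* d)) (+-cong (×1-homo-* a b) (×1-homo-* c d))

    ⟦⟧-homo-* : ∀ x y → ⟦ x D.* y ⟧ ≈ ⟦ x ⟧ * ⟦ y ⟧
    ⟦⟧-homo-* (a , b) (c , d) = begin
      ⟪ a ℕ.* c ℕ.+ b ℕ.* d ⟫ - ⟪ a ℕ.* d ℕ.+ b ℕ.* c ⟫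
        ≈⟨ +-cong (⟪⟫-homo a c b d) (-‿cong (⟪⟫-homo a d b c)) ⟩
      (A * C + B * D′) - (A * D′ + B * C)
        ≈⟨ interchange _ _ _ _ ⟩
      (A * C - A * D′) + (B * D′ - B * C)
        ≈⟨ +-congˡ (⁻¹-anti-homo‿- (B * C) (B * D′)) ⟨
      (A * C - A * D′) - (B * C - B * D′)
        ≈⟨ +-cong (x[y-z]≈xy-xz A C D′) (-‿cong (x[y-z]≈xy-xz B C D′)) ⟨
      A * (C - D′) - B * (C - D′)
        ≈⟨ [y-z]x≈yx-zx (C - D′) A B ⟨
      (A - B) * (C - D′) ∎
      where
      A = ⟪ a ⟫
      B = ⟪ b ⟫
      C = ⟪ c ⟫
      D′ = ⟪ d ⟫

    cancel : ∀ {a b c d} → a ℕ.+ d ≡ c ℕ.+ b → ⟦ a , b ⟧ ≈ ⟦ c , d ⟧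
    cancel {a} {b} {c} {d} eq = begin
      A - B               ≈⟨ +-congʳ (+-identityʳ A) ⟨
      (A + 0#) - B        ≈⟨ +-congʳ (+-congˡ (-‿inverseʳ D′)) ⟨
      (A + (D′ - D′)) - B ≈⟨ +-congʳ (+-assoc A D′ (- D′)) ⟨
      ((A + D′) - D′) - B ≈⟨ +-congʳ (+-congʳ sums) ⟩
      ((C + B) - D′) - B  ≈⟨ +-assoc _ _ _ ⟩
      (C + B) + (- D′ - B) ≈⟨ +-congˡ (⁻¹-∙-comm D′ B) ⟩
      (C + B) - (D′ + B)  ≈⟨ interchange C B D′ B ⟩
      (C - D′) + (B - B)  ≈⟨ +-congˡ (-‿inverseʳ B) ⟩
      (C - D′) + 0#       ≈⟨ +-identityʳ _ ⟩
      C - D′              ∎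
      where
      A = ⟪ a ⟫
      B = ⟪ b ⟫
      C = ⟪ c ⟫
      D′ = ⟪ d ⟫
      sums : A + D′ ≈ C + B
      sums = trans (sym (×-homo-+ 1# a d)) (trans (×-congˡ eq) (×-homo-+ 1# c b))

    -- The values at 0 and 1 are 0# and 1# on the nose, so that constants in
    -- a goal match those of the solver.
    value : D.Carrier → Carrier
    value (0 , 0) = 0#
    value (1 , 0) = 1#
    value x       = ⟦ x ⟧

    value≈ : ∀ x → value x ≈ ⟦ x ⟧
    value≈ (0 , 0)           = sym (-‿inverseʳ 0#)
    value≈ (1 , 0)           = sym (trans (+-cong (+-identityʳ 1#) -0#≈0#) (+-identityʳ 1#))
    value≈ (0 , suc _)       = refl
    value≈ (1 , suc _)       = refl
    value≈ (suc (suc _) , _) = refl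

    morphism : differences -Raw-AlmostCommutative⟶ fromCommutativeRing R
    morphism = record
      { ⟦_⟧    = value
      ; +-homo = λ x y → trans (value≈ (x D.+ y))
          (trans (⟦⟧-homo-+ x y) (sym (+-cong (value≈ x) (value≈ y))))
      ; *-homo = λ x y → trans (value≈ (x D.* y))
          (trans (⟦⟧-homo-* x y) (sym (*-cong (value≈ x) (value≈ y))))
      ; -‿homo = λ (a , b) → trans (value≈ (b , a))
          (trans (sym (⁻¹-anti-homo‿- ⟪ a ⟫ ⟪ b ⟫)) (sym (-‿cong (value≈ (a , b)))))
      ; 0-homo = refl
      ; 1-homo = refl
      }

    _coeff≟_ : WeaklyDecidable λ x y → value x ≈ value y
    (a , b) coeff≟ (c , d) with a ℕ.+ d ℕ.≟ c ℕ.+ b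
    ... | yes eq =
      just (trans (value≈ (a , b)) (trans (cancel {a} {b} {c} {d} eq) (sym (value≈ (c , d)))))
    ... | no _   = nothing

  open Algebra.Solver.Ring differences (fromCommutativeRing R) morphism _coeff≟_ public
    using (solve; _:=_; _:+_; _:*_; _:-_; :-_; con; Polynomial)

  :0 :1 : ∀ {n} → Polynomial n
  :0 = con (0 , 0)
  :1 = con (1 , 0)

-- Case distinction on any proposition, as long as the goal is ⊥. Stability of decidable goals
-- brings proofs into this form.
excluded-middle : ∀ {a} {A : Set a} → (Dec A → ⊥) → ⊥
excluded-middle k = k (no (k ∘ yes))

-- Linear algebra over the finite constant field

module LinearAlgebra {q : ℕ} {c ℓ₁ ℓ₂ : Level} (G : GlobalFunctionField q c ℓ₁ ℓ₂) where

  open FunctionFieldTheory G public hiding (ι-isRingHomomorphism)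
  open F using (_≈_; _+_; _*_; _-_; 0#)

  FField KField : CommutativeRing _ _
  FField = commutativeRing functionField
  KField = commutativeRing constantField

  module ΣF = SemiringSum F.semiring
  module ΣK = SemiringSum K.semiring
  module SolverF = RingSolver FField
  module SolverK = RingSolver KField
  module ι = IsRingHomomorphism (FunctionFieldTheory.ι-isRingHomomorphism G)
  private
    module KRing = RingProperties K.ring

    enum : Fin q → K.Carrier
    enum = Bijection.to cardinality

    index : K.Carrier → Fin q
    index a = proj₁ (Bijection.surjective cardinality a)

    enum-index : ∀ a → enum (index a) K.≈ a
    enum-index a = proj₂ (Bijection.surjective cardinality a) ≡.refl

  _≟K_ : ∀ a b → Dec (a K.≈ b)
  a ≟K b = map′
    (λ eq → K.trans (K.sym (enum-index a)) (K.trans (K.reflexive (≡.cong enum eq)) (enum-index b)))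
    (λ eq → Bijection.injective cardinality
      (K.trans (enum-index a) (K.trans eq (K.sym (enum-index b)))))
    (index a Fin.≟ index b)

  any-scalar? : ∀ {p} {A : Pred K.Carrier p} → (∀ {a b} → a K.≈ b → A a → A b) →
                (∀ a → Dec (A a)) → Dec (∃ A)
  any-scalar? resp A? = map′
    (λ (i , x) → enum i , x)
    (λ (a , x) → index a , resp (K.sym (enum-index a)) x)
    (Fin.any? (A? ∘ enum))

  any-vector? : ∀ {p} n {A : Pred (Vector K.Carrier n) p} →
                (∀ {a b} → (∀ i → a i K.≈ b i) → A a → A b) →
                (∀ a → Dec (A a)) → Dec (∃ A)
  any-vector? zero resp A? = map′
    (λ x → Vector.[] , x) (λ (a , x) → resp {a} {Vector.[]} (λ ()) x) (A? Vector.[])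
  any-vector? (suc n) {A} resp A? = map′
    (λ (a₀ , a , x) → a₀ ◂ a , x)
    (λ (a , x) → a zero , a ∘ suc , resp (λ { zero → K.refl ; (suc i) → K.refl }) x)
    (any-scalar? {A = λ a₀ → ∃ λ a → A (a₀ ◂ a)}
      (λ eq (a , x) → a , resp (λ { zero → eq ; (suc i) → K.refl }) x)
      (λ a₀ → any-vector? n (λ eq → resp (λ { zero → K.refl ; (suc i) → eq i })) (A? ∘ (a₀ ◂_))))

  private module HK = HeytingField constantField

  -- Tightness of the apartness only refutes that `a` has no inverse. The search for `b` in the
  -- finite field removes this double negation.
  K-inverse : ∀ {a} → ¬ (a K.≈ K.0#) → ∃ λ b → b K.* a K.≈ K.1#
  K-inverse {a} a≉0 = decidable-stable
    (any-scalar? (λ eq x → K.trans (K.*-congʳ (K.sym eq)) x) (λ b → (b K.* a) ≟K K.1#))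
    λ none → a≉0 (proj₁ (HK.tight a K.0#) λ a#0 →
      let b , left , _ = HK.#⇒invertible a#0 in
      none (b , K.trans (K.*-congˡ (K.sym (K.trans (K.+-congˡ KRing.-0#≈0#) (K.+-identityʳ a)))) left))

  -- Invertibility implies apartness, and apartness is what `ν-trivial` asks for.
  ≉0⇒# : ∀ {a} → ¬ (a K.≈ K.0#) → a K.# K.0#
  ≉0⇒# {a} a≉0 =
    let b , ba≈1 = K-inverse a≉0
        a-0≈a = K.trans (K.+-congˡ KRing.-0#≈0#) (K.+-identityʳ a)
    in HK.invertible⇒# (b , K.trans (K.*-congˡ a-0≈a) ba≈1 ,
                            K.trans (K.*-comm _ b) (K.trans (K.*-congˡ a-0≈a) ba≈1))

  K-integral : ∀ {a b} → ¬ (a K.≈ K.0#) → a K.* b K.≈ K.0# → b K.≈ K.0#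
  K-integral {a} {b} a≉0 ab≈0 = begin
    b                ≈⟨ K.*-identityˡ b ⟨
    K.1# K.* b       ≈⟨ K.*-congʳ (proj₂ (K-inverse a≉0)) ⟨
    a⁻¹ K.* a K.* b  ≈⟨ K.*-assoc a⁻¹ a b ⟩
    a⁻¹ K.* (a K.* b) ≈⟨ K.*-congˡ ab≈0 ⟩
    a⁻¹ K.* K.0#     ≈⟨ K.zeroʳ a⁻¹ ⟩
    K.0#             ∎
    where
    open SetoidReasoning K.setoid
    a⁻¹ = proj₁ (K-inverse a≉0)

  -- In the zero ring a local parameter would be 0, with value `⊤⁺` instead of 1.
  K-nontrivial : Place → ¬ (K.1# K.≈ K.0#)
  K-nontrivial P 1≈0 with Place.ν-normal P
  ... | t , νt≡1 with ≡.trans (≡.sym νt≡1) (Equivalence.from (Place.ν-∞ P) t≈0)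
    where
    t≈0 : t ≈ 0#
    t≈0 = F.trans (F.sym (F.*-identityˡ t)) (F.trans (F.*-congʳ (F.trans (F.sym ι.1#-homo)
      (F.trans (ι.⟦⟧-cong 1≈0) ι.0#-homo))) (F.zeroˡ t))
  ... | ()

  combination-cong : ∀ {n} {a b : Vector K.Carrier n} {v w : Vector F.Carrier n} →
                     (∀ i → a i K.≈ b i) → (∀ i → v i ≈ w i) → combination a v ≈ combination b w
  combination-cong a≈b v≈w = ΣF.sum-cong-≋ λ i → F.*-cong (ι.⟦⟧-cong (a≈b i)) (v≈w i)

  combination-zero : ∀ {n} {a : Vector K.Carrier n} (v : Vector F.Carrier n) →
                     (∀ i → a i K.≈ K.0#) → combination a v ≈ 0#
  combination-zero {n} v a≈0 = F.trans
    (ΣF.sum-cong-≋ λ i → F.trans (F.*-congʳ (F.trans (ι.⟦⟧-cong (a≈0 i)) ι.0#-homo)) (F.zeroˡ (v i)))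
    (ΣF.sum-replicate-zero n)

  ι-minus : ∀ a b → ι (a K.- b) ≈ ι a - ι b
  ι-minus a b = F.trans (ι.+-homo a (K.- b)) (F.+-congˡ (ι.-‿homo b))

  combination-minus : ∀ {n} (a b : Vector K.Carrier n) x (v : Vector F.Carrier n) →
    combination (λ i → a i K.- x K.* b i) v ≈ combination a v - ι x * combination b v
  combination-minus {zero}  a b x v = SolverF.solve 1 (λ x → :0 := :0 :- x :* :0) F.refl (ι x)
    where open SolverF
  combination-minus {suc n} a b x v = F.trans
    (F.+-cong
      (F.*-congʳ (F.trans (ι-minus (a zero) _) (F.+-congˡ (F.-‿cong (ι.*-homo x (b zero))))))
      (combination-minus (a ∘ suc) (b ∘ suc) x (v ∘ suc)))
    (SolverF.solve 6 (λ a x b v s t →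
      (a :- x :* b) :* v :+ (s :- x :* t) := (a :* v :+ s) :- x :* (b :* v :+ t))
      F.refl (ι (a zero)) (ι x) (ι (b zero)) (v zero)
      (combination (a ∘ suc) (v ∘ suc)) (combination (b ∘ suc) (v ∘ suc)))
    where open SolverF

  combination-shift : ∀ {n} (a b : Vector K.Carrier n) w (v : Vector F.Carrier n) →
    combination a (λ i → v i - ι (b i) * w) ≈ combination a v - ι (ΣK.sum (λ i → a i K.* b i)) * w
  combination-shift {zero} a b w v = F.trans
    (SolverF.solve 1 (λ w → :0 := :0 :- :0 :* w) F.refl w)
    (F.+-congˡ (F.-‿cong (F.*-congʳ (F.sym ι.0#-homo))))
    where open SolverF
  combination-shift {suc n} a b w v = F.trans
    (F.+-congˡ (combination-shift (a ∘ suc) (b ∘ suc) w (v ∘ suc)))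
    (F.trans
      (SolverF.solve 6 (λ a b v w s t →
        a :* (v :- b :* w) :+ (s :- t :* w) := (a :* v :+ s) :- (a :* b :+ t) :* w)
        F.refl (ι (a zero)) (ι (b zero)) (v zero) w _ _)
      (F.+-congˡ (F.-‿cong (F.*-congʳ (F.trans (F.+-congʳ (F.sym (ι.*-homo _ _)))
        (F.sym (ι.+-homo _ _)))))))
    where open SolverF

  unit : ∀ {n} → Fin n → Vector K.Carrier n
  unit zero    zero    = K.1#
  unit zero    (suc j) = K.0#
  unit (suc i) zero    = K.0#
  unit (suc i) (suc j) = unit i j

  combination-unit : ∀ {n} (i : Fin n) (v : Vector F.Carrier n) → combination (unit i) v ≈ v i
  combination-unit zero v = F.trans
    (F.+-cong (F.trans (F.*-congʳ ι.1#-homo) (F.*-identityˡ _)) (combination-zero (v ∘ suc) (λ _ → K.refl)))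
    (F.+-identityʳ _)
  combination-unit (suc i) v = F.trans
    (F.+-cong (F.trans (F.*-congʳ ι.0#-homo) (F.zeroˡ _)) (combination-unit i (v ∘ suc)))
    (F.+-identityˡ _)

  Independent : ∀ {n} → Pred (Vector F.Carrier n) (c ⊔ ℓ₁)
  Independent v = ∀ a → combination a v ≈ 0# → ∀ i → a i K.≈ K.0#

  -- To be read as dim V ≥ n, and `¬ HasIndependent V (suc n)` as dim V ≤ n. Both make sense before
  -- any basis of V is known.
  record HasIndependent {v} (V : Pred F.Carrier v) (n : ℕ) : Set (c ⊔ ℓ₁ ⊔ v) where
    constructor family
    field
      vectors     : Vector F.Carrier n
      contained   : ∀ i → V (vectors i)
      independent : Independent vectors

  independent-⊆ : ∀ {v w n} {V : Pred F.Carrier v} {W : Pred F.Carrier w} →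
                  (∀ {f} → V f → W f) → HasIndependent V n → HasIndependent W n
  independent-⊆ V⊆W (family v v∈ ind) = family v (V⊆W ∘ v∈) ind

  independent-zero : ∀ {v} {V : Pred F.Carrier v} → HasIndependent V 0
  independent-zero = family (λ ()) (λ ()) λ _ _ ()

  independent-pred : ∀ {v n} {V : Pred F.Carrier v} → HasIndependent V (suc n) → HasIndependent V n
  independent-pred (family v v∈ ind) = family (v ∘ suc) (v∈ ∘ suc) λ a a≈0 i →
    ind (K.0# ◂ a) (F.trans (F.+-cong (F.trans (F.*-congʳ ι.0#-homo) (F.zeroˡ _)) a≈0) (F.+-identityˡ _)) (suc i)

  independent-≤ : ∀ {v m n} {V : Pred F.Carrier v} → m ≤ n → HasIndependent V n → HasIndependent V m
  independent-≤ {m = m} {V = V} m≤n h with ℕ.m≤n⇒∃[o]m+o≡n m≤n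
  ... | o , eq = drop o (≡.subst (HasIndependent V) (≡.trans (≡.sym eq) (ℕ.+-comm m o)) h)
    where
    drop : ∀ o {m} → HasIndependent V (o ℕ.+ m) → HasIndependent V m
    drop zero    = id
    drop (suc o) = drop o ∘ independent-pred

  independent-nonzero : ∀ {v n} {V : Pred F.Carrier v} → Place → HasIndependent V (suc n) →
                        ∃ λ f → V f × ¬ (f ≈ 0#)
  independent-nonzero P (family v v∈ ind) = v zero , v∈ zero , λ v₀≈0 →
    K-nontrivial P (ind (unit zero) (F.trans (combination-unit zero v) v₀≈0) zero)

  -- A linear relation between elements and coefficient families; no
  -- coefficient family has to be singled out for an element that has several.
  IsLinear : ∀ {i x} {I : Set i} → (F.Carrier → (I → K.Carrier) → Set x) → Set _
  IsLinear Coord = ∀ {f g a b} → Coord f a → Coord g b → ∀ x →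
                   Coord (f - ι x * g) (λ p → a p K.- x K.* b p)

  module _ {i x} {I : Set i} {Coord : F.Carrier → (I → K.Carrier) → Set x}
           (linear : IsLinear Coord) where

    -- One linear condition costs at most one dimension. Unless all `p`-th coefficients vanish, a
    -- vector with a nonzero one is the pivot, and multiples of it are subtracted from the others.
    eliminate₁ : ∀ p {n} → HasIndependent (λ f → ∃ λ a → Coord f a) (suc n) →
                 HasIndependent (λ f → ∃ λ a → Coord f a × a p K.≈ K.0#) n
    eliminate₁ p {n} (family v v∈ ind) with Fin.any? (λ i → ¬? (proj₁ (v∈ i) p ≟K K.0#))
    ... | no all≈0 = independent-pred
      (family v (λ i → proj₁ (v∈ i) , proj₂ (v∈ i) , decidable-stable (_ ≟K _) (λ ≉0 → all≈0 (i , ≉0))) ind)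
    ... | yes (j , pivot≉0) = family w w∈ w-ind
      where
      value : Fin (suc n) → K.Carrier
      value i = proj₁ (v∈ i) p
      pivot⁻¹ : K.Carrier
      pivot⁻¹ = proj₁ (K-inverse pivot≉0)
      ratio : Fin n → K.Carrier
      ratio i = value (punchIn j i) K.* pivot⁻¹
      w : Vector F.Carrier n
      w i = v (punchIn j i) - ι (ratio i) * v j
      w∈ : ∀ i → ∃ λ a → Coord (w i) a × a p K.≈ K.0#
      w∈ i = _ , linear (proj₂ (v∈ (punchIn j i))) (proj₂ (v∈ j)) (ratio i) , (begin
        value (punchIn j i) K.- value (punchIn j i) K.* pivot⁻¹ K.* value j
          ≈⟨ K.+-congˡ (K.-‿cong (K.trans (K.*-assoc _ _ _)
               (K.trans (K.*-congˡ (proj₂ (K-inverse pivot≉0))) (K.*-identityʳ _)))) ⟩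
        value (punchIn j i) K.- value (punchIn j i)
          ≈⟨ K.-‿inverseʳ _ ⟩
        K.0# ∎)
        where open SetoidReasoning K.setoid
      w-ind : Independent w
      w-ind a aw≈0 i = K.trans (K.reflexive (≡.sym (Vector.insertAt-punchIn a j x₀ i)))
        (ind b (F.trans b-combination aw≈0) (punchIn j i))
        where
        open SetoidReasoning F.setoid
        s = ΣK.sum (λ i → a i K.* ratio i)
        -- The coefficient of the pivot vector that turns a relation between the `w` into one
        -- between the `v`.
        x₀ = K.- s
        b = insertAt a j x₀
        b-combination : combination b v ≈ combination a w
        b-combination = begin
          combination b v
            ≈⟨ ΣF.sum-remove {i = j} (λ i → ι (b i) * v i) ⟩
          ι (b j) * v j + combination (b ∘ punchIn j) (v ∘ punchIn j)
            ≈⟨ F.+-cong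
                 (F.*-congʳ (F.trans (ι.⟦⟧-cong (K.reflexive (Vector.insertAt-lookup a j x₀))) (ι.-‿homo s)))
                 (combination-cong {w = v ∘ punchIn j}
                   (λ i → K.reflexive (Vector.insertAt-punchIn a j x₀ i)) (λ _ → F.refl)) ⟩
          F.- ι s * v j + combination a (v ∘ punchIn j)
            ≈⟨ SolverF.solve 3 (λ s v t → (:- s) :* v :+ t := t :- s :* v) F.refl (ι s) (v j) _ ⟩
          combination a (v ∘ punchIn j) - ι s * v j
            ≈⟨ combination-shift a ratio (v j) (v ∘ punchIn j) ⟨
          combination a w ∎
          where open SolverF

  eliminate : ∀ {i x} {I : Set i} {Coord : F.Carrier → (I → K.Carrier) → Set x} → IsLinear Coord →
              ∀ {m n} (idx : Fin m → I) → HasIndependent (λ f → ∃ λ a → Coord f a) (m ℕ.+ n) →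
              HasIndependent (λ f → ∃ λ a → Coord f a × ∀ j → a (idx j) K.≈ K.0#) n
  eliminate linear {zero} idx = independent-⊆ λ (a , x) → a , x , λ ()
  eliminate {Coord = Coord} linear {suc m} idx h = independent-⊆
    (λ (a , (x , a₀) , rest) → a , x , λ { zero → a₀ ; (suc j) → rest j })
    -- The condition imposed first becomes part of `Coord`, so that the later subtractions preserve
    -- it.
    (eliminate {Coord = λ f a → Coord f a × a (idx zero) K.≈ K.0#}
      (λ (x , a₀) (y , b₀) z → linear x y z ,
        K.trans (K.+-cong a₀ (K.-‿cong (K.*-congˡ b₀)))
          (SolverK.solve 1 (λ z → :0 :- z :* :0 := :0) K.refl z))
      (idx ∘ suc) (eliminate₁ linear (idx zero) h))
    where open SolverK

module SolverZ = RingSolver ℤ.+-*-commutativeRing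

+-cancelˡ-≤ : ∀ i {j k} → i ℤ.+ j ℤ.≤ i ℤ.+ k → j ℤ.≤ k
+-cancelˡ-≤ i {j} {k} le = ≡.subst₂ ℤ._≤_ (cancel i j) (cancel i k) (ℤ.+-monoʳ-≤ (ℤ.- i) le)
  where
  open SolverZ
  cancel : ∀ i j → ℤ.- i ℤ.+ (i ℤ.+ j) ≡ j
  cancel = solve 2 (λ i j → :- i :+ (i :+ j) := j) ≡.refl

-- Valuations, dimensions and Riemann's inequality

module Valuations {q : ℕ} {c ℓ₁ ℓ₂ : Level} (G : GlobalFunctionField q c ℓ₁ ℓ₂) where

  open LinearAlgebra G public
  open F using (_≈_; _+_; _*_; _-_; 0#; 1#; _^F_)
  private module FRing = RingProperties F.ring

  Order≥ : Place → ℤ → Pred F.Carrier _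
  Order≥ P n f = [ n ] ≤∞ ν P f

  [-]-injective : ∀ {m n : ℤ} → _≡_ {A = ℤ∞} [ m ] [ n ] → m ≡ n
  [-]-injective ≡.refl = ≡.refl

  module _ (P : Place) where
    open Place P hiding (ν)

    order? : ∀ n f → Dec (Order≥ P n f)
    order? n f = ≤⁺-dec ℤ._≤?_ [ n ] (ν P f)

    order-resp : ∀ {n f g} → f ≈ g → Order≥ P n f → Order≥ P n g
    order-resp {n} f≈g = ≡.subst ([ n ] ≤∞_) (ν-cong f≈g)

    order-≤ : ∀ {m n f} → m ℤ.≤ n → Order≥ P n f → Order≥ P m f
    order-≤ m≤n = ≤⁺-trans ℤ.≤-trans [ m≤n ]

    order-≡ : ∀ {m n f} → m ≡ n → Order≥ P m f → Order≥ P n f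
    order-≡ ≡.refl = id

    order-0 : ∀ {n} → Order≥ P n 0#
    order-0 {n} = ≡.subst ([ n ] ≤∞_) (≡.sym (Equivalence.from ν-∞ F.refl)) (_ ≤⊤⁺)

    order-+ : ∀ {n f g} → Order≥ P n f → Order≥ P n g → Order≥ P n (f + g)
    order-+ {n} {f} {g} n≤f n≤g = ≤⁺-trans ℤ.≤-trans (glb (ν P f) (ν P g) n≤f n≤g) (ν-+ f g)
      where
      glb : ∀ x y → [ n ] ≤∞ x → [ n ] ≤∞ y → [ n ] ≤∞ x ⊓∞ y
      glb [ _ ] [ _ ] [ p ] [ q ] = [ ℤ.⊓-glb p q ]
      glb [ _ ] ⊤⁺    p     q     = p
      glb ⊤⁺    _     p     q     = q

    order-* : ∀ {m n f g} → Order≥ P m f → Order≥ P n g → Order≥ P (m ℤ.+ n) (f * g)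
    order-* {m} {n} {f} {g} m≤f n≤g =
      ≡.subst ([ m ℤ.+ n ] ≤∞_) (≡.sym (ν-* f g)) (add (ν P f) (ν P g) m≤f n≤g)
      where
      add : ∀ x y → [ m ] ≤∞ x → [ n ] ≤∞ y → [ m ℤ.+ n ] ≤∞ x +∞ y
      add [ _ ] [ _ ] [ p ] [ q ] = [ ℤ.+-mono-≤ p q ]
      add [ _ ] ⊤⁺    p     q     = _ ≤⊤⁺
      add ⊤⁺    _     p     q     = _ ≤⊤⁺

    order-ι : ∀ a → Order≥ P 0ℤ (ι a)
    order-ι a with a ≟K K.0#
    ... | yes a≈0 = order-resp (F.sym (F.trans (ι.⟦⟧-cong a≈0) ι.0#-homo)) order-0
    ... | no a≉0  = ≡.subst ([ 0ℤ ] ≤∞_) (≡.sym (ν-trivial (≉0⇒# a≉0))) [ ℤ.≤-refl ]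

    order-ι* : ∀ a {n f} → Order≥ P n f → Order≥ P n (ι a * f)
    order-ι* a {n} n≤f = order-≡ (ℤ.+-identityˡ n) (order-* (order-ι a) n≤f)

    -- Negation is multiplication by the constant -1.
    order-neg : ∀ {n f} → Order≥ P n f → Order≥ P n (F.- f)
    order-neg n≤f = order-resp
      (F.trans (F.*-congʳ (F.trans (ι.-‿homo K.1#) (F.-‿cong ι.1#-homo))) (FRing.-1*x≈-x _))
      (order-ι* (K.- K.1#) n≤f)

    order-minus : ∀ {n f g} → Order≥ P n f → Order≥ P n g → Order≥ P n (f - g)
    order-minus n≤f n≤g = order-+ n≤f (order-neg n≤g)

    order-sum : ∀ {n m} {v : Vector F.Carrier m} → (∀ i → Order≥ P n (v i)) → Order≥ P n (F.sum v)
    order-sum {m = zero}  n≤v = order-0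
    order-sum {m = suc m} n≤v = order-+ (n≤v zero) (order-sum (n≤v ∘ suc))

    order-combination : ∀ {n m} a {v : Vector F.Carrier m} → (∀ i → Order≥ P n (v i)) →
                        Order≥ P n (combination a v)
    order-combination a n≤v = order-sum λ i → order-ι* (a i) (n≤v i)

    exact⇒order : ∀ {n f} → ν P f ≡ [ n ] → Order≥ P n f
    exact⇒order νf≡n = ≡.subst ([ _ ] ≤∞_) (≡.sym νf≡n) [ ℤ.≤-refl ]

    exact⇒≤ : ∀ {m n f} → ν P f ≡ [ n ] → Order≥ P m f → m ℤ.≤ n
    exact⇒≤ νf≡n m≤f = [≤]-injective (≡.subst ([ _ ] ≤∞_) νf≡n m≤f)

    order-exact : ∀ {n f} → Order≥ P n f → ¬ Order≥ P (ℤ.suc n) f → ν P f ≡ [ n ]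
    order-exact {n} {f} n≤f n≮f with ν P f
    order-exact {n} [ n≤m ] n≮f | [ m ] with n ℤ.≟ m
    ... | yes n≡m = ≡.cong [_] (≡.sym n≡m)
    ... | no n≢m  = contradiction [ ℤ.i<j⇒suc[i]≤j (ℤ.≤∧≢⇒< n≤m n≢m) ] n≮f
    order-exact n≤f n≮f | ⊤⁺ = contradiction (_ ≤⊤⁺) n≮f

    exact⇒≉0 : ∀ {n f} → ν P f ≡ [ n ] → ¬ (f ≈ 0#)
    exact⇒≉0 νf≡n f≈0 with ≡.trans (≡.sym νf≡n) (Equivalence.from ν-∞ f≈0)
    ... | ()

    ≉0⇒exact : ∀ {f} → ¬ (f ≈ 0#) → ∃ λ n → ν P f ≡ [ n ]
    ≉0⇒exact {f} f≉0 with ν P f in eq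
    ... | [ n ] = n , ≡.refl
    ... | ⊤⁺    = contradiction (Equivalence.to ν-∞ eq) f≉0

    -- The value of `f` at any place is a concrete element of `ℤ∞` and tells whether `f` is 0. This
    -- is why linear algebra in F asks for a place below.
    ≈0? : ∀ f → Dec (f ≈ 0#)
    ≈0? f with ν P f in eq
    ... | [ n ] = no (exact⇒≉0 eq)
    ... | ⊤⁺    = yes (Equivalence.to ν-∞ eq)

    exact-* : ∀ {m n f g} → ν P f ≡ [ m ] → ν P g ≡ [ n ] → ν P (f * g) ≡ [ m ℤ.+ n ]
    exact-* {f = f} {g} νf νg = ≡.trans (ν-* f g) (≡.cong₂ _+∞_ νf νg)

    exact-1 : ν P 1# ≡ [ 0ℤ ]
    exact-1 = ≡.trans (ν-cong (F.sym ι.1#-homo)) (ν-trivial (≉0⇒# (K-nontrivial P)))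

    exact-^ : ∀ {n f} j → ν P f ≡ [ n ] → ν P (f ^F j) ≡ [ + j ℤ.* n ]
    exact-^ {n} zero νf = ≡.trans exact-1 (≡.cong [_] (≡.sym (ℤ.*-zeroˡ n)))
    exact-^ {n} (suc j) νf =
      ≡.trans (exact-* νf (exact-^ j νf)) (≡.cong [_] (≡.sym (ℤ.suc-* (+ j) n)))

    order-cancel : ∀ {m n h f} → ν P h ≡ [ m ] → Order≥ P (m ℤ.+ n) (h * f) → Order≥ P n f
    order-cancel {m} {n} {h} {f} νh≡m ≤hf with ν P f in νf
    ... | ⊤⁺    = _ ≤⊤⁺
    ... | [ k ] = [ +-cancelˡ-≤ m (exact⇒≤ (exact-* νh≡m νf) ≤hf) ]

    F-integral : ∀ {f g} → ¬ (f ≈ 0#) → f * g ≈ 0# → g ≈ 0#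
    F-integral {f} {g} f≉0 fg≈0 with ≈0? g
    ... | yes g≈0 = g≈0
    ... | no g≉0  = contradiction fg≈0
      (exact⇒≉0 (exact-* (proj₂ (≉0⇒exact f≉0)) (proj₂ (≉0⇒exact g≉0))))

  -- In a relation with nonzero coefficient at `f`, division by this coefficient would express `f`
  -- by `v`.
  extend-independent : ∀ {n f} {v : Vector F.Carrier n} → Independent v →
                       (∀ a → ¬ (f - combination a v ≈ 0#)) → Independent (f ◂ v)
  extend-independent {n} {f} {v} ind f∉ a eq with a zero ≟K K.0#
  ... | yes a₀≈0 = λ
    { zero    → a₀≈0
    ; (suc i) → ind (a ∘ suc) (F.trans (F.trans (F.sym (F.+-identityˡ _))
        (F.+-congʳ (F.sym (F.trans (F.*-congʳ (F.trans (ι.⟦⟧-cong a₀≈0) ι.0#-homo)) (F.zeroˡ f))))) eq) i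
    }
  ... | no a₀≉0 = contradiction f-spanned (f∉ coefficient)
    where
    open SetoidReasoning F.setoid
    b = proj₁ (K-inverse a₀≉0)
    coefficient : Vector K.Carrier n
    coefficient i = K.0# K.- b K.* a (suc i)
    s = combination (a ∘ suc) v
    f-spanned : f - combination coefficient v ≈ 0#
    f-spanned = begin
      f - combination coefficient v
        ≈⟨ F.+-congˡ (F.-‿cong (F.trans (combination-minus (λ _ → K.0#) (a ∘ suc) b v)
             (F.+-congʳ (combination-zero v (λ _ → K.refl))))) ⟩
      f - (0# - ι b * s)
        ≈⟨ solve 3 (λ f b s → f :- (:0 :- b :* s) := :1 :* f :+ b :* s) F.refl f (ι b) s ⟩
      1# * f + ι b * s
        ≈⟨ F.+-congʳ (F.*-congʳ (F.trans (F.sym ι.1#-homo)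
             (F.trans (ι.⟦⟧-cong (K.sym (proj₂ (K-inverse a₀≉0)))) (ι.*-homo b (a zero))))) ⟩
      ι b * ι (a zero) * f + ι b * s
        ≈⟨ solve 4 (λ b a f s → b :* a :* f :+ b :* s := b :* (a :* f :+ s)) F.refl (ι b) _ f s ⟩
      ι b * (ι (a zero) * f + s)
        ≈⟨ F.*-congˡ eq ⟩
      ι b * 0#
        ≈⟨ F.zeroʳ (ι b) ⟩
      0# ∎
      where open SolverF

  -- A combination of elements of order greater than `k` has order greater than `k`, so that it
  -- cannot be `f`.
  add-lower-order : ∀ P {v n k f} {V : Pred F.Carrier v} → V f → ν P f ≡ [ k ] →
                    HasIndependent (λ g → V g × Order≥ P (ℤ.suc k) g) n → HasIndependent V (suc n)
  add-lower-order P {k = k} {f} Vf νf≡k (family v v∈ ind) = family (f ◂ v)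
    (λ { zero → Vf ; (suc i) → proj₁ (v∈ i) })
    (extend-independent ind λ a eq → ℤ.<-irrefl ≡.refl (ℤ.suc[i]≤j⇒i<j
      (exact⇒≤ P νf≡k (order-resp P
        (F.sym (FRing.x∙y⁻¹≈ε⇒x≈y f _ eq))
        (order-combination P a (proj₂ ∘ v∈))))))

  -- Among `suc l` independent vectors, some nonzero combination would survive the elimination of
  -- all `l` coordinates, and a vector with zero coordinates is 0.
  spanned-bound : ∀ {v l} {V : Pred F.Carrier v} {b : Vector F.Carrier l} → Place →
                  IsBasis V (_≈ 0#) b → ¬ HasIndependent V (suc l)
  spanned-bound {l = l} {V} {b} P isBasis h =
    let f , (a , f≈ , a≈0) , f≉0 = independent-nonzero P
          (eliminate {Coord = λ f a → f - combination a b ≈ 0#} linear id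
            (≡.subst (HasIndependent _) (ℕ.+-comm 1 l) (independent-⊆ (IsBasis.spanning isBasis) h)))
    in f≉0 (F.trans (FRing.x∙y⁻¹≈ε⇒x≈y f _ f≈) (combination-zero b a≈0))
    where
    open SetoidReasoning F.setoid
    linear : IsLinear (λ f a → f - combination a b ≈ 0#)
    linear {f} {g} {a} {a′} f≈ g≈ x = begin
      (f - ι x * g) - combination _ b
        ≈⟨ F.+-congˡ (F.-‿cong (combination-minus a a′ x b)) ⟩
      (f - ι x * g) - (combination a b - ι x * combination a′ b)
        ≈⟨ solve 5 (λ f x g s t → (f :- x :* g) :- (s :- x :* t) := (f :- s) :- x :* (g :- t))
             F.refl f (ι x) g _ _ ⟩
      (f - combination a b) - ι x * (g - combination a′ b)
        ≈⟨ F.+-cong f≈ (F.-‿cong (F.*-congˡ g≈)) ⟩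
      0# - ι x * 0#
        ≈⟨ solve 1 (λ x → :0 :- x :* :0 := :0) F.refl (ι x) ⟩
      0# ∎
      where open SolverF

  -- A maximal independent family spans; spanning is decidable because K is finite.
  dimension-exists : ∀ {v} {V : Pred F.Carrier v} → Place → ∀ B → ¬ HasIndependent V (suc B) →
                     ((∃ λ l → l ≤ B × HasDimension V (_≈ 0#) l) → ⊥) → ⊥
  dimension-exists {V = V} P B maximal none = excluded-middle {A = HasIndependent V B} λ
    { (yes (family v v∈ ind)) → none (B , ℕ.≤-refl , v , record
        { contained   = v∈
        ; independent = ind
        ; spanning    = λ {f} Vf → decidable-stable
            (any-vector? B
              (λ a≈b → F.trans (F.+-congˡ (F.-‿cong (combination-cong (K.sym ∘ a≈b) (λ _ → F.refl)))))
              (λ a → ≈0? P (f - combination a v)))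
            λ unspanned → maximal (family (f ◂ v)
              (λ { zero → Vf ; (suc i) → v∈ i })
              (extend-independent ind λ a eq → unspanned (a , eq)))
        })
    ; (no smaller) → descend B smaller none
    }
    where
    descend : ∀ B → ¬ HasIndependent V B → ((∃ λ l → l ≤ B × HasDimension V (_≈ 0#) l) → ⊥) → ⊥
    descend zero    smaller none = smaller independent-zero
    descend (suc B) smaller none = dimension-exists P B smaller
      λ (l , l≤B , dim) → none (l , ℕ.m≤n⇒m≤1+n l≤B , dim)

  -- The genus bound with an upper bound `B` in place of ℓ(D). The inequality is decidable, so the
  -- existence of ℓ(D) up to double negation is enough.
  riemann : ∀ {g B δ} D → Place → IsGenus g → HasDivisorDegree D δ → ¬ HasIndependent (ℒ D) (suc B) →
            δ ℤ.+ 1ℤ ℤ.≤ + (B ℕ.+ g)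
  riemann {g} {B} {δ} D P genus degree maximal = decidable-stable (_ ℤ.≤? _)
    λ ≰ → dimension-exists P B maximal λ (l , l≤B , dim) → ≰ (begin
      δ ℤ.+ 1ℤ                          ≡⟨ rearrange δ (+ l) ⟩
      + l ℤ.+ (δ ℤ.- + l ℤ.+ 1ℤ)        ≤⟨ ℤ.+-mono-≤ (ℤ.+≤+ l≤B) (IsGenus.upperBound genus D degree dim) ⟩
      + B ℤ.+ + g                       ≡⟨⟩
      + (B ℕ.+ g)                       ∎)
    where
    open ℤ.≤-Reasoning
    rearrange : ∀ δ l → δ ℤ.+ 1ℤ ≡ l ℤ.+ (δ ℤ.- l ℤ.+ 1ℤ)
    rearrange δ l = solve 2 (λ δ l → δ :+ :1 := l :+ (δ :- l :+ :1)) ≡.refl δ l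
      where open SolverZ

-- Functions without poles that vanish at P∞

module NoGlobalZero {q : ℕ} {c ℓ₁ ℓ₂ : Level} (G : GlobalFunctionField q c ℓ₁ ℓ₂) where

  open Valuations G
  open F using (_≈_; _+_; _*_; _-_; 0#; 1#; _^F_)

  PoleAt : Place → ℤ → Pred F.Carrier _
  PoleAt P n f = Order≥ P (ℤ.- n) f × (∀ Q → ¬ (Q ≈ᴾ P) → Order≥ Q 0ℤ f)

  ℒ⇒PoleAt : ∀ {P n f} → ℒ (n · P) f → PoleAt P n f
  ℒ⇒PoleAt (P≥ ∷ [] , Q≥) = P≥ , λ Q Q≉P → Q≥ Q (Q≉P ∷ [])

  PoleAt⇒ℒ : ∀ {P n f} → PoleAt P n f → ℒ (n · P) f
  PoleAt⇒ℒ (P≥ , Q≥) = P≥ ∷ [] , λ { Q (Q≉P ∷ []) → Q≥ Q Q≉P }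

  order-≈ᴾ : ∀ {P Q n f} → P ≈ᴾ Q → Order≥ P n f → Order≥ Q n f
  order-≈ᴾ {n = n} {f} P≈Q = ≡.subst ([ n ] ≤∞_) (P≈Q f)

  ≈ᴾ-sym : ∀ {P Q} → P ≈ᴾ Q → Q ≈ᴾ P
  ≈ᴾ-sym P≈Q f = ≡.sym (P≈Q f)

  -- An empty basis of the residue class field would put 1 into `𝔪 P`.
  degree-positive : ∀ P {d} → HasDegree P d → 1 ≤ d
  degree-positive P {suc d} _ = s≤s z≤n
  degree-positive P {zero} (b , isBasis) with IsBasis.spanning isBasis (exact⇒order P (exact-1 P))
  ... | a , 1∈𝔪 with exact⇒≤ P (exact-1 P)
                      (order-resp P (solve 1 (λ x → x :- :0 := x) F.refl 1#) 1∈𝔪)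
    where open SolverF
  ... | ℤ.+≤+ ()

  module _ {g : ℕ} (genus : IsGenus g) {P∞ : Place} (degree∞ : HasDegree P∞ 1)
           {f : F.Carrier} (f-zero : PoleAt P∞ (ℤ.- 1ℤ) f) where

    private
      regular : ∀ Q → Order≥ Q 0ℤ f
      -- There is no decision whether `Q` equals `P∞`. As the conclusion is decidable, both cases
      -- may be used to refute its negation; the same pattern recurs below.
      regular Q = decidable-stable (order? Q 0ℤ f) λ ≱ →
        ≱ (proj₂ f-zero Q λ Q≈P∞ → ≱ (order-≤ Q (ℤ.+≤+ z≤n) (order-≈ᴾ {P∞} {Q} (≈ᴾ-sym {Q} {P∞} Q≈P∞) (proj₁ f-zero))))

      f*≥ : ∀ Q {n h} → Order≥ Q n h → Order≥ Q n (f * h)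
      f*≥ Q {n} n≤h = order-≡ Q (ℤ.+-identityˡ n) (order-* Q (regular Q) n≤h)

      f*≥′ : ∀ Q {n h} → Q ≈ᴾ P∞ → Order≥ Q (ℤ.- (n ℤ.+ 1ℤ)) h → Order≥ Q (ℤ.- n) (f * h)
      f*≥′ Q {n} Q≈P∞ n≤h = order-≡ Q
        (SolverZ.solve 1 (λ n → :1 :+ :- (n :+ :1) := :- n) ≡.refl n)
        (order-* Q (order-≈ᴾ {P∞} {Q} (≈ᴾ-sym {Q} {P∞} Q≈P∞) (proj₁ f-zero)) n≤h)
        where open SolverZ

      f*ℒ : ∀ D {h} → ℒ D h → ℒ D (f * h)
      f*ℒ D (terms≥ , others≥) = All.map (λ {t} → f*≥ (proj₁ t)) terms≥ , λ Q Q∉ → f*≥ Q (others≥ Q Q∉)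

      -- h, f h, f² h, ... remain in `ℒ D` because `f` has no poles, and their orders at `P∞`
      -- increase strictly because `f` has a zero there.
      chain : ∀ D {k} → ν P∞ f ≡ [ k ] → ∀ n {h m} → ℒ D h → ν P∞ h ≡ [ m ] →
              HasIndependent (λ x → ℒ D x × Order≥ P∞ m x) n
      chain D νf zero    _ _ = independent-zero
      chain D {k} νf (suc n) {h} {m} ℒh νh = add-lower-order P∞ (ℒh , exact⇒order P∞ νh) νh
        (independent-⊆
          (λ (ℒx , ≥) → (ℒx , order-≤ P∞ (ℤ.≤-trans (ℤ.i≤suc[i] m) suc[m]≤) ≥) , order-≤ P∞ suc[m]≤ ≥)
          (chain D νf n (f*ℒ D ℒh) (exact-* P∞ νf νh)))
        where
        suc[m]≤ : ℤ.suc m ℤ.≤ k ℤ.+ m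
        suc[m]≤ = ℤ.+-monoˡ-≤ m (exact⇒≤ P∞ νf (proj₁ f-zero))

      finite-dimensional⇒trivial : ¬ (f ≈ 0#) → ∀ D {l} → Hasℓ D l → ∀ {h} → ℒ D h → h ≈ 0#
      finite-dimensional⇒trivial f≉0 D {l} (b , isBasis) {h} ℒh = decidable-stable (≈0? P∞ h) λ h≉0 →
        spanned-bound P∞ isBasis (independent-⊆ proj₁
          (chain D (proj₂ (≉0⇒exact P∞ f≉0)) (suc l) ℒh (proj₂ (≉0⇒exact P∞ h≉0))))

      Terms : Set _
      Terms = List (Place × ℤ)

      -- The terms of D + P∞ if a place equal to `P∞` is already listed; a second entry for it would
      -- violate `distinct`.
      bump : (ts : Terms) → Any (λ t → proj₁ t ≈ᴾ P∞) ts → Terms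
      bump ((Q , n) ∷ ts) (here _)  = (Q , n ℤ.+ 1ℤ) ∷ ts
      bump (t ∷ ts)       (there i) = t ∷ bump ts i

      bump-All : ∀ {p} (A : Pred Place p) ts i → All (A ∘ proj₁) ts → All (A ∘ proj₁) (bump ts i)
      bump-All A (_ ∷ ts) (here _)  (x ∷ xs) = x ∷ xs
      bump-All A (_ ∷ ts) (there i) (x ∷ xs) = x ∷ bump-All A ts i xs

      bump-distinct : ∀ ts i → AllPairs (λ s t → ¬ (proj₁ s ≈ᴾ proj₁ t)) ts →
                      AllPairs (λ s t → ¬ (proj₁ s ≈ᴾ proj₁ t)) (bump ts i)
      bump-distinct (_ ∷ ts) (here _)  (x ∷ xs) = x ∷ xs
      bump-distinct ((Q , _) ∷ ts) (there i) (x ∷ xs) =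
        bump-All (λ R → ¬ (Q ≈ᴾ R)) ts i x ∷ bump-distinct ts i xs

      -- The listed place `Q` carries a degree `d` of its own, and d ≥ 1 turns into the inequality.
      bump-degree : ∀ ts i {δ} → TotalDegree ts δ → ∃ λ δ′ → TotalDegree (bump ts i) δ′ × δ ℤ.+ 1ℤ ℤ.≤ δ′
      bump-degree ((Q , n) ∷ ts) (here _) {δ} (_∷_ {d = d} {t = t} deg rest) =
        (n ℤ.+ 1ℤ) ℤ.* + d ℤ.+ t , deg ∷ rest , (begin
          n ℤ.* + d ℤ.+ t ℤ.+ 1ℤ    ≤⟨ ℤ.+-monoʳ-≤ (n ℤ.* + d ℤ.+ t) (ℤ.+≤+ (degree-positive Q deg)) ⟩
          n ℤ.* + d ℤ.+ t ℤ.+ + d   ≡⟨ solve 3 (λ n d t → n :* d :+ t :+ d := (n :+ :1) :* d :+ t) ≡.refl n (+ d) t ⟩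
          (n ℤ.+ 1ℤ) ℤ.* + d ℤ.+ t  ∎)
        where
        open ℤ.≤-Reasoning
        open SolverZ
      bump-degree ((Q , n) ∷ ts) (there i) (_∷_ {d = d} {t = t} deg rest) with bump-degree ts i rest
      ... | δ′ , rest′ , ≤ = n ℤ.* + d ℤ.+ δ′ , deg ∷ rest′ ,
        ℤ.≤-trans (ℤ.≤-reflexive (ℤ.+-assoc (n ℤ.* + d) t 1ℤ)) (ℤ.+-monoʳ-≤ (n ℤ.* + d) ≤)

      bump-terms : ∀ ts i {h} → All (λ t → Order≥ (proj₁ t) (ℤ.- proj₂ t) h) (bump ts i) →
                   All (λ t → Order≥ (proj₁ t) (ℤ.- proj₂ t) (f * h)) ts
      bump-terms ((Q , n) ∷ ts) (here Q≈P∞) (x ∷ xs) = f*≥′ Q {n} Q≈P∞ x ∷ All.map (λ {t} → f*≥ (proj₁ t)) xs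
      bump-terms ((Q , n) ∷ ts) (there i) (x ∷ xs) = f*≥ Q x ∷ bump-terms ts i xs

      -- `D′` will be D + P∞, whether or not `D` lists `P∞`. The zero of `f` compensates for the
      -- additional pole.
      Bumped : Divisor → ℤ → Set _
      Bumped D δ = ∃ λ D′ → ∃ λ δ′ → HasDivisorDegree D′ δ′ × δ ℤ.+ 1ℤ ℤ.≤ δ′ × (∀ {h} → ℒ D′ h → ℒ D (f * h))

      bumped-listed : ∀ D {δ} → HasDivisorDegree D δ → Any (λ t → proj₁ t ≈ᴾ P∞) (terms D) → Bumped D δ
      bumped-listed D degD i with bump-degree (terms D) i degD
      ... | δ′ , degD′ , ≤ =
        record { terms = bump (terms D) i ; distinct = bump-distinct (terms D) i (Divisor.distinct D) } ,
        δ′ , degD′ , ≤ ,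
        λ (terms≥ , others≥) → bump-terms (terms D) i terms≥ ,
          λ Q Q∉ → f*≥ Q (others≥ Q (bump-All (λ R → ¬ (Q ≈ᴾ R)) (terms D) i Q∉))

      bumped-unlisted : ∀ D {δ} → HasDivisorDegree D δ → ¬ Any (λ t → proj₁ t ≈ᴾ P∞) (terms D) → Bumped D δ
      bumped-unlisted D {δ} degD P∞∉ =
        record
          { terms = (P∞ , 1ℤ) ∷ terms D
          ; distinct = All.map (λ {t} R≉P∞ P∞≈R → R≉P∞ (≈ᴾ-sym {P∞} {proj₁ t} P∞≈R)) (All.¬Any⇒All¬ _ P∞∉) ∷ Divisor.distinct D
          } ,
        1ℤ ℤ.* + 1 ℤ.+ δ , degree∞ ∷ degD , ℤ.≤-reflexive (ℤ.+-comm δ 1ℤ) ,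
        λ { {h} (P∞≥ ∷ terms≥ , others≥) → All.map (λ {t} → f*≥ (proj₁ t)) terms≥ ,
          -- `Q` is not listed in `D` but may equal `P∞`, where the condition of the enlarged
          -- divisor has to be used.
          λ Q Q∉ → decidable-stable (order? Q 0ℤ (f * h)) λ ≱ →
            ≱ (f*≥ Q (others≥ Q ((λ Q≈P∞ → ≱ (f*≥′ Q {0ℤ} Q≈P∞ (order-≈ᴾ {P∞} {Q} (≈ᴾ-sym {Q} {P∞} Q≈P∞) P∞≥))) ∷ Q∉))) }

    -- The powers of f would make every space ℒ D either trivial or infinite
    -- dimensional; then f embeds ℒ (D + P∞) into ℒ D = 0, and D + P∞ violates
    -- the genus bound that D attains.
    no-global-zero : f ≈ 0#
    no-global-zero with IsGenus.attained genus
    ... | D , δ , l , degD , dimD , attained = decidable-stable (≈0? P∞ f) λ f≉0 → excluded-middle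
      λ { (yes listed)  → absurd f≉0 (bumped-listed D degD listed)
        ; (no unlisted) → absurd f≉0 (bumped-unlisted D degD unlisted)
        }
      where
      absurd : ¬ (f ≈ 0#) → Bumped D δ → ⊥
      absurd f≉0 (D′ , δ′ , degD′ , δ+1≤δ′ , f*D′⊆D) = ℤ.<-irrefl ≡.refl (begin-strict
        + g                        ≡⟨ attained ⟨
        δ ℤ.- + l ℤ.+ 1ℤ           ≤⟨ ℤ.+-monoˡ-≤ 1ℤ (ℤ.i-j≤i δ (+ l)) ⟩
        δ ℤ.+ 1ℤ                   ≤⟨ δ+1≤δ′ ⟩
        δ′                         <⟨ ℤ.suc[i]≤j⇒i<j ℤ.≤-refl ⟩
        ℤ.suc δ′                   ≡⟨ ℤ.+-comm 1ℤ δ′ ⟩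
        δ′ ℤ.+ 1ℤ                  ≤⟨ riemann D′ P∞ genus degD′ trivial ⟩
        + g                        ∎)
        where
        open ℤ.≤-Reasoning
        trivial : ¬ HasIndependent (ℒ D′) 1
        trivial h = let x , ℒx , x≉0 = independent-nonzero P∞ h in
          x≉0 (F-integral P∞ f≉0 (finite-dimensional⇒trivial f≉0 D dimD (f*D′⊆D ℒx)))

-- Pole numbers and the filtration by pole order at P∞

module PoleFiltration {q : ℕ} {c ℓ₁ ℓ₂ : Level} (G : GlobalFunctionField q c ℓ₁ ℓ₂) where

  open NoGlobalZero G public
  open Valuations G public
  open F using (_≈_; _+_; _*_; _-_; 0#; 1#; _^F_)

  -- Negative orders come from the inverse of a local parameter, which is available up to double
  -- negation only. Hence this is a hypothesis until the goal is decidable.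
  HasOrders : Place → Set _
  HasOrders P = ∀ k → ∃ λ h → ν P h ≡ [ k ]

  -- Multiplication by `h` of order -k moves `f` and `w` into the valuation ring. Their residue
  -- classes are multiples α and γ of the same basis element, as the degree is 1, and γ ≠ 0, so that
  -- a = α / γ.
  leading-coefficient : ∀ P → HasDegree P 1 → HasOrders P → ∀ {k f w} → Order≥ P k f → ν P w ≡ [ k ] →
                        ∃ λ a → Order≥ P (ℤ.suc k) (f - ι a * w)
  leading-coefficient P (b , isBasis) orders {k} {f} {w} k≤f νw =
    a , order-cancel P νh (order-resp P factor
      (order-≡ P (solveℤ k)
        (order-+ P (order-minus P (proj₂ f-residue) (order-ι* P a (proj₂ w-residue)))
          (order-resp P (F.sym aγ-cancels) (order-0 P)))))
    where
    open IsBasis isBasis using (spanning; contained)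
    h = proj₁ (orders (ℤ.- k))
    νh = proj₂ (orders (ℤ.- k))
    solveℤ : ∀ k → 1ℤ ≡ ℤ.- k ℤ.+ ℤ.suc k
    solveℤ = solve 1 (λ k → :1 := :- k :+ (:1 :+ k)) ≡.refl
      where open SolverZ
    regular : ∀ {x} → Order≥ P k x → Order≥ P 0ℤ (h * x)
    regular k≤x = order-≡ P (ℤ.+-inverseˡ k) (order-* P (exact⇒order P νh) k≤x)
    residue : ∀ {x} → Order≥ P k x → ∃ λ α → Order≥ P 1ℤ (h * x - ι α * b zero)
    residue k≤x with spanning (regular k≤x)
    ... | α , ∈𝔪 = α zero , order-resp P (F.+-congˡ (F.-‿cong (F.+-identityʳ _))) ∈𝔪
    f-residue = residue k≤f
    w-residue = residue (exact⇒order P νw)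
    α = proj₁ f-residue
    γ = proj₁ w-residue
    γ≉0 : ¬ (γ K.≈ K.0#)
    γ≉0 γ≈0 with exact⇒≤ P (exact-* P νh νw) (order-resp P
      (F.trans (F.+-congˡ (F.-‿cong (F.trans (F.*-congʳ (F.trans (ι.⟦⟧-cong γ≈0) ι.0#-homo)) (F.zeroˡ _))))
        (SolverF.solve 1 (λ x → x :- :0 := x) F.refl (h * w))) (proj₂ w-residue))
      where open SolverF
    ... | 1≤0 with ≡.subst (1ℤ ℤ.≤_) (ℤ.+-inverseˡ k) 1≤0
    ... | ℤ.+≤+ ()
    a = α K.* proj₁ (K-inverse γ≉0)
    aγ≈α : a K.* γ K.≈ α
    aγ≈α = K.trans (K.*-assoc _ _ _) (K.trans (K.*-congˡ (proj₂ (K-inverse γ≉0))) (K.*-identityʳ α))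
    aγ-cancels : (ι α - ι a * ι γ) * b zero ≈ 0#
    aγ-cancels = F.trans (F.*-congʳ (F.trans
      (F.+-congˡ (F.-‿cong (F.trans (F.sym (ι.*-homo a γ)) (ι.⟦⟧-cong aγ≈α)))) (F.-‿inverseʳ _))) (F.zeroˡ _)
    factor : ((h * f - ι α * b zero) - ι a * (h * w - ι γ * b zero)) + (ι α - ι a * ι γ) * b zero
             ≈ h * (f - ι a * w)
    factor = solve 7 (λ h f α b a w γ →
      ((h :* f :- α :* b) :- a :* (h :* w :- γ :* b)) :+ (α :- a :* γ) :* b := h :* (f :- a :* w))
      F.refl h f (ι α) (b zero) (ι a) w (ι γ)
      where open SolverF

  module Poles {s} {P∞ : Place} {P : Fin s → Place} {e : Fin s → ℕ} (C : ColumnwiseConstruction P∞ P e)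
               (orders∞ : HasOrders P∞) (degree∞ : HasDegree P∞ 1) {g : ℕ} (genus : IsGenus g) where
    open ColumnwiseConstruction C

    -- Pole order less than `N`. With this shift the filtration starts at `Below 0`, which is ℒ(-P∞)
    -- = 0.
    Below : ℕ → Pred F.Carrier _
    Below N = PoleAt P∞ (+ N ℤ.- 1ℤ)

    below-resp : ∀ {N f h} → f ≈ h → Below N f → Below N h
    below-resp eq (∞≥ , Q≥) = order-resp P∞ eq ∞≥ , λ Q Q≉ → order-resp Q eq (Q≥ Q Q≉)

    below-minus-ι* : ∀ {N f h} a → Below N f → Below N h → Below N (f - ι a * h)
    below-minus-ι* a (∞≥ , Q≥) (∞≥′ , Q≥′) =
      order-minus P∞ ∞≥ (order-ι* P∞ a ∞≥′) , λ Q Q≉ → order-minus Q (Q≥ Q Q≉) (order-ι* Q a (Q≥′ Q Q≉))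

    below-suc : ∀ N {f} → Below N f → Below (suc N) f
    below-suc N (∞≥ , Q≥) = order-≤ P∞ (ℤ.neg-mono-≤ (ℤ.i-j≤i (+ N) 1ℤ)) ∞≥ , Q≥

    suc-neg : ∀ N → ℤ.suc (ℤ.- + N) ≡ ℤ.- (+ N ℤ.- 1ℤ)
    suc-neg N = solve 1 (λ n → :1 :+ :- n := :- (n :- :1)) ≡.refl (+ N)
      where open SolverZ

    not-below⇒exact : ∀ N {f} → Below (suc N) f → ¬ Below N f → ν P∞ f ≡ [ ℤ.- + N ]
    not-below⇒exact N (∞≥ , Q≥) ≰ = order-exact P∞ ∞≥ λ ∞> →
      ≰ (order-≡ P∞ (suc-neg N) ∞> , Q≥)

    exact⇒not-below : ∀ N {f} → ν P∞ f ≡ [ ℤ.- + N ] → ¬ Below N f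
    exact⇒not-below N νf (∞≥ , _) = ℤ.<-irrefl ≡.refl
      (ℤ.suc[i]≤j⇒i<j (≡.subst (ℤ._≤ ℤ.- + N) (≡.sym (suc-neg N)) (exact⇒≤ P∞ νf ∞≥)))

    y-below : ∀ r → Below (suc (nonGap r)) (y r)
    y-below r = ℒ⇒PoleAt (y∈ r)

    y-exact : ∀ r → ν P∞ (y r) ≡ [ ℤ.- + nonGap r ]
    y-exact r = not-below⇒exact (nonGap r) (y-below r) (y∉ r ∘ PoleAt⇒ℒ)

    -- For a gap `N` the two spaces would have bases of the same length, but `f` extends the smaller
    -- one.
    pole⇒nonGap : ∀ N {f} → Below (suc N) f → ν P∞ f ≡ [ ℤ.- + N ] → ∃ λ r → nonGap r ≡ N
    pole⇒nonGap N {f} f-below νf = nonGap-complete N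
      λ (_ , l , (b , isBasis) , (b′ , isBasis′)) → spanned-bound P∞ isBasis
        (add-lower-order P∞ (PoleAt⇒ℒ f-below) νf (independent-⊆
          (λ ℒx → let (∞≥ , Q≥) = ℒ⇒PoleAt ℒx in
            PoleAt⇒ℒ (below-suc N (∞≥ , Q≥)) , order-≡ P∞ (≡.sym (suc-neg N)) ∞≥)
          (family b′ (IsBasis.contained isBasis′) (IsBasis.independent isBasis′))))

    nonGap-≤ : ∀ {r r′} → r ≤ r′ → nonGap r ≤ nonGap r′
    nonGap-≤ r≤r′ with ℕ.m≤n⇒m<n∨m≡n r≤r′
    ... | inj₁ r<r′   = ℕ.<⇒≤ (nonGap-increasing r<r′)
    ... | inj₂ ≡.refl = ℕ.≤-refl

    -- The number of pole numbers less than `N`. Since `nonGap` is increasing, comparison with its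
    -- next value settles whether `N` is a pole number, without deciding `IsGap`.
    nonGaps< : ℕ → ℕ
    nonGaps< zero = 0
    nonGaps< (suc N) with nonGap (nonGaps< N) ℕ.≟ N
    ... | yes _ = suc (nonGaps< N)
    ... | no _  = nonGaps< N

    nonGaps<-spec : ∀ N → (∀ {r} → r < nonGaps< N → nonGap r < N) × (∀ {r} → nonGaps< N ≤ r → N ≤ nonGap r)
    nonGaps<-spec zero = (λ ()) , λ _ → z≤n
    nonGaps<-spec (suc N) with nonGap (nonGaps< N) ℕ.≟ N
    ... | yes eq = (λ r< → s≤s (ℕ.≤-trans (nonGap-≤ (ℕ.s≤s⁻¹ r<)) (ℕ.≤-reflexive eq))) ,
                   (λ <r → ℕ.≤-trans (s≤s (ℕ.≤-reflexive (≡.sym eq))) (nonGap-increasing <r))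
    ... | no ≢ with nonGaps<-spec N
    ...   | below , above = (λ r< → ℕ.m≤n⇒m≤1+n (below r<)) ,
                            (λ ≤r → ℕ.≤-trans (ℕ.≤∧≢⇒< (above ℕ.≤-refl) (≢ ∘ ≡.sym)) (nonGap-≤ ≤r))

    nonGaps<-nonGap : ∀ r → nonGaps< (nonGap r) ≡ r
    nonGaps<-nonGap r with nonGaps<-spec (nonGap r)
    ... | below , above = ℕ.≤-antisym
      (ℕ.≮⇒≥ λ r< → ℕ.<-irrefl ≡.refl (below r<))
      (ℕ.≮⇒≥ λ <r → ℕ.<⇒≱ (nonGap-increasing <r) (above ℕ.≤-refl))

    -- What pole order `N` adds to the functions of smaller pole order: the next of the y_r, or
    -- nothing.
    data Step (N : ℕ) : Set (c ⊔ ℓ₁ ⊔ ℓ₂) where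
      nongap : nonGap (nonGaps< N) ≡ N → nonGaps< (suc N) ≡ suc (nonGaps< N) →
               (∀ {f} → Below (suc N) f → ∃ λ a → Below N (f - ι a * y (nonGaps< N))) → Step N
      gap    : nonGaps< (suc N) ≡ nonGaps< N → (∀ {f} → Below (suc N) f → Below N f) → Step N

    step : ∀ N → Step N
    step N with nonGap (nonGaps< N) ℕ.≟ N in dec
    ... | yes eq = nongap eq suc-count λ {f} f-below →
      let a , ∞≥ = leading-coefficient P∞ degree∞ orders∞ (proj₁ f-below) (≡.subst (λ n → ν P∞ (y (nonGaps< N)) ≡ [ ℤ.- + n ]) eq (y-exact _))
      in a , order-≡ P∞ (suc-neg N) ∞≥ ,
         proj₂ (below-minus-ι* {suc N} a f-below (≡.subst (λ n → Below (suc n) (y (nonGaps< N))) eq (y-below _)))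
      where
      suc-count : nonGaps< (suc N) ≡ suc (nonGaps< N)
      suc-count rewrite dec = ≡.refl
    ... | no ≢ = gap same-count λ {f} f-below →
      decidable-stable′ f-below λ ≰ →
        let r , eq = pole⇒nonGap N f-below (not-below⇒exact N f-below ≰)
        in ≢ (≡.trans (≡.cong nonGap (≡.trans (≡.cong nonGaps< (≡.sym eq)) (nonGaps<-nonGap r))) eq)
      where
      same-count : nonGaps< (suc N) ≡ nonGaps< N
      same-count rewrite dec = ≡.refl
      -- `Below N` sharpens `Below (suc N)` at `P∞` only, and the order there is decidable.
      decidable-stable′ : ∀ {f} → Below (suc N) f → ¬ ¬ Below N f → Below N f
      decidable-stable′ (_ , Q≥) ¬¬b = decidable-stable (order? P∞ _ _) (λ ≱ → ¬¬b λ b → ≱ (proj₁ b)) , Q≥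

    below-zero : ∀ {f} → Below 0 f → f ≈ 0#
    below-zero = no-global-zero genus {P∞} degree∞

    -- The y_r of pole order less than `N` span `Below N`, in the form of an induction principle,
    -- which avoids coefficient vectors. `below-zero` is its base.
    below-induction : ∀ {w} (W : Pred F.Carrier w) N → (∀ {f} → f ≈ 0# → W f) →
                      (∀ {f} r a → r < nonGaps< N → W (f - ι a * y r) → W f) →
                      ∀ {f} → Below N f → W f
    below-induction W zero    W-zero W-add f-below = W-zero (below-zero f-below)
    below-induction W (suc N) W-zero W-add f-below with step N
    ... | nongap _ count reduce = W-add (nonGaps< N) (proj₁ (reduce f-below))
            (ℕ.≤-reflexive (≡.sym count))
            (below-induction W N W-zero (λ r a r< → W-add r a (ℕ.≤-trans (ℕ.m≤n⇒m≤1+n r<) (ℕ.≤-reflexive (≡.sym count)))) (proj₂ (reduce f-below)))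
    ... | gap count reduce = below-induction W N W-zero
            (λ r a r< → W-add r a (ℕ.≤-trans r< (ℕ.≤-reflexive (≡.sym count)))) (reduce f-below)

    -- The pole orders of the y_r are distinct.
    below-independent : ∀ N → HasIndependent (Below N) (nonGaps< N)
    below-independent zero = independent-zero
    below-independent (suc N) with step N
    ... | gap count _ = ≡.subst (HasIndependent _) (≡.sym count)
            (independent-⊆ (below-suc N) (below-independent N))
    ... | nongap eq count _ = ≡.subst (HasIndependent _) (≡.sym count)
            (add-lower-order P∞ (≡.subst (λ n → Below (suc n) (y (nonGaps< N))) eq (y-below _))
              (≡.subst (λ n → ν P∞ (y (nonGaps< N)) ≡ [ ℤ.- + n ]) eq (y-exact _))
              (independent-⊆ (λ b → below-suc N b , order-≡ P∞ (≡.sym (suc-neg N)) (proj₁ b))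
                (below-independent N)))

    -- As `P∞` has degree 1, lowering the pole order by one is a single linear condition: the
    -- coefficient relative to an element `w` of order -N has to vanish.
    leading-eliminate : ∀ {v} {V : Pred F.Carrier v} → (∀ {f h} a → V f → V h → V (f - ι a * h)) →
                        ∀ N {n} → HasIndependent (λ f → V f × Below (suc N) f) (suc n) →
                        HasIndependent (λ f → V f × Below N f) n
    leading-eliminate {V = V} closed N h = independent-⊆
      (λ (a , (Vf , (∞≥ , Q≥) , lead) , a≈0) → Vf ,
        order-≡ P∞ (suc-neg N)
          (order-resp P∞ (F.trans (F.+-congˡ (F.-‿cong (F.trans (F.*-congʳ (F.trans (ι.⟦⟧-cong (a≈0 zero)) ι.0#-homo)) (F.zeroˡ w))))
            (SolverF.solve 1 (λ x → x :- :0 := x) F.refl _)) lead) , Q≥)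
      (eliminate {Coord = Coord} (λ {f} {f′} {a} {a′} → linear {f} {f′} {a} {a′}) {1} id (independent-⊆
        (λ (Vf , b) → let a , lead = leading-coefficient P∞ degree∞ orders∞ (proj₁ b) νw in (λ _ → a) , Vf , b , lead) h))
      where
      open SolverF
      w = proj₁ (orders∞ (ℤ.- + N))
      νw = proj₂ (orders∞ (ℤ.- + N))
      Coord : F.Carrier → (Fin 1 → K.Carrier) → Set _
      Coord f a = V f × Below (suc N) f × Order≥ P∞ (ℤ.suc (ℤ.- + N)) (f - ι (a zero) * w)
      linear : IsLinear Coord
      linear {f} {f′} {a} {a′} (Vf , b , lead) (Vf′ , b′ , lead′) x =
        closed x Vf Vf′ , below-minus-ι* {suc N} x b b′ ,
        order-resp P∞ (F.sym (F.trans
          (F.+-congˡ (F.-‿cong (F.*-congʳ (F.trans (ι-minus _ _) (F.+-congˡ (F.-‿cong (ι.*-homo _ _)))))))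
          (SolverF.solve 6 (λ f x f′ a a′ w → (f :- x :* f′) :- (a :- x :* a′) :* w := (f :- a :* w) :- x :* (f′ :- a′ :* w))
            F.refl f (ι x) f′ (ι (a zero)) (ι (a′ zero)) w)))
          (order-minus P∞ lead (order-ι* P∞ x lead′))

    private
      U : Pred F.Carrier _
      U _ = ⊤

    below-bound : ∀ N → ¬ HasIndependent (Below N) (suc (nonGaps< N))
    below-bound zero h = let _ , b , f≉0 = independent-nonzero P∞ h in f≉0 (below-zero b)
    below-bound (suc N) h with step N
    ... | gap count reduce = below-bound N (independent-⊆ reduce (≡.subst (HasIndependent (Below (suc N)) ∘ suc) count h))
    ... | nongap _ count _ = below-bound N (independent-⊆ proj₂
            (leading-eliminate {V = U} _ N (independent-⊆ (_ ,_)
              (≡.subst (HasIndependent (Below (suc N)) ∘ suc) count h))))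

    -- At most `g` numbers less than `N` are gaps. This is Riemann's inequality for the multiples of
    -- P∞, whose dimensions `below-bound` estimates by the number of pole numbers.
    gap-bound : ∀ N → N ≤ nonGaps< N ℕ.+ g
    gap-bound zero = z≤n
    gap-bound (suc N) = ℤ.drop‿+≤+ (≡.subst (ℤ._≤ + (nonGaps< (suc N) ℕ.+ g)) (degree-eq (+ N))
      (riemann (+ N · P∞) P∞ genus (degree∞ ∷ []) (below-bound (suc N) ∘ independent-⊆ ℒ⇒PoleAt)))
      where
      degree-eq : ∀ n → n ℤ.* 1ℤ ℤ.+ 0ℤ ℤ.+ 1ℤ ≡ 1ℤ ℤ.+ n
      degree-eq = solve 1 (λ n → n :* :1 :+ :0 :+ :1 := :1 :+ n) ≡.refl
        where open SolverZ

eventually-map : ∀ {a b} {A : ℕ → Set a} {B : ℕ → Set b} →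
                 (∀ {n} → A n → B n) → Eventually A → Eventually B
eventually-map f (N , A≥) = N , λ n N≤n → f (A≥ n N≤n)

eventually-× : ∀ {a b} {A : ℕ → Set a} {B : ℕ → Set b} →
               Eventually A → Eventually B → Eventually (λ n → A n × B n)
eventually-× (M , A≥) (N , B≥) = M ℕ.⊔ N , λ n ≤n →
  A≥ n (ℕ.≤-trans (ℕ.m≤m⊔n M N) ≤n) , B≥ n (ℕ.≤-trans (ℕ.m≤n⊔m M N) ≤n)

eventually-Fin : ∀ {a m} {A : Fin m → ℕ → Set a} →
                 (∀ i → Eventually (A i)) → Eventually (λ n → ∀ i → A i n)
eventually-Fin {m = zero}  A≥ = 0 , λ _ _ ()
eventually-Fin {m = suc m} A≥ = eventually-map (λ { (x , xs) zero → x ; (x , xs) (suc i) → xs i })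
  (eventually-× (A≥ zero) (eventually-Fin (A≥ ∘ suc)))

-- Local expansions with digits in F

module LocalExpansion {q : ℕ} {c ℓ₁ ℓ₂ : Level} (G : GlobalFunctionField q c ℓ₁ ℓ₂) where

  open PoleFiltration G public
  open F using (_≈_; _+_; _*_; _-_; 0#; 1#; _^F_)

  0≤+ : ∀ {n} → 0ℤ ℤ.≤ + n
  0≤+ = ℤ.+≤+ z≤n

  x-0≈x : ∀ x → x - 0# ≈ x
  x-0≈x = solve 1 (λ x → x :- :0 := x) F.refl
    where open SolverF

  module _ (P : Place) {z z⁻¹ : F.Carrier} (νz : ν P z ≡ [ 1ℤ ]) (zz⁻¹≈1 : z * z⁻¹ ≈ 1#) where

    exact-inverse : ν P z⁻¹ ≡ [ ℤ.- 1ℤ ]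
    exact-inverse = let n , νz⁻¹ = ≉0⇒exact P z⁻¹≉0 in
      ≡.trans νz⁻¹ (≡.cong [_] (cancel ([-]-injective
        (≡.trans (≡.sym (exact-* P νz νz⁻¹)) (≡.trans (Place.ν-cong P zz⁻¹≈1) (exact-1 P))))))
      where
      z⁻¹≉0 : ¬ (z⁻¹ ≈ 0#)
      z⁻¹≉0 z⁻¹≈0 = exact⇒≉0 P (exact-1 P)
        (F.trans (F.sym zz⁻¹≈1) (F.trans (F.*-congˡ z⁻¹≈0) (F.zeroʳ z)))
      cancel : ∀ {n} → 1ℤ ℤ.+ n ≡ 0ℤ → n ≡ ℤ.- 1ℤ
      cancel {n} eq = ≡.trans (SolverZ.solve 1 (λ n → n := :- :1 :+ (:1 :+ n)) ≡.refl n)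
        (≡.trans (≡.cong (λ m → ℤ.- 1ℤ ℤ.+ m) eq) ≡.refl)
        where open SolverZ

    hasOrders : HasOrders P
    hasOrders (+ n)      = z ^F n , ≡.trans (exact-^ P n νz) (≡.cong [_] (ℤ.*-identityʳ (+ n)))
    hasOrders ℤ.-[1+ n ] = z⁻¹ ^F suc n , ≡.trans (exact-^ P (suc n) exact-inverse)
      (≡.cong [_] (SolverZ.solve 1 (λ n → n :* :- :1 := :- n) ≡.refl (+ suc n)))
      where open SolverZ

  -- Σ_(k<M) (Σ_h a_(k,h) b_h) z^k in Horner form, so that subtracting the lowest digit and dividing
  -- by `z` shifts `a`.
  expand : ∀ {d} → Vector F.Carrier d → F.Carrier → ℕ → (ℕ → Vector K.Carrier d) → F.Carrier
  expand b z zero    a = 0#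
  expand b z (suc M) a = combination (a 0) b + z * expand b z M (a ∘ suc)

  expand-minus : ∀ {d} (b : Vector F.Carrier d) z M x a a′ →
    expand b z M (λ k h → a k h K.- x K.* a′ k h) ≈ expand b z M a - ι x * expand b z M a′
  expand-minus b z zero x a a′ = solve 1 (λ x → :0 := :0 :- x :* :0) F.refl (ι x)
    where open SolverF
  expand-minus b z (suc M) x a a′ = F.trans
    (F.+-cong (combination-minus (a 0) (a′ 0) x b) (F.*-congˡ (expand-minus b z M x (a ∘ suc) (a′ ∘ suc))))
    (solve 6 (λ s x s′ z t t′ → (s :- x :* s′) :+ z :* (t :- x :* t′) := (s :+ z :* t) :- x :* (s′ :+ z :* t′))
      F.refl _ (ι x) _ z _ _)
    where open SolverF

  expand-zero : ∀ {d} (b : Vector F.Carrier d) z M {a} → (∀ {k} → k < M → ∀ h → a k h K.≈ K.0#) →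
                expand b z M a ≈ 0#
  expand-zero b z zero    a≈0 = F.refl
  expand-zero b z (suc M) a≈0 = F.trans
    (F.+-cong (combination-zero b (a≈0 (s≤s z≤n)))
      (F.trans (F.*-congˡ (expand-zero b z M (λ k< → a≈0 (s≤s k<)))) (F.zeroʳ z)))
    (F.+-identityʳ 0#)

  module Expansion (P : Place) {d : ℕ} {b : Vector F.Carrier d} (isBasis : IsBasis (𝒪 P) (𝔪 P) b)
                   {z z⁻¹ : F.Carrier} (νz : ν P z ≡ [ 1ℤ ]) (zz⁻¹≈1 : z * z⁻¹ ≈ 1#) where
    open IsBasis isBasis

    z*-order : ∀ {M f} → Order≥ P (+ M) f → Order≥ P (+ suc M) (z * f)
    z*-order M≤f = order-* P (exact⇒order P νz) M≤f

    expand-regular : ∀ M a → Order≥ P 0ℤ (expand b z M a)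
    expand-regular zero    a = order-0 P
    expand-regular (suc M) a = order-+ P (order-combination P (a 0) contained)
      (order-≤ P 0≤+ (z*-order {0} (expand-regular M (a ∘ suc))))

    -- The residue class determines the lowest digit; the rest is divisible by `z`.
    expand-exists : ∀ M {f} → Order≥ P 0ℤ f → ∃ λ a → Order≥ P (+ M) (f - expand b z M a)
    expand-exists zero    0≤f = (λ _ _ → K.0#) , order-resp P (F.sym (x-0≈x _)) 0≤f
    expand-exists (suc M) {f} 0≤f =
      (λ { zero → a₀ ; (suc k) → a k }) , order-resp P factor (z*-order {M} (proj₂ rest))
      where
      open SetoidReasoning F.setoid
      open SolverF
      a₀ = proj₁ (spanning 0≤f)
      S = combination a₀ b
      u = f - S
      0≤z⁻¹u : Order≥ P 0ℤ (z⁻¹ * u)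
      0≤z⁻¹u = order-* P (exact⇒order P (exact-inverse P νz zz⁻¹≈1)) (proj₂ (spanning 0≤f))
      rest = expand-exists M 0≤z⁻¹u
      a = proj₁ rest
      t = expand b z M a
      factor : z * (z⁻¹ * u - t) ≈ f - (S + z * t)
      factor = begin
        z * (z⁻¹ * u - t)      ≈⟨ solve 4 (λ z z⁻¹ u t → z :* (z⁻¹ :* u :- t) := (z :* z⁻¹) :* u :- z :* t) F.refl z z⁻¹ u t ⟩
        (z * z⁻¹) * u - z * t  ≈⟨ F.+-congʳ (F.*-congʳ zz⁻¹≈1) ⟩
        1# * u - z * t         ≈⟨ solve 4 (λ f s z t → :1 :* (f :- s) :- z :* t := f :- (s :+ z :* t)) F.refl f S z t ⟩
        f - (S + z * t)        ∎

    expand-unique : ∀ M {a} → Order≥ P (+ M) (expand b z M a) → ∀ {k} → k < M → ∀ h → a k h K.≈ K.0#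
    expand-unique (suc M) {a} M≤ = digits
      where
      t = expand b z M (a ∘ suc)
      1≤zt : Order≥ P 1ℤ (z * t)
      1≤zt = z*-order {0} (expand-regular M (a ∘ suc))
      a₀≈0 : ∀ h → a 0 h K.≈ K.0#
      a₀≈0 = independent (a 0) (order-resp P
        (SolverF.solve 2 (λ s t → (s :+ t) :- t := s) F.refl (combination (a 0) b) (z * t))
        (order-minus P (order-≤ P (ℤ.+≤+ (s≤s z≤n)) M≤) 1≤zt))
        where open SolverF
      rest : Order≥ P (+ M) t
      rest = order-cancel P {1ℤ} νz (order-resp P
        (F.trans (F.+-congʳ (combination-zero b a₀≈0)) (F.+-identityˡ _)) M≤)
      digits : ∀ {k} → k < suc M → ∀ h → a k h K.≈ K.0#
      digits {zero}  _         = a₀≈0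
      digits {suc k} (s≤s k<M) = expand-unique M rest k<M

    expand-truncate : ∀ {M N} → M ≤ N → ∀ a → Order≥ P (+ M) (expand b z N a - expand b z M a)
    expand-truncate {N = N} z≤n a = order-resp P (F.sym (x-0≈x _)) (expand-regular N a)
    expand-truncate {suc M} {suc N} (s≤s M≤N) a = order-resp P
      (SolverF.solve 4 (λ z t t′ s → z :* (t :- t′) := (s :+ z :* t) :- (s :+ z :* t′)) F.refl z _ _ _)
      (z*-order (expand-truncate M≤N (a ∘ suc)))
      where open SolverF

    -- The precision `L` of the digits stays fixed, whereas the number `M` of digits compared drops
    -- with each division by `z`.
    sum-expand : ∀ {L} M {N} → M ≤ L → M ≤ N → ∀ {x : ℕ → F.Carrier} {a} → (∀ (k : Fin N) → Order≥ P 0ℤ (x (toℕ k))) →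
                 (∀ {k} → k < M → Order≥ P (+ L) (x k - combination (a k) b)) →
                 Order≥ P (+ M) (F.sum {N} (λ k → x (toℕ k) * (z ^F toℕ k)) - expand b z M a)
    sum-expand zero M≤L z≤n 0≤x _ = order-resp P (F.sym (x-0≈x _))
      (order-sum P λ k → order-* P (0≤x k) (order-≤ P (0≤+ {toℕ k ℕ.* 1}) (exact⇒order P (≡.trans (exact-^ P (toℕ k) νz) (≡.cong [_] (≡.sym (ℤ.pos-* (toℕ k) 1)))))))
    sum-expand {L} (suc M) {suc N} M<L (s≤s M≤N) {x} {a} 0≤x x≈a = order-resp P (begin
      (x₀ - s) + z * (Σ′ - t)         ≈⟨ solve 5 (λ x s z u t → (x :- s) :+ z :* (u :- t) := (x :* :1 :+ z :* u) :- (s :+ z :* t)) F.refl x₀ s z Σ′ t ⟩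
      (x₀ * 1# + z * Σ′) - (s + z * t) ≈⟨ F.+-congʳ (F.+-congˡ shift) ⟩
      F.sum {suc N} (λ k → x (toℕ k) * (z ^F toℕ k)) - (s + z * t) ∎)
      (order-+ P (order-≤ P (ℤ.+≤+ M<L) (x≈a (s≤s z≤n)))
        (z*-order (sum-expand {L} M (ℕ.<⇒≤ M<L) M≤N {x ∘ suc} {a ∘ suc} (0≤x ∘ suc) (λ k< → x≈a (s≤s k<)))))
      where
      open SetoidReasoning F.setoid
      open SolverF
      x₀ = x 0
      s = combination (a 0) b
      t = expand b z M (a ∘ suc)
      xz : Vector F.Carrier N
      xz k = x (suc (toℕ k)) * (z ^F toℕ k)
      Σ′ = F.sum xz
      shift : z * Σ′ ≈ F.sum {N} (λ k → x (suc (toℕ k)) * (z * (z ^F toℕ k)))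
      shift = F.trans (ΣF.*-distribˡ-sum z xz) (ΣF.sum-cong-≋ pointwise)
        where
        pointwise : ∀ k → z * xz k ≈ x (suc (toℕ k)) * (z * (z ^F toℕ k))
        pointwise k = solve 3 (λ z x w → z :* (x :* w) := x :* (z :* w)) F.refl z (x (suc (toℕ k))) (z ^F toℕ k)

  combination-difference : ∀ {d} (a : Vector K.Carrier d) (v w : Vector F.Carrier d) →
    combination a (λ h → v h - w h) ≈ combination a v - combination a w
  combination-difference {zero} a v w = F.sym (x-0≈x 0#)
  combination-difference {suc d} a v w = F.trans
    (F.+-congˡ (combination-difference (a ∘ suc) (v ∘ suc) (w ∘ suc)))
    (solve 5 (λ a v w s t → a :* (v :- w) :+ (s :- t) := (a :* v :+ s) :- (a :* w :+ t)) F.refl (ι (a zero)) (v zero) (w zero) _ _)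
    where open SolverF

  -- Corresponding combinations of `b` and `b′` differ by an element of `𝔪 P`, so they have the same
  -- residue class.
  residue-basis-perturb : ∀ P {d} {b b′ : Vector F.Carrier d} → IsBasis (𝒪 P) (𝔪 P) b →
                          (∀ h → Order≥ P 1ℤ (b′ h - b h)) → IsBasis (𝒪 P) (𝔪 P) b′
  residue-basis-perturb P {b = b} {b′} isBasis close = record
    { contained   = λ h → order-resp P
        (solve 2 (λ x y → (x :- y) :+ y := x) F.refl (b′ h) (b h))
        (order-+ P (order-≤ P 0≤+ (close h)) (contained h))
    ; independent = λ a ∈𝔪 → independent a (order-resp P
        (solve 2 (λ x y → x :- (x :- y) := y) F.refl _ _) (order-minus P ∈𝔪 (difference a)))
    ; spanning    = λ {f} 0≤f → let a , ∈𝔪 = spanning 0≤f in a , order-resp P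
        (solve 3 (λ f x y → (f :- y) :- (x :- y) := f :- x) F.refl f _ _) (order-minus P ∈𝔪 (difference a))
    }
    where
    open IsBasis isBasis
    open SolverF
    difference : ∀ a → Order≥ P 1ℤ (combination a b′ - combination a b)
    difference a = order-resp P (combination-difference a b′ b) (order-combination P a close)

  module _ {P : Place} (coefficientField : Completion.CoefficientField P) where
    open Completion P
    open CoefficientField coefficientField

    private
      _≈[_]_ : Sequence → ℤ → Sequence → Set
      α ≈[ M ] β = Eventually λ n → Order≥ P M (α n - β n)

      ≈-trans : ∀ {M α β γ} → α ≈[ M ] β → β ≈[ M ] γ → α ≈[ M ] γ
      ≈-trans αβ βγ = eventually-map
        (λ (x , y) → order-resp P (solve 3 (λ a b c → (a :- b) :+ (b :- c) := a :- c) F.refl _ _ _) (order-+ P x y))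
        (eventually-× αβ βγ)
        where open SolverF

    σ-regular : ∀ {a} → 𝒪 P a → Eventually λ n → Order≥ P 0ℤ (σ a n)
    σ-regular {a} 0≤a = eventually-map
      (λ 1≤ → order-resp P (solve 2 (λ x y → (x :- y) :+ y := x) F.refl _ a) (order-+ P (order-≤ P 0≤+ 1≤) 0≤a))
      (section 0≤a)
      where open SolverF

    -- K-linearity of `σ` up to order `M`: sums and products are respected, and constants are fixed.
    σ-combination : ∀ M {d} (a : Vector K.Carrier d) {v : Vector F.Carrier d} → (∀ h → 𝒪 P (v h)) →
      Eventually λ n → Order≥ P (+ M) (σ (combination a v) n - combination a (λ h → σ (v h) n))
    -- The value of `σ` at 0 is obtained from its value at the constant `ι K.0#`.
    σ-combination M {zero} a 0≤v = ≈-trans {+ M} {σ 0#} {σ (ι K.0#)} {λ _ → 0#}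
      (cong (order-0 P) (order-ι P K.0#)
        (order-resp P (F.sym (F.trans (F.+-congˡ (F.-‿cong ι.0#-homo)) (x-0≈x 0#))) (order-0 P)) (+ M))
      (eventually-map (order-resp P (F.+-congˡ (F.-‿cong ι.0#-homo))) (ι-homo K.0# (+ M)))
    σ-combination M {suc d} a {v} 0≤v = eventually-map assemble
      (eventually-× (+-homo 0≤a₀v₀ 0≤tail (+ M)) (eventually-× (*-homo (order-ι P a₀) (0≤v zero) (+ M))
        (eventually-× (ι-homo a₀ (+ M)) (eventually-× (σ-regular (0≤v zero)) (σ-combination M (a ∘ suc) (0≤v ∘ suc))))))
      where
      a₀ = a zero
      v₀ = v zero
      0≤a₀v₀ = order-ι* P a₀ (0≤v zero)
      0≤tail = order-combination P (a ∘ suc) (0≤v ∘ suc)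
      assemble : ∀ {n} → _ → Order≥ P (+ M) (σ (combination a v) n - combination a (λ h → σ (v h) n))
      assemble {n} (sum≥ , product≥ , ι≥ , σv₀≥0 , tail≥) = order-resp P
        (solve 7 (λ s s₀ t m v m′ t′ →
            (((s :- (s₀ :+ t)) :+ (s₀ :- m :* v)) :+ (m :- m′) :* v) :+ (t :- t′) := s :- (m′ :* v :+ t′))
          F.refl (σ (combination a v) n) (σ (ι a₀ * v₀) n) (σ (combination (a ∘ suc) (v ∘ suc)) n)
          (σ (ι a₀) n) (σ v₀ n) (ι a₀) (combination (a ∘ suc) (λ h → σ (v (suc h)) n)))
        (order-+ P (order-+ P (order-+ P sum≥ product≥)
          (order-≡ P (ℤ.+-identityʳ (+ M)) (order-* P ι≥ σv₀≥0))) tail≥)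
        where open SolverF

    -- Up to order L, the lifts σ (b h) to the completion may be replaced by
    -- elements of F, so that all further expansions take place in F.
    lift-basis : ∀ L {d} {b : Vector F.Carrier d} → (∀ h → 𝒪 P (b h)) → ∃ λ b′ →
                 (∀ h → Order≥ P 1ℤ (b′ h - b h)) ×
                 (Eventually λ n → ∀ h → Order≥ P (+ L) (σ (b h) n - b′ h))
    lift-basis L {d} {b} 0≤b = (λ h → σ (b h) N) , proj₂ sections N (ℕ.m≤n⊔m M N′) ,
      N , λ n N≤n h → proj₂ (cauchy′ h) n N (ℕ.≤-trans (M≤N h) N≤n) (M≤N h)
      where
      cauchy′ : ∀ h → ∃ λ N → ∀ m n → N ≤ m → N ≤ n → Order≥ P (+ L) (σ (b h) m - σ (b h) n)
      cauchy′ h = cauchy (0≤b h) (+ L)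
      sections = eventually-Fin (λ h → section (0≤b h))
      bounds : Eventually (λ n → ∀ h → proj₁ (cauchy′ h) ≤ n)
      bounds = eventually-Fin (λ h → proj₁ (cauchy′ h) , λ _ → id)
      M = proj₁ bounds
      N′ = proj₁ sections
      N = M ℕ.⊔ N′
      M≤N : ∀ h → proj₁ (cauchy′ h) ≤ N
      M≤N = proj₂ bounds N (ℕ.m≤m⊔n M N′)

  module _ {s} {P∞ : Place} {P : Fin s → Place} {e : Fin s → ℕ} (C : ColumnwiseConstruction P∞ P e) where
    open ColumnwiseConstruction C

    rows : ∀ i → ℕ → ℕ → Vector K.Carrier (e i)
    rows i r k h = matrix i (k ℕ.* e i ℕ.+ toℕ h) r

    -- The link between matrix and function field: the rows are digits of y_r with respect to a
    -- basis in F. This basis depends on `M`, as it approximates the lifted basis of the residue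
    -- class field only up to order `M`.
    matrix-expansion : ∀ i {z⁻¹} → z i * z⁻¹ ≈ 1# → ∀ M → ∃ λ b → IsBasis (𝒪 (P i)) (𝔪 (P i)) b ×
                       (∀ r → Order≥ (P i) (+ M) (y r - expand b (z i) M (rows i r)))
    matrix-expansion i zz⁻¹≈1 M = b , b-isBasis , y-expansion
      where
      open Completion (P i)
      open CoefficientField (coefficientField i)
      lifted = lift-basis (coefficientField i) M (IsBasis.contained (basis-isBasis i))
      b = proj₁ lifted
      b-isBasis = residue-basis-perturb (P i) (basis-isBasis i) (proj₁ (proj₂ lifted))
      open Expansion (P i) b-isBasis (z-local i) zz⁻¹≈1
      -- Three replacements: the residue class by its coordinates, `σ` of a combination by the
      -- combination of the lifts, and the lifts by `b`.
      digit-close : ∀ r k → Eventually λ n → Order≥ (P i) (+ M) (σ (β i k r) n - combination (rows i r k) b)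
      digit-close r k = eventually-map
        (λ {n} (x , y′ , w) → order-resp (P i)
          (F.trans
            (solve 4 (λ s t u v → ((s :- t) :+ (t :- u)) :+ (u :- v) := s :- v) F.refl
              (σ (β i k r) n) (σ (combination κ (basis i)) n) (combination κ (λ h → σ (basis i h) n)) (combination κ b))
            (F.+-congˡ (F.-‿cong (combination-cong {w = b} (λ h → K.sym (matrix-entries i k h r)) (λ _ → F.refl)))))
          (order-+ (P i) (order-+ (P i) x y′)
            (order-resp (P i) (combination-difference κ (λ h → σ (basis i h) n) b) (order-combination (P i) κ w))))
        (eventually-× (cong (β∈𝒪 i k r) 0≤κ (coordinates-correct i k r) (+ M))
          (eventually-× (σ-combination (coefficientField i) M κ (IsBasis.contained (basis-isBasis i)))
            (proj₂ (proj₂ lifted))))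
        where
        open SolverF
        κ = coordinates i k r
        0≤κ = order-combination (P i) κ (IsBasis.contained (basis-isBasis i))
      y-expansion : ∀ r → Order≥ (P i) (+ M) (y r - expand b (z i) M (rows i r))
      y-expansion r = order-resp (P i) (solve 3 (λ y s t → (y :- s) :+ (s :- t) := y :- t) F.refl (y r) _ _)
        (order-+ (P i) (proj₁ at-n)
          (sum-expand M ℕ.≤-refl (ℕ.m≤n+m M N) {λ k → σ (β i k r) n} {rows i r}
            (proj₁ (proj₂ at-n)) (λ {k} k<M → ≡.subst (λ k → Order≥ (P i) (+ M) (σ (β i k r) n - combination (rows i r k) b))
              (Fin.toℕ-fromℕ< k<M) (proj₂ (proj₂ at-n) (Fin.fromℕ< k<M)))))
        where
        open SolverF
        N = proj₁ (expansion i r (+ M))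
        -- N + M terms are past the threshold `N` of convergence and cover the `M` digits to be
        -- compared.
        everything = eventually-× (proj₂ (expansion i r (+ M)) (N ℕ.+ M) (ℕ.m≤m+n N M))
          (eventually-× {A = λ n → ∀ (k : Fin (N ℕ.+ M)) → Order≥ (P i) 0ℤ (σ (β i (toℕ k) r) n)}
            (eventually-Fin λ k → σ-regular (coefficientField i) (β∈𝒪 i (toℕ k) r))
            (eventually-Fin {m = M} λ k → digit-close r (toℕ k)))
        n = proj₁ everything
        at-n = proj₂ everything n ℕ.≤-refl

-- Enumeration of the digit coordinates at all places

total : ∀ {s} → Vector ℕ s → ℕ
total = Vector.foldr ℕ._+_ 0

flatten : ∀ {s} (D : Vector ℕ s) → Σ (Fin s) (Fin ∘ D) → Fin (total D)
flatten D (zero , j)  = j ↑ˡ _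
flatten D (suc i , j) = D zero ↑ʳ flatten (D ∘ suc) (i , j)

unflatten : ∀ {s} (D : Vector ℕ s) → Fin (total D) → Σ (Fin s) (Fin ∘ D)
unflatten {suc s} D = Sum.[ (zero ,_) , (λ ρ → let i , j = unflatten (D ∘ suc) ρ in suc i , j) ] ∘ splitAt (D zero)

unflatten-flatten : ∀ {s} (D : Vector ℕ s) x → unflatten D (flatten D x) ≡ x
unflatten-flatten D (zero , j)
  rewrite Fin.splitAt-↑ˡ (D zero) j (total (D ∘ suc)) = ≡.refl
unflatten-flatten D (suc i , j)
  rewrite Fin.splitAt-↑ʳ (D zero) (total (D ∘ suc)) (flatten (D ∘ suc) (i , j))
        | unflatten-flatten (D ∘ suc) (i , j) = ≡.refl

flatten-unflatten : ∀ {s} (D : Vector ℕ s) ρ → flatten D (unflatten D ρ) ≡ ρ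
flatten-unflatten {suc s} D ρ with splitAt (D zero) ρ in eq
... | inj₁ j  = Fin.splitAt⁻¹-↑ˡ eq
... | inj₂ ρ′ = ≡.trans (≡.cong (D zero ↑ʳ_) (flatten-unflatten (D ∘ suc) ρ′)) (Fin.splitAt⁻¹-↑ʳ {m = D zero} eq)

total-scale : ∀ {s} n (D : Vector ℕ s) (E : Vector ℕ s) →
              total (λ i → n ℕ.* D i ℕ.* E i) ≡ n ℕ.* total (λ i → D i ℕ.* E i)
total-scale {zero}  n D E = ≡.sym (ℕ.*-zeroʳ n)
total-scale {suc s} n D E = ≡.trans
  (≡.cong₂ ℕ._+_ (ℕ.*-assoc n (D zero) (E zero)) (total-scale n (D ∘ suc) (E ∘ suc)))
  (≡.sym (ℕ.*-distribˡ-+ n (D zero ℕ.* E zero) _))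

Fin⇒suc : ∀ {n} → Fin n → ∃ λ m → n ≡ suc m
Fin⇒suc {suc n} _ = n , ≡.refl

-∣i∣≤i : ∀ i → ℤ.- + ℤ.∣ i ∣ ℤ.≤ i
-∣i∣≤i (+ n)      = ℤ.neg-≤-pos
-∣i∣≤i ℤ.-[1+ n ] = ℤ.≤-refl

-- (i , k , h) is the h-th coordinate of the k-th digit at the i-th place;
-- M i digits are taken there.
module Coefficients {s} (e : Vector ℕ s) where

  Index : Set
  Index = Σ (Fin s) λ i → ℕ × Fin (e i)

  size : Vector ℕ s → ℕ
  size M = total λ i → M i ℕ.* e i

  module _ (M : Vector ℕ s) where
    private
      D : Vector ℕ s
      D i = M i ℕ.* e i

      digit : Σ (Fin s) (Fin ∘ D) → Σ (Fin s) λ i → Fin (M i) × Fin (e i)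
      digit (i , j) = i , remQuot (e i) j

      digit-injective : ∀ x y → digit x ≡ digit y → x ≡ y
      digit-injective (i , j) (i′ , j′) eq = ≡.trans (≡.sym (recombine (i , j))) (≡.trans (≡.cong undigit eq) (recombine (i′ , j′)))
        where
        undigit : (Σ (Fin s) λ i → Fin (M i) × Fin (e i)) → Σ (Fin s) (Fin ∘ D)
        undigit (i , k , h) = i , combine k h
        recombine : ∀ x → undigit (digit x) ≡ x
        recombine (i , j) = ≡.cong (i ,_) (Fin.combine-remQuot {M i} (e i) j)

    index : Fin (size M) → Index
    index ρ = let i , k , h = digit (unflatten D ρ) in i , toℕ k , h

    index-bounded : ∀ ρ → proj₁ (proj₂ (index ρ)) < M (proj₁ (index ρ))
    index-bounded ρ = Fin.toℕ<n _

    index-covers : ∀ i k h → k < M i → ∃ λ ρ → index ρ ≡ (i , k , h)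
    index-covers i k h k<M = flatten D (i , combine (Fin.fromℕ< k<M) h) , (begin
      index (flatten D (i , combine (Fin.fromℕ< k<M) h))
        ≡⟨ ≡.cong (λ x → let i , k , h = digit x in i , toℕ k , h) (unflatten-flatten D _) ⟩
      (let k , h = remQuot (e i) (combine (Fin.fromℕ< k<M) h) in i , toℕ k , h)
        ≡⟨ ≡.cong (λ x → let k , h = x in i , toℕ k , h) (Fin.remQuot-combine (Fin.fromℕ< k<M) h) ⟩
      (i , toℕ (Fin.fromℕ< k<M) , h)
        ≡⟨ ≡.cong (λ k → i , k , h) (Fin.toℕ-fromℕ< k<M) ⟩
      (i , k , h) ∎)
      where open ≡.≡-Reasoning

    index-injective : ∀ ρ ρ′ → index ρ ≡ index ρ′ → ρ ≡ ρ′
    index-injective ρ ρ′ eq = ≡.trans (≡.sym (flatten-unflatten D ρ)) (≡.trans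
      (≡.cong (flatten D) (digit-injective _ _ (lower ≡.refl ≡.refl eq))) (flatten-unflatten D ρ′))
      where
      lower : ∀ {i i′} {k : Fin (M i)} {h} {k′ : Fin (M i′)} {h′ n n′} → toℕ k ≡ n → toℕ k′ ≡ n′ →
              _≡_ {A = Index} (i , n , h) (i′ , n′ , h′) →
              _≡_ {A = Σ (Fin s) λ i → Fin (M i) × Fin (e i)} (i , k , h) (i′ , k′ , h′)
      lower k≡n k′≡n ≡.refl with Fin.toℕ-injective (≡.trans k≡n (≡.sym k′≡n))
      ... | ≡.refl = ≡.refl

  index-lift : ∀ {M N : Vector ℕ s} → (∀ i → M i ≤ N i) → ∀ ρ → ∃ λ ρ′ → index N ρ′ ≡ index M ρ
  index-lift {M} {N} M≤N ρ =
    index-covers N (proj₁ (index M ρ)) _ (proj₂ (proj₂ (index M ρ))) (ℕ.<-≤-trans (index-bounded M ρ) (M≤N _))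

-- Independence of the rows

module RowIndependence {q : ℕ} {c ℓ₁ ℓ₂ : Level} (G : GlobalFunctionField q c ℓ₁ ℓ₂) where

  open LocalExpansion G public
  open F using (_≈_; _+_; _*_; _-_; 0#; 1#; _^F_)

  private
    minus-neg : ∀ u x v → u K.- (K.- x) K.* v K.≈ u K.+ x K.* v
    minus-neg = solve 3 (λ u x v → u :- (:- x) :* v := u :+ x :* v) K.refl
      where open SolverK

    0+x0 : ∀ x → K.0# K.+ x K.* K.0# K.≈ K.0#
    0+x0 = solve 1 (λ x → :0 :+ x :* :0 := :0) K.refl
      where open SolverK

    0-x0 : ∀ x → K.0# K.- x K.* K.0# K.≈ K.0#
    0-x0 = solve 1 (λ x → :0 :- x :* :0 := :0) K.refl
      where open SolverK

  -- The number of conditions is a sum `size M`, known to be a successor only through the presence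
  -- of `p`; hence the equation as an argument.
  eliminate-except : ∀ {i x} {I : Set i} {Coord : F.Carrier → (I → K.Carrier) → Set x} → IsLinear Coord →
    ∀ {m m′ n} → m ≡ suc m′ → (idx : Fin m → I) (p : Fin m) →
    HasIndependent (λ f → ∃ λ a → Coord f a) (m′ ℕ.+ n) →
    HasIndependent (λ f → ∃ λ a → Coord f a × ∀ ρ → ρ ≢ p → a (idx ρ) K.≈ K.0#) n
  eliminate-except linear ≡.refl idx p h = independent-⊆
    (λ (a , x , a≈0) → a , x , λ ρ ρ≢p → ≡.subst (λ ρ → a (idx ρ) K.≈ K.0#)
      (Fin.punchIn-punchOut (ρ≢p ∘ ≡.sym)) (a≈0 (punchOut (ρ≢p ∘ ≡.sym))))
    (eliminate linear (idx ∘ punchIn p) h)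

  sum-single : ∀ {n} (t : Vector K.Carrier n) p → (∀ ρ → ρ ≢ p → t ρ K.≈ K.0#) → ΣK.sum t K.≈ t p
  sum-single t zero t≈0 = K.trans (K.+-congˡ (sum-zero (t ∘ suc) (λ ρ → t≈0 (suc ρ) λ ()))) (K.+-identityʳ _)
    where
    sum-zero : ∀ {n} (t : Vector K.Carrier n) → (∀ ρ → t ρ K.≈ K.0#) → ΣK.sum t K.≈ K.0#
    sum-zero {n} t t≈0 = K.trans (ΣK.sum-cong-≋ t≈0) (ΣK.sum-replicate-zero n)
  sum-single t (suc p) t≈0 = K.trans
    (K.+-cong (t≈0 zero λ ()) (sum-single (t ∘ suc) p (λ ρ ρ≢p → t≈0 (suc ρ) (ρ≢p ∘ Fin.suc-injective))))
    (K.+-identityˡ _)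

  form : ∀ {i n} {I : Set i} → Vector K.Carrier n → (Fin n → I) → (I → K.Carrier) → K.Carrier
  form l idx a = ΣK.sum λ ρ → l ρ K.* a (idx ρ)

  form-minus : ∀ {i n} {I : Set i} (l : Vector K.Carrier n) (idx : Fin n → I) x a b →
               form l idx (λ p → a p K.- x K.* b p) K.≈ form l idx a K.- x K.* form l idx b
  form-minus {n = zero}  l idx x a b = SolverK.solve 1 (λ x → :0 := :0 :- x :* :0) K.refl x
    where open SolverK
  form-minus {n = suc n} l idx x a b = K.trans (K.+-congˡ (form-minus (l ∘ suc) (idx ∘ suc) x a b))
    (SolverK.solve 6 (λ l a x b s t → l :* (a :- x :* b) :+ (s :- x :* t) := (l :* a :+ s) :- x :* (l :* b :+ t))
      K.refl (l zero) (a (idx zero)) x (b (idx zero)) _ _)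
    where open SolverK

  form-zero : ∀ {i n} {I : Set i} (l : Vector K.Carrier n) (idx : Fin n → I) {a} →
              (∀ ρ → a (idx ρ) K.≈ K.0#) → form l idx a K.≈ K.0#
  form-zero {n = n} l idx a≈0 = K.trans
    (ΣK.sum-cong-≋ λ ρ → K.trans (K.*-congˡ (a≈0 ρ)) (K.zeroʳ (l ρ))) (ΣK.sum-replicate-zero n)

  -- A relation with nonzero coefficient at `p` supplies the condition that `eliminate-except`
  -- leaves out.
  form-single : ∀ {i n} {I : Set i} (l : Vector K.Carrier n) (idx : Fin n → I) {a} p →
                (∀ ρ → ρ ≢ p → a (idx ρ) K.≈ K.0#) → ¬ (l p K.≈ K.0#) → form l idx a K.≈ K.0# →
                ∀ ρ → a (idx ρ) K.≈ K.0#
  form-single l idx {a} p a≈0 lp≉0 form≈0 ρ with ρ Fin.≟ p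
  ... | no ρ≢p     = a≈0 ρ ρ≢p
  ... | yes ≡.refl = K-integral lp≉0 (K.trans (K.sym
          (sum-single (λ ρ → l ρ K.* a (idx ρ)) p λ ρ ρ≢p → K.trans (K.*-congˡ (a≈0 ρ ρ≢p)) (K.zeroʳ (l ρ)))) form≈0)

  totalDegree-tabulate : ∀ {s} {P : Fin s → Place} {e : Fin s → ℕ} (n : Fin s → ℕ) → (∀ i → HasDegree (P i) (e i)) →
                         TotalDegree (List.tabulate λ i → P i , + n i) (+ total (λ i → n i ℕ.* e i))
  totalDegree-tabulate {zero} n degree = []
  totalDegree-tabulate {suc s} {P} {e} n degree = ≡.subst
    (TotalDegree (List.tabulate λ i → P i , + n i))
    (≡.cong (ℤ._+ + total (λ i → n (suc i) ℕ.* e (suc i))) (≡.sym (ℤ.pos-* (n zero) (e zero))))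
    (degree zero ∷ totalDegree-tabulate {P = P ∘ suc} (n ∘ suc) (degree ∘ suc))

  order-^ : ∀ P {f} j → Order≥ P 0ℤ f → Order≥ P 0ℤ (f ^F j)
  order-^ P zero    0≤f = exact⇒order P (exact-1 P)
  order-^ P (suc j) 0≤f = order-* P 0≤f (order-^ P j 0≤f)

  module Rows {s} {P∞ : Place} {P : Fin s → Place} {e : Fin s → ℕ} (C : ColumnwiseConstruction P∞ P e)
              (degree∞ : HasDegree P∞ 1) (degree : ∀ i → HasDegree (P i) (e i))
              {g : ℕ} (genus : IsGenus g)
              (P∞≉P : ∀ i → ¬ (P∞ ≈ᴾ P i)) (P≉P : ∀ i j → i ≢ j → ¬ (P i ≈ᴾ P j))
              (orders∞ : HasOrders P∞)
              (z-inverse : ∀ i → ∃ λ z⁻¹ → ColumnwiseConstruction.z C i * z⁻¹ ≈ 1#) where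
    open ColumnwiseConstruction C
    open Coefficients e
    open Poles C orders∞ degree∞ genus

    column : ℕ → Index → K.Carrier
    column r (i , k , h) = rows C i r k h

    below-mono : ∀ {M N} → M ≤ N → ∀ {f} → Below M f → Below N f
    below-mono M≤N (∞≥ , Q≥) = order-≤ P∞ (ℤ.neg-mono-≤ (ℤ.+-monoˡ-≤ (ℤ.- 1ℤ) (ℤ.+≤+ M≤N))) ∞≥ , Q≥

    nonGaps<-≤ : ∀ N → nonGaps< N ≤ N
    nonGaps<-≤ zero = z≤n
    nonGaps<-≤ (suc N) with step N
    ... | nongap _ count≡ _ = ℕ.≤-trans (ℕ.≤-reflexive count≡) (s≤s (nonGaps<-≤ N))
    ... | gap count≡ _      = ℕ.≤-trans (ℕ.≤-reflexive count≡) (ℕ.m≤n⇒m≤1+n (nonGaps<-≤ N))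

    module _ (M : Fin s → ℕ) where
      private
        expansions = λ i → matrix-expansion C i (proj₂ (z-inverse i)) (M i)
        b : ∀ i → Vector F.Carrier (e i)
        b i = proj₁ (expansions i)
        b-isBasis : ∀ i → IsBasis (𝒪 (P i)) (𝔪 (P i)) (b i)
        b-isBasis i = proj₁ (proj₂ (expansions i))
        module E i = Expansion (P i) (b-isBasis i) (z-local i) (proj₂ (z-inverse i))

      -- A relation, since the digits from `N i` on are arbitrary. The basis is chosen for precision
      -- `M` even if `N` is larger, so the columns of the matrix are coefficients of the y_r for N =
      -- M.
      Coord : Vector ℕ s → F.Carrier → (Index → K.Carrier) → Set
      Coord N f a = ∀ i → Order≥ (P i) (+ N i) (f - expand (b i) (z i) (N i) λ k h → a (i , k , h))

      Coord-resp : ∀ {N f f′ a} → f ≈ f′ → Coord N f a → Coord N f′ a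
      Coord-resp f≈f′ x i = order-resp (P i) (F.+-congʳ f≈f′) (x i)

      Coord-linear : ∀ N → IsLinear (Coord N)
      Coord-linear N {f} {f′} {a} {a′} x x′ t i = order-resp (P i)
        (F.sym (F.trans (F.+-congˡ (F.-‿cong (expand-minus (b i) (z i) (N i) t _ _)))
          (solve 5 (λ f t f′ u u′ → (f :- t :* f′) :- (u :- t :* u′) := (f :- u) :- t :* (f′ :- u′)) F.refl f (ι t) f′ _ _)))
        (order-minus (P i) (x i) (order-ι* (P i) t (x′ i)))
        where open SolverF

      Coord-exists : ∀ N {f} → (∀ i → Order≥ (P i) 0ℤ f) → ∃ λ a → Coord N f a
      Coord-exists N 0≤f = (λ (i , k , h) → proj₁ (E.expand-exists i (N i) (0≤f i)) k h) ,
                           λ i → proj₂ (E.expand-exists i (N i) (0≤f i))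

      Coord-order⇒zero : ∀ {N f a} → Coord N f a → (∀ i → Order≥ (P i) (+ N i) f) →
                         ∀ i {k} → k < N i → ∀ h → a (i , k , h) K.≈ K.0#
      Coord-order⇒zero {N} x N≤f i = E.expand-unique i (N i) (order-resp (P i)
        (solve 2 (λ f u → f :- (f :- u) := u) F.refl _ _) (order-minus (P i) (N≤f i) (x i)))
        where open SolverF

      Coord-zero⇒order : ∀ {N f a} → Coord N f a → (∀ ρ → a (index N ρ) K.≈ K.0#) →
                         ∀ i → Order≥ (P i) (+ N i) f
      Coord-zero⇒order {N} {f} {a} x a≈0 i = order-resp (P i)
        (F.trans (F.+-congˡ (F.-‿cong (expand-zero (b i) (z i) (N i) digit≈0))) (x-0≈x f)) (x i)
        where
        digit≈0 : ∀ {k} → k < N i → ∀ h → a (i , k , h) K.≈ K.0#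
        digit≈0 {k} k< h = let ρ , eq = index-covers N i k h k< in ≡.subst (λ p → a p K.≈ K.0#) eq (a≈0 ρ)

      Coord-truncate : ∀ {N f a} → (∀ i → M i ≤ N i) → Coord N f a → Coord M f a
      Coord-truncate M≤N x i = order-resp (P i)
        (solve 3 (λ f u v → (f :- u) :+ (u :- v) := f :- v) F.refl _ _ _)
        (order-+ (P i) (order-≤ (P i) (ℤ.+≤+ (M≤N i)) (x i)) (E.expand-truncate i (M≤N i) _))
        where open SolverF

      Coord-y : ∀ r → Coord M (y r) (column r)
      Coord-y r i = proj₂ (proj₂ (expansions i)) r

      module _ (l : Vector K.Carrier (size M)) where

        φ : (Index → K.Carrier) → K.Carrier
        φ = form l (index M)

        φ-order : ∀ {f a} → Coord M f a → (∀ i → Order≥ (P i) (+ M i) f) → φ a K.≈ K.0#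
        φ-order {f} {a} x M≤f = form-zero l (index M) {a} λ ρ →
          Coord-order⇒zero {M} {f} {a} x M≤f _ (index-bounded M ρ) _

        -- The differences of two coefficient families of `f` are coefficients of f - f = 0.
        φ-unique : ∀ {f a a′} → Coord M f a → Coord M f a′ → φ a′ K.≈ K.0# → φ a K.≈ K.0#
        φ-unique {f} {a} {a′} x x′ φa′≈0 = begin
          φ a                          ≈⟨ solve 1 (λ u → u := u :- :1 :* :0) K.refl (φ a) ⟩
          φ a K.- K.1# K.* K.0#        ≈⟨ K.+-congˡ (K.-‿cong (K.*-congˡ φa′≈0)) ⟨
          φ a K.- K.1# K.* φ a′        ≈⟨ form-minus l (index M) K.1# a a′ ⟨
          φ (λ p → a p K.- K.1# K.* a′ p) ≈⟨ φ-order (Coord-resp {M} f-f≈0 (Coord-linear M {f} {f} {a} {a′} x x′ K.1#)) (λ i → order-0 (P i)) ⟩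
          K.0#                         ∎
          where
          open SetoidReasoning K.setoid
          open SolverK
          f-f≈0 : f - ι K.1# * f ≈ 0#
          f-f≈0 = F.trans (F.+-congˡ (F.-‿cong (F.trans (F.*-congʳ ι.1#-homo) (F.*-identityˡ f)))) (F.-‿inverseʳ f)

        Coord-add-y : ∀ {f a} x r → Coord M (f - ι x * y r) a →
                      ∃ λ a′ → Coord M f a′ × φ a′ K.≈ φ a K.+ x K.* φ (column r)
        Coord-add-y {f} {a} x r coord = (λ p → a p K.- (K.- x) K.* column r p) ,
          Coord-resp {M} (F.trans (F.+-congˡ (F.-‿cong (F.*-congʳ (ι.-‿homo x))))
              (solve 3 (λ f x y → (f :- x :* y) :- (:- x) :* y := f) F.refl f (ι x) (y r)))
            (Coord-linear M {f - ι x * y r} {y r} {a} {column r} coord (Coord-y r) (K.- x)) ,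
          K.trans (form-minus l (index M) (K.- x) a (column r))
            (minus-neg (φ a) x (φ (column r)))
          where open SolverF

        φ-vanishes : ∀ N → (∀ r → r < nonGaps< N → φ (column r) K.≈ K.0#) →
                     ∀ {f} → Below N f → ∃ λ a → Coord M f a × φ a K.≈ K.0#
        φ-vanishes N columns≈0 = below-induction (λ f → ∃ λ a → Coord M f a × φ a K.≈ K.0#) N
          (λ {f} f≈0 → (λ _ → K.0#) ,
            (λ i → order-resp (P i) (F.sym (F.trans (F.+-cong f≈0 (F.-‿cong (expand-zero (b i) (z i) (M i) λ _ _ → K.refl))) (x-0≈x 0#))) (order-0 (P i))) ,
            form-zero l (index M) (λ _ → K.refl))
          λ r x r< (a , coord , φa≈0) → let a′ , coord′ , eq = Coord-add-y {a = a} x r coord in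
            a′ , coord′ , K.trans eq (K.trans (K.+-cong φa≈0 (K.*-congˡ (columns≈0 r r<)))
              (0+x0 x))

        module _ {m c′} (count≡ : size M ≡ suc c′) (m-large : g ℕ.+ size M ≤ m)
                 (columns≈0 : ∀ r → r < m → φ (column r) K.≈ K.0#) p (lp≉0 : ¬ (l p K.≈ K.0#)) where

          -- The space W of the overview: pole order less than `nonGap m` means membership in the
          -- span of y_0, ..., y_(m-1).
          V : Pred F.Carrier _
          V f = Below (nonGap m) f × (∀ i → Order≥ (P i) (+ M i) f)

          V-closed : ∀ {f f′} x → V f → V f′ → V (f - ι x * f′)
          V-closed x (b , M≤f) (b′ , M≤f′) = below-minus-ι* {nonGap m} x b b′ ,
            λ i → order-minus (P i) (M≤f i) (order-ι* (P i) x (M≤f′ i))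

          -- The relation l makes one of the vanishing conditions redundant.
          V-independent : HasIndependent V (suc g)
          V-independent = independent-⊆
            (λ {f} (a , (f-below , coord , φa≈0) , a≈0) → f-below ,
              Coord-zero⇒order {M} {f} {a} coord (form-single l (index M) {a} p a≈0 lp≉0 φa≈0))
            (eliminate-except {Coord = λ f a → Below (nonGap m) f × Coord M f a × φ a K.≈ K.0#}
              (λ {f} {f′} {a} {a′} (f-below , x , φa) (f′-below , x′ , φa′) t →
                below-minus-ι* {nonGap m} t f-below f′-below , Coord-linear M {f} {f′} {a} {a′} x x′ t ,
                K.trans (form-minus l (index M) t a a′)
                  (K.trans (K.+-cong φa (K.-‿cong (K.*-congˡ φa′))) (0-x0 t)))
              count≡ (index M) p
              (independent-≤ enough (independent-⊆
                (λ f-below → let a , coord , φa≈0 = φ-vanishes (nonGap m)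
                                   (λ r r< → columns≈0 r (ℕ.≤-trans r< (ℕ.≤-reflexive (nonGaps<-nonGap m)))) f-below
                             in a , f-below , coord , φa≈0)
                (below-independent (nonGap m)))))
            where
            -- `c′` conditions remain, one less than `size M`, and m ≥ g + `size M` leaves g + 1
            -- dimensions.
            enough : c′ ℕ.+ suc g ≤ nonGaps< (nonGap m)
            enough = begin
              c′ ℕ.+ suc g         ≡⟨ ℕ.+-suc c′ g ⟩
              suc c′ ℕ.+ g         ≡⟨ ≡.cong (ℕ._+ g) count≡ ⟨
              size M ℕ.+ g        ≡⟨ ℕ.+-comm (size M) g ⟩
              g ℕ.+ size M        ≤⟨ m-large ⟩
              m                    ≡⟨ nonGaps<-nonGap m ⟨
              nonGaps< (nonGap m)  ∎
              where open ℕ.≤-Reasoning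

          regular-at : ∀ i {f N} → Below N f → Order≥ (P i) 0ℤ f
          regular-at i (_ , Q≥) = Q≥ (P i) (P∞≉P i ∘ ≈ᴾ-sym {P i} {P∞})

          below-* : ∀ {p p′ f f′} → Below (suc p) f → Below (suc p′) f′ → Below (suc (p ℕ.+ p′)) (f * f′)
          below-* {p} {p′} (∞≥ , Q≥) (∞≥′ , Q≥′) =
            order-≡ P∞ (≡.trans (≡.sym (ℤ.neg-distrib-+ (+ p) (+ p′))) ≡.refl) (order-* P∞ ∞≥ ∞≥′) ,
            λ Q Q≉ → order-* Q (Q≥ Q Q≉) (Q≥′ Q Q≉)

          -- V has more than g pole orders, so that for one of them the difference
          -- to the pole order of y R is no gap: then some product of an element
          -- of V with some y r has the pole order of y R.
          module _ R (m≤R : m ≤ R) (smaller≈0 : ∀ r → r < R → φ (column r) K.≈ K.0#)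
                   (φR≉0 : ¬ (φ (column R) K.≈ K.0#)) where

            private
              N = nonGap R

            -- For w = f y_r, the difference w - x y_R has a smaller pole order and is killed by φ.
            -- So φ(w) = x φ(y_R) with x ≠ 0, although `w` vanishes to the orders `M i`.
            no-product : ∀ {f} r p → p ℕ.+ nonGap r ≡ N → V f → Below (suc p) f → ¬ (ν P∞ f ≡ [ ℤ.- + p ])
            no-product {f} r p p+r≡N (_ , M≤f) f-below νf with step N
            ... | gap _ reduce = exact⇒not-below N (y-exact R) (reduce (y-below R))
            ... | nongap _ _ reduce = x≉0 (K-integral′ φR≉0 (K.trans (K.sym (K.+-identityˡ _))
                    (K.trans (K.+-congʳ (K.sym φa≈0)) (K.trans (K.sym eq) (φ-order {w} {a′} coord′ M≤w)))))
              where
              K-integral′ : ∀ {x y} → ¬ (y K.≈ K.0#) → x K.* y K.≈ K.0# → x K.≈ K.0#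
              K-integral′ y≉0 xy≈0 = K-integral y≉0 (K.trans (K.*-comm _ _) xy≈0)
              w = f * y r
              νw : ν P∞ w ≡ [ ℤ.- + N ]
              νw = ≡.trans (exact-* P∞ νf (y-exact r)) (≡.cong [_]
                (≡.trans (≡.sym (ℤ.neg-distrib-+ (+ p) (+ nonGap r))) (≡.cong (λ n → ℤ.- + n) p+r≡N)))
              w-below : Below (suc N) w
              w-below = ≡.subst (λ n → Below (suc n) w) p+r≡N (below-* {p} {nonGap r} f-below (y-below r))
              M≤w : ∀ i → Order≥ (P i) (+ M i) w
              M≤w i = order-≡ (P i) (ℤ.+-identityʳ (+ M i)) (order-* (P i) (M≤f i) (regular-at i {N = suc (nonGap r)} (y-below r)))
              reduced : ∃ λ x → Below N (w - ι x * y R)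
              reduced = ≡.subst (λ k → ∃ λ x → Below N (w - ι x * y k)) (nonGaps<-nonGap R) (reduce w-below)
              x = proj₁ reduced
              vanishing = φ-vanishes N (λ r r< → smaller≈0 r (ℕ.≤-trans r< (ℕ.≤-reflexive (nonGaps<-nonGap R)))) (proj₂ reduced)
              a = proj₁ vanishing
              φa≈0 = proj₂ (proj₂ vanishing)
              added = Coord-add-y {w} {a} x R (proj₁ (proj₂ vanishing))
              a′ = proj₁ added
              coord′ = proj₁ (proj₂ added)
              eq = proj₂ (proj₂ added)
              x≉0 : ¬ (x K.≈ K.0#)
              x≉0 x≈0 = exact⇒not-below N νw (below-resp {N}
                (F.trans (F.+-congˡ (F.-‿cong (F.trans (F.*-congʳ (F.trans (ι.⟦⟧-cong x≈0) ι.0#-homo)) (F.zeroˡ _)))) (x-0≈x w))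
                (proj₂ reduced))

            -- The reflection t ↦ N - t maps the numbers less than `p` onto those from `q` to `N`.
            -- By `no-product` it sends no pole order of `V` to a pole number, so the `n` pole
            -- orders and the pole numbers from `q` to `N` together are at most `p`. The term
            -- `nonGaps< q` on the right replaces a subtraction on the left.
            pole-orders-bound : ∀ p q {n} → q ℕ.+ p ≡ suc N → HasIndependent (λ f → V f × Below p f) n →
                                n ℕ.+ nonGaps< (suc N) ≤ p ℕ.+ nonGaps< q
            pole-orders-bound zero q {zero} q≡ _ = ℕ.≤-reflexive (≡.cong nonGaps< (≡.trans (≡.sym q≡) (ℕ.+-identityʳ q)))
            pole-orders-bound zero q {suc n} q≡ h =
              let _ , (_ , f-below) , f≉0 = independent-nonzero P∞ h in contradiction (below-zero f-below) f≉0
            pole-orders-bound (suc p) q {n} q+p≡N h with step q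
            ... | nongap q-nongap count≡ _ = ℕ.≤-trans
                    (pole-orders-bound p (suc q) (≡.trans (≡.sym (ℕ.+-suc q p)) q+p≡N) (independent-⊆ lower h))
                    (ℕ.≤-reflexive (≡.trans (≡.cong (p ℕ.+_) count≡) (ℕ.+-suc p _)))
              where
              lower : ∀ {f} → V f × Below (suc p) f → V f × Below p f
              lower {f} (Vf , f-below) = Vf , decidable-stable (order? P∞ _ f) (λ ≱ →
                no-product (nonGaps< q) p
                  (≡.trans (≡.cong (p ℕ.+_) q-nongap) (≡.trans (ℕ.+-comm p q) (ℕ.suc-injective (≡.trans (≡.sym (ℕ.+-suc q p)) q+p≡N))))
                  Vf f-below (not-below⇒exact p f-below (≱ ∘ proj₁))) , proj₂ f-below
            pole-orders-bound (suc p) q {zero} q+p≡N h | gap count≡ _ = ℕ.m≤n⇒m≤1+n (ℕ.≤-trans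
              (pole-orders-bound p (suc q) (≡.trans (≡.sym (ℕ.+-suc q p)) q+p≡N) independent-zero)
              (ℕ.≤-reflexive (≡.cong (p ℕ.+_) count≡)))
            pole-orders-bound (suc p) q {suc n} q+p≡N h | gap count≡ _ = s≤s (ℕ.≤-trans
              (pole-orders-bound p (suc q) (≡.trans (≡.sym (ℕ.+-suc q p)) q+p≡N) (leading-eliminate V-closed p h))
              (ℕ.≤-reflexive (≡.cong (p ℕ.+_) count≡)))

            -- For q = 0, the reflection would turn the g + 1 pole orders of `V` into g + 1 gaps up
            -- to `N`.
            no-exception : ⊥
            no-exception = ℕ.<-irrefl ≡.refl (begin-strict
              suc N                       ≤⟨ gap-bound (suc N) ⟩
              nonGaps< (suc N) ℕ.+ g      ≡⟨ ℕ.+-comm _ g ⟩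
              g ℕ.+ nonGaps< (suc N)      <⟨ ℕ.n<1+n _ ⟩
              suc g ℕ.+ nonGaps< (suc N)  ≤⟨ pole-orders-bound (suc N) 0 ≡.refl (independent-⊆
                  (λ Vf → Vf , below-mono (ℕ.m≤n⇒m≤1+n (nonGap-≤ m≤R)) (proj₁ Vf)) V-independent) ⟩
              suc N ℕ.+ 0                 ≡⟨ ℕ.+-identityʳ _ ⟩
              suc N                       ∎)
              where open ℕ.≤-Reasoning

          φ-column≈0 : ∀ R r → r < R → φ (column r) K.≈ K.0#
          φ-column≈0 (suc R) r r< with ℕ.m≤n⇒m<n∨m≡n (ℕ.s≤s⁻¹ r<)
          ... | inj₁ r<R    = φ-column≈0 R r r<R
          ... | inj₂ ≡.refl with R ℕ.<? m
          ...   | yes R<m = columns≈0 R R<m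
          ...   | no R≮m  = decidable-stable (φ (column R) ≟K K.0#)
                  (no-exception R (ℕ.≮⇒≥ R≮m) (φ-column≈0 R))

          φ-Coord : ∀ N {f a} → Below N f → Coord M f a → φ a K.≈ K.0#
          φ-Coord N {f} {a} f-below coord =
            let a′ , coord′ , φa′≈0 = φ-vanishes N (λ r _ → φ-column≈0 (suc r) r ℕ.≤-refl) f-below
            in φ-unique {f} {a} {a′} coord coord′ φa′≈0

          -- Multiplication by powers of an element h of V embeds the functions with
          -- poles in multiples of the zeros of h into the functions with poles at P∞
          -- only, whose coefficients satisfy the relation l.
          module _ {h} (Vh : V h) (h≉0 : ¬ (h ≈ 0#)) where

            private
              order-at : ∀ i → ∃ λ o → ν (P i) h ≡ [ + o ] × M i ≤ o
              order-at i with ≉0⇒exact (P i) h≉0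
              ... | n , νh with exact⇒≤ (P i) νh (proj₂ Vh i)
              ...   | ℤ.+≤+ M≤o = _ , νh , M≤o

              o : Fin s → ℕ
              o i = proj₁ (order-at i)

              M≤o : ∀ i → M i ≤ o i
              M≤o i = proj₂ (proj₂ (order-at i))

              νh^ : ∀ j i → ν (P i) (h ^F j) ≡ [ + (j ℕ.* o i) ]
              νh^ j i = ≡.trans (exact-^ (P i) j (proj₁ (proj₂ (order-at i)))) (≡.cong [_] (≡.sym (ℤ.pos-* j (o i))))

            -- ℒ(j O) for O = Σ o_i P_i, without the list of terms.
            Bounded : ℕ → Pred F.Carrier _
            Bounded j f = (∀ i → Order≥ (P i) (ℤ.- + (j ℕ.* o i)) f) ×
                          (∀ Q → (∀ i → ¬ (Q ≈ᴾ P i)) → Order≥ Q 0ℤ f)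

            bounded-closed : ∀ j {f f′} x → Bounded j f → Bounded j f′ → Bounded j (f - ι x * f′)
            bounded-closed j x (P≥ , Q≥) (P≥′ , Q≥′) =
              (λ i → order-minus (P i) (P≥ i) (order-ι* (P i) x (P≥′ i))) ,
              (λ Q Q∉ → order-minus Q (Q≥ Q Q∉) (order-ι* Q x (Q≥′ Q Q∉)))

            h^-regular : ∀ j {f} → Bounded j f → ∀ i → Order≥ (P i) 0ℤ (h ^F j * f)
            h^-regular j (P≥ , _) i = order-≡ (P i) (ℤ.+-inverseʳ (+ (j ℕ.* o i)))
              (order-* (P i) (exact⇒order (P i) (νh^ j i)) (P≥ i))

            h^-below : ∀ j {f} → Bounded j f → ∃ λ N → Below N (h ^F j * f)
            -- `f` has no pole at `P∞`, so the order of the product there is at least j n. The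
            -- absolute value gives a bound for either sign of `n`.
            h^-below j {f} bounded@(P≥ , Q≥) = suc ℤ.∣ + j ℤ.* n ∣ ,
              order-≤ P∞ (-∣i∣≤i (+ j ℤ.* n)) (order-≡ P∞ (ℤ.+-identityʳ (+ j ℤ.* n))
                (order-* P∞ (exact⇒order P∞ (exact-^ P∞ j νh)) (Q≥ P∞ P∞≉P))) ,
              λ Q Q≉P∞ → decidable-stable (order? Q 0ℤ _) λ ≱ →
                ≱ (order-* Q (order-^ Q j (proj₂ (proj₁ Vh) Q Q≉P∞)) (Q≥ Q λ i Q≈Pi →
                  ≱ (order-≈ᴾ {P i} {Q} (≈ᴾ-sym {Q} {P i} Q≈Pi) (h^-regular j bounded i))))
              where
              n = proj₁ (≉0⇒exact P∞ h≉0)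
              νh = proj₂ (≉0⇒exact P∞ h≉0)

            bounded-pred : ∀ j {f} → Bounded (suc j) f → (∀ i → Order≥ (P i) (+ o i) (h ^F suc j * f)) → Bounded j f
            bounded-pred j (_ , Q≥) o≤ = (λ i → order-cancel (P i) (νh^ (suc j) i)
              (order-≡ (P i) (≡.sym (cancel i)) (o≤ i))) , Q≥
              where
              cancel : ∀ i → + (suc j ℕ.* o i) ℤ.+ ℤ.- + (j ℕ.* o i) ≡ + o i
              cancel i = SolverZ.solve 2 (λ o jo → (o :+ jo) :+ :- jo := o) ≡.refl (+ o i) (+ (j ℕ.* o i))
                where open SolverZ

            private
              p′ : Fin (size o)
              p′ = proj₁ (index-lift {M} {o} M≤o p)

              p′≡ : index o p′ ≡ index M p
              p′≡ = proj₂ (index-lift {M} {o} M≤o p)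

              -- `size o` is the degree of O, so d = deg O - 1.
              d : ℕ
              d = proj₁ (Fin⇒suc p′)

              count-o≡ : size o ≡ suc d
              count-o≡ = proj₂ (Fin⇒suc p′)

            p-coefficient-zero : ∀ {a} → φ a K.≈ K.0# → (∀ ρ → ρ ≢ p′ → a (index o ρ) K.≈ K.0#) →
                                 ∀ ρ → a (index o ρ) K.≈ K.0#
            p-coefficient-zero {a} φa≈0 a≈0 ρ with ρ Fin.≟ p′
            ... | no ρ≢p′    = a≈0 ρ ρ≢p′
            ... | yes ≡.refl = ≡.subst (λ x → a x K.≈ K.0#) (≡.sym p′≡) (form-single l (index M) {a} p others≈0 lp≉0 φa≈0 p)
              where
              others≈0 : ∀ ρ → ρ ≢ p → a (index M ρ) K.≈ K.0#
              others≈0 ρ ρ≢p = let ρ′ , ρ′≡ = index-lift {M} {o} M≤o ρ in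
                ≡.subst (λ x → a x K.≈ K.0#) ρ′≡ (a≈0 ρ′ λ ρ′≡p′ → ρ≢p (index-injective M ρ p
                  (≡.trans (≡.sym ρ′≡) (≡.trans (≡.cong (index o) ρ′≡p′) p′≡))))

            -- `f` lies in ℒ(j O) as soon as the product of h^(j+1) and `f` vanishes to the orders
            -- `o i`. These are deg O conditions on its digits, and φ makes one of them redundant,
            -- because the product has poles at `P∞` only.
            bounded-eliminate : ∀ j {n} → HasIndependent (Bounded (suc j)) (d ℕ.+ n) → HasIndependent (Bounded j) n
            bounded-eliminate j independent = independent-⊆
              (λ {f} (a , (bounded , coord) , a≈0) → bounded-pred j bounded
                (Coord-zero⇒order {o} {h ^F suc j * f} {a} coord (p-coefficient-zero {a}
                  (φ-Coord (proj₁ (h^-below (suc j) bounded)) {h ^F suc j * f} {a} (proj₂ (h^-below (suc j) bounded))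
                    (Coord-truncate {o} {h ^F suc j * f} {a} M≤o coord)) a≈0)))
              (eliminate-except {Coord = λ f a → Bounded (suc j) f × Coord o (h ^F suc j * f) a}
                (λ {f} {f′} {a} {a′} (bounded , coord) (bounded′ , coord′) x →
                  bounded-closed (suc j) x bounded bounded′ ,
                  Coord-resp {o} {a = λ p → a p K.- x K.* a′ p}
                    (solve 4 (λ h f x f′ → h :* f :- x :* (h :* f′) := h :* (f :- x :* f′)) F.refl (h ^F suc j) f (ι x) f′)
                    (Coord-linear o {h ^F suc j * f} {h ^F suc j * f′} {a} {a′} coord coord′ x))
                count-o≡ (index o) p′
                (independent-⊆ (λ bounded → let a , coord = Coord-exists o (h^-regular (suc j) bounded) in a , bounded , coord)
                  independent))
              where open SolverF

            -- The induction starts with ℒ(0), which lies in `Below 1` and has dimension at most 1.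
            bounded-bound : ∀ j n → HasIndependent (Bounded j) n → n ≤ suc (j ℕ.* d)
            bounded-bound zero n independent = ℕ.≮⇒≥ λ 1<n → below-bound 1
              (independent-≤ (ℕ.≤-trans (s≤s (nonGaps<-≤ 1)) 1<n) (independent-⊆ constant independent))
              where
              constant : ∀ {f} → Bounded 0 f → Below 1 f
              constant (P≥ , Q≥) = Q≥ P∞ P∞≉P , λ Q _ → decidable-stable (order? Q 0ℤ _) λ ≱ →
                ≱ (Q≥ Q λ i Q≈Pi → ≱ (order-≈ᴾ {P i} {Q} (≈ᴾ-sym {Q} {P i} Q≈Pi) (P≥ i)))
            bounded-bound (suc j) n independent with d ℕ.≤? n
            ... | no d≰n  = ℕ.m≤n⇒m≤1+n (ℕ.≤-trans (ℕ.<⇒≤ (ℕ.≰⇒> d≰n)) (ℕ.m≤m+n d (j ℕ.* d)))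
            ... | yes d≤n with ℕ.m≤n⇒∃[o]m+o≡n d≤n
            ...   | n′ , ≡.refl = ℕ.≤-trans
                    (ℕ.+-monoʳ-≤ d (bounded-bound j n′ (bounded-eliminate j independent)))
                    (ℕ.≤-reflexive (ℕ.+-suc d (j ℕ.* d)))

            -- With deg(j O) = j (d + 1) and ℓ(j O) ≤ 1 + j d, the number deg - ℓ + 1 is at least j.
            -- The choice j = g + 1 is the first that exceeds the genus.
            contradiction-with-genus : ⊥
            contradiction-with-genus = ℕ.<-irrefl ≡.refl (begin-strict
              suc (suc g ℕ.* d) ℕ.+ g              <⟨ ℕ.n<1+n _ ⟩
              suc (suc (suc g ℕ.* d) ℕ.+ g)        ≡⟨ ≡.cong suc (≡.cong suc (ℕ.+-comm (suc g ℕ.* d) g)) ⟩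
              suc (suc g ℕ.+ suc g ℕ.* d)          ≡⟨ ≡.cong suc (ℕ.*-suc (suc g) d) ⟨
              suc (suc g ℕ.* suc d)                ≡⟨ ≡.cong (λ n → suc (suc g ℕ.* n)) count-o≡ ⟨
              suc (suc g ℕ.* size o)              ≡⟨ ≡.cong suc (total-scale (suc g) o e) ⟨
              suc (total (λ i → suc g ℕ.* o i ℕ.* e i)) ≡⟨ ℕ.+-comm 1 _ ⟩
              total (λ i → suc g ℕ.* o i ℕ.* e i) ℕ.+ 1
                ≤⟨ ℤ.drop‿+≤+ (riemann D P∞ genus (totalDegree-tabulate {P = P} (λ i → suc g ℕ.* o i) degree)
                     (λ independent → ℕ.<-irrefl ≡.refl (bounded-bound (suc g) _ (independent-⊆ ℒ⇒Bounded independent)))) ⟩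
              suc (suc g ℕ.* d) ℕ.+ g              ∎)
              where
              open ℕ.≤-Reasoning
              D : Divisor
              D = record
                { terms    = List.tabulate λ i → P i , + (suc g ℕ.* o i)
                ; distinct = AllPairs.tabulate⁺ λ {i} {j} i≢j → P≉P i j i≢j
                }
              ℒ⇒Bounded : ∀ {f} → ℒ D f → Bounded (suc g) f
              ℒ⇒Bounded (P≥ , Q≥) = All.tabulate⁻ P≥ , λ Q Q∉ → Q≥ Q (All.tabulate⁺ Q∉)

        relation-trivial : ∀ {m} → g ℕ.+ size M ≤ m → (∀ r → r < m → φ (column r) K.≈ K.0#) →
                           ∀ p → l p K.≈ K.0#
        relation-trivial m-large columns≈0 p = decidable-stable (l p ≟K K.0#) λ lp≉0 →
          let _ , count≡ = Fin⇒suc p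
              h , Vh , h≉0 = independent-nonzero P∞ (V-independent count≡ m-large columns≈0 p lp≉0)
          in contradiction-with-genus count≡ m-large columns≈0 p lp≉0 Vh h≉0

-- Counting solutions of linear systems

module Σℕ = MonoidSum ℕ.+-0-commutativeMonoid

𝟙 : ∀ {a} {A : Set a} → Dec A → ℕ
𝟙 (yes _) = 1
𝟙 (no _)  = 0

𝟙-cong : ∀ {a b} {A : Set a} {B : Set b} (A? : Dec A) (B? : Dec B) → (A → B) → (B → A) → 𝟙 A? ≡ 𝟙 B?
𝟙-cong (yes _) (yes _) _ _ = ≡.refl
𝟙-cong (no _)  (no _)  _ _ = ≡.refl
𝟙-cong (yes a) (no ¬b) f _ = contradiction (f a) ¬b
𝟙-cong (no ¬a) (yes b) _ g = contradiction (g b) ¬a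

length-filter-tabulate : ∀ {a p n} {A : Set a} {Q : Pred A p} (Q? : Decidable Q) (f : Fin n → A) →
                         length (filter Q? (List.tabulate f)) ≡ Σℕ.sum (𝟙 ∘ Q? ∘ f)
length-filter-tabulate {n = zero} Q? f = ≡.refl
length-filter-tabulate {n = suc n} Q? f with Q? (f zero)
... | yes _ = ≡.cong suc (length-filter-tabulate Q? (f ∘ suc))
... | no _  = length-filter-tabulate Q? (f ∘ suc)

sum-zero : ∀ {n} {f : Vector ℕ n} → (∀ i → f i ≡ 0) → Σℕ.sum f ≡ 0
sum-zero {n} f≡0 = ≡.trans (Σℕ.sum-cong-≗ f≡0) (Σℕ.sum-replicate-zero n)

sum-constant : ∀ n x → Σℕ.sum {n} (λ _ → x) ≡ n ℕ.* x
sum-constant zero    x = ≡.refl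
sum-constant (suc n) x = ≡.cong (x ℕ.+_) (sum-constant n x)

sum-𝟙-unique : ∀ {n p b} {A : Pred (Fin n) p} {B : Set b} (A? : Decidable A) (B? : Dec B) i →
               (∀ {j} → A j → B × j ≡ i) → (B → A i) → Σℕ.sum (𝟙 ∘ A?) ≡ 𝟙 B?
sum-𝟙-unique A? (no ¬b) i A⇒ B⇒ = sum-zero λ j → 𝟙-cong (A? j) (no id) (¬b ∘ proj₁ ∘ A⇒) λ ()
sum-𝟙-unique {suc n} A? (yes b) i A⇒ B⇒ = ≡.trans (Σℕ.sum-remove {i = i} (𝟙 ∘ A?))
  (≡.cong₂ ℕ._+_ (𝟙-cong (A? i) (yes b) (λ _ → b) B⇒)
    (sum-zero λ j → 𝟙-cong (A? (punchIn i j)) (no id) (Fin.punchInᵢ≢i i j ∘ proj₂ ∘ A⇒) λ ()))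

sum-split : ∀ m {n} (f : Vector ℕ (m ℕ.+ n)) → Σℕ.sum f ≡ Σℕ.sum (f ∘ (_↑ˡ n)) ℕ.+ Σℕ.sum (f ∘ (m ↑ʳ_))
sum-split zero    f = ≡.refl
sum-split (suc m) f = ≡.trans (≡.cong (f zero ℕ.+_) (sum-split m (f ∘ suc))) (≡.sym (ℕ.+-assoc (f zero) _ _))

sum-combine : ∀ m n (f : Vector ℕ (m ℕ.* n)) → Σℕ.sum f ≡ Σℕ.sum {m} (λ i → Σℕ.sum {n} (λ j → f (combine i j)))
sum-combine zero    n f = ≡.refl
sum-combine (suc m) n f = ≡.trans (sum-split n f) (≡.cong (Σℕ.sum (f ∘ (_↑ˡ m ℕ.* n)) ℕ.+_) (sum-combine m n (f ∘ (n ↑ʳ_))))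

module Counting {q : ℕ} {c ℓ₁ ℓ₂ : Level} .{{_ : NonTrivial q}} (G : GlobalFunctionField q c ℓ₁ ℓ₂) where

  open LinearAlgebra G
  open DigitalMethod G using (digit)

  private instance
    q≢0 : ℕ.NonZero q
    q≢0 = nonTrivial⇒nonZero q

  -- Unlike `sum`, this splits off the last column, which belongs to the leading digit `z` of
  -- `combine z n`.
  linear : ℕ → (ℕ → K.Carrier) → (ℕ → K.Carrier) → K.Carrier
  linear zero    a x = K.0#
  linear (suc m) a x = linear m a x K.+ a m K.* x m

  linear-cong : ∀ m {a b x y} → (∀ {r} → r < m → a r K.≈ b r) → (∀ {r} → r < m → x r K.≈ y r) →
                linear m a x K.≈ linear m b y
  linear-cong zero    a≈b x≈y = K.refl
  linear-cong (suc m) a≈b x≈y = K.+-cong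
    (linear-cong m (λ r< → a≈b (ℕ.m≤n⇒m≤1+n r<)) (λ r< → x≈y (ℕ.m≤n⇒m≤1+n r<)))
    (K.*-cong (a≈b ℕ.≤-refl) (x≈y ℕ.≤-refl))

  linear-minus : ∀ m a t b x → linear m (λ r → a r K.- t K.* b r) x K.≈ linear m a x K.- t K.* linear m b x
  linear-minus zero a t b x = SolverK.solve 1 (λ t → :0 := :0 :- t :* :0) K.refl t
    where open SolverK
  linear-minus (suc m) a t b x = K.trans (K.+-congʳ (linear-minus m a t b x))
    (SolverK.solve 6 (λ u t v a b x → (u :- t :* v) :+ (a :- t :* b) :* x := (u :+ a :* x) :- t :* (v :+ b :* x))
      K.refl _ t _ (a m) (b m) (x m))
    where open SolverK

  sum≈linear : ∀ m a x → ΣK.sum {m} (λ r → a (toℕ r) K.* x (toℕ r)) K.≈ linear m a x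
  sum≈linear zero    a x = K.refl
  sum≈linear (suc m) a x = K.trans (ΣK.sum-init-last (λ r → a (toℕ r) K.* x (toℕ r))) (K.+-cong
    (K.trans (ΣK.sum-cong-≋ inject₁-term) (sum≈linear m a x))
    (K.reflexive (≡.cong (λ r → a r K.* x r) (Fin.toℕ-fromℕ m))))
    where
    inject₁-term : ∀ (r : Fin m) → a (toℕ (Fin.inject₁ r)) K.* x (toℕ (Fin.inject₁ r)) K.≈ a (toℕ r) K.* x (toℕ r)
    inject₁-term r = K.reflexive (≡.cong (λ r → a r K.* x r) (Fin.toℕ-inject₁ r))

  toℕ-digit : ∀ r n → toℕ (digit r n) ≡ (n ℕ./ q ^ r) {{ℕ.m^n≢0 q r}} ℕ.% q
  toℕ-digit r n = Fin.toℕ-fromℕ< _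

  digit-low : ∀ {r m} k n → r < m → digit r (k ℕ.* q ^ m ℕ.+ n) ≡ digit r n
  digit-low {r} {m} k n r<m with ℕ.m≤n⇒∃[o]m+o≡n r<m
  ... | o , ≡.refl = Fin.toℕ-injective (begin
    toℕ (digit r (k ℕ.* q ^ m′ ℕ.+ n))           ≡⟨ toℕ-digit r _ ⟩
    (k ℕ.* q ^ m′ ℕ.+ n) ℕ./ q ^ r ℕ.% q         ≡⟨ ≡.cong (λ x → (x ℕ.+ n) ℕ./ q ^ r ℕ.% q) factor ⟩
    (w ℕ.* q ℕ.* q ^ r ℕ.+ n) ℕ./ q ^ r ℕ.% q    ≡⟨ ≡.cong (ℕ._% q) (ℕ.+-distrib-/-∣ˡ {w ℕ.* q ℕ.* q ^ r} n (ℕ.n∣m*n (w ℕ.* q))) ⟩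
    (w ℕ.* q ℕ.* q ^ r ℕ./ q ^ r ℕ.+ n ℕ./ q ^ r) ℕ.% q
      ≡⟨ ≡.cong (λ x → (x ℕ.+ n ℕ./ q ^ r) ℕ.% q) (ℕ.m*n/n≡m (w ℕ.* q) (q ^ r)) ⟩
    (w ℕ.* q ℕ.+ n ℕ./ q ^ r) ℕ.% q              ≡⟨ ℕ.%-remove-+ˡ {w ℕ.* q} (n ℕ./ q ^ r) (ℕ.n∣m*n w) ⟩
    n ℕ./ q ^ r ℕ.% q                            ≡⟨ toℕ-digit r n ⟨
    toℕ (digit r n)                              ∎)
    where
    open ≡.≡-Reasoning
    instance
      q^r≢0 : ℕ.NonZero (q ^ r)
      q^r≢0 = ℕ.m^n≢0 q r
    m′ = suc r ℕ.+ o
    w = k ℕ.* q ^ o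
    factor : k ℕ.* q ^ m′ ≡ w ℕ.* q ℕ.* q ^ r
    factor = begin
      k ℕ.* (q ℕ.* q ^ (r ℕ.+ o))        ≡⟨ ≡.cong (λ x → k ℕ.* (q ℕ.* x)) (ℕ.^-distribˡ-+-* q r o) ⟩
      k ℕ.* (q ℕ.* (q ^ r ℕ.* q ^ o))    ≡⟨ ≡.cong (k ℕ.*_) (≡.sym (ℕ.*-assoc q (q ^ r) (q ^ o))) ⟩
      k ℕ.* (q ℕ.* q ^ r ℕ.* q ^ o)      ≡⟨ ≡.cong (k ℕ.*_) (ℕ.*-comm (q ℕ.* q ^ r) (q ^ o)) ⟩
      k ℕ.* (q ^ o ℕ.* (q ℕ.* q ^ r))    ≡⟨ ℕ.*-assoc k (q ^ o) _ ⟨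
      w ℕ.* (q ℕ.* q ^ r)                ≡⟨ ℕ.*-assoc w q (q ^ r) ⟨
      w ℕ.* q ℕ.* q ^ r                  ∎

  digit-high : ∀ m o k {n} → n < q ^ m → digit (m ℕ.+ o) (k ℕ.* q ^ m ℕ.+ n) ≡ digit o k
  digit-high m o k {n} n< = Fin.toℕ-injective (begin
    toℕ (digit (m ℕ.+ o) N)              ≡⟨ toℕ-digit (m ℕ.+ o) N ⟩
    N ℕ./ q ^ (m ℕ.+ o) ℕ.% q            ≡⟨ ≡.cong (ℕ._% q) (ℕ./-congʳ (ℕ.^-distribˡ-+-* q m o)) ⟩
    N ℕ./ (q ^ m ℕ.* q ^ o) ℕ.% q        ≡⟨ ≡.cong (ℕ._% q) (ℕ.m/n/o≡m/[n*o] N (q ^ m) (q ^ o)) ⟨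
    N ℕ./ q ^ m ℕ./ q ^ o ℕ.% q          ≡⟨ ≡.cong (λ x → x ℕ./ q ^ o ℕ.% q) quotient ⟩
    k ℕ./ q ^ o ℕ.% q                    ≡⟨ toℕ-digit o k ⟨
    toℕ (digit o k)                      ∎)
    where
    open ≡.≡-Reasoning
    instance
      q^m≢0 : ℕ.NonZero (q ^ m)
      q^m≢0 = ℕ.m^n≢0 q m
      q^o≢0 : ℕ.NonZero (q ^ o)
      q^o≢0 = ℕ.m^n≢0 q o
      q^m+o≢0 : ℕ.NonZero (q ^ (m ℕ.+ o))
      q^m+o≢0 = ℕ.m^n≢0 q (m ℕ.+ o)
      q^m*q^o≢0 : ℕ.NonZero (q ^ m ℕ.* q ^ o)
      q^m*q^o≢0 = ℕ.m*n≢0 (q ^ m) (q ^ o)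
    N = k ℕ.* q ^ m ℕ.+ n
    quotient : N ℕ./ q ^ m ≡ k
    quotient = begin
      N ℕ./ q ^ m                              ≡⟨ ℕ.+-distrib-/-∣ˡ {k ℕ.* q ^ m} n (ℕ.n∣m*n k) ⟩
      k ℕ.* q ^ m ℕ./ q ^ m ℕ.+ n ℕ./ q ^ m    ≡⟨ ≡.cong₂ ℕ._+_ (ℕ.m*n/n≡m k (q ^ m)) (ℕ.m<n⇒m/n≡0 n<) ⟩
      k ℕ.+ 0                                  ≡⟨ ℕ.+-identityʳ k ⟩
      k                                        ∎

  combine-toℕ : ∀ m (z : Fin q) (n : Fin (q ^ m)) → toℕ (combine z n) ≡ toℕ z ℕ.* q ^ m ℕ.+ toℕ n
  combine-toℕ m z n = ≡.trans (Fin.toℕ-combine z n) (≡.cong (ℕ._+ toℕ n) (ℕ.*-comm (q ^ m) (toℕ z)))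

  digit-combine-low : ∀ {r m} (z : Fin q) (n : Fin (q ^ m)) → r < m → digit r (toℕ (combine z n)) ≡ digit r (toℕ n)
  digit-combine-low {r} {m} z n r<m =
    ≡.trans (≡.cong (digit r) (combine-toℕ m z n)) (digit-low (toℕ z) (toℕ n) r<m)

  digit-combine-high : ∀ m (z : Fin q) (n : Fin (q ^ m)) → digit m (toℕ (combine z n)) ≡ z
  digit-combine-high m z n = begin
    digit m (toℕ (combine z n))                     ≡⟨ ≡.cong₂ digit (≡.sym (ℕ.+-identityʳ m)) (combine-toℕ m z n) ⟩
    digit (m ℕ.+ 0) (toℕ z ℕ.* q ^ m ℕ.+ toℕ n)     ≡⟨ digit-high m 0 (toℕ z) (Fin.toℕ<n n) ⟩
    digit 0 (toℕ z)                                 ≡⟨ Fin.toℕ-injective (≡.trans (toℕ-digit 0 (toℕ z))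
                                                         (≡.trans (≡.cong (ℕ._% q) (ℕ.n/1≡n (toℕ z))) (ℕ.m<n⇒m%n≡m (Fin.toℕ<n z)))) ⟩
    z                                               ∎
    where open ≡.≡-Reasoning

  RowsIndependent : ℕ → ∀ {d} → (Fin d → ℕ → K.Carrier) → Set (c ⊔ ℓ₁)
  RowsIndependent m {d} A = ∀ (l : Vector K.Carrier d) → (∀ r → r < m → ΣK.sum (λ ρ → l ρ K.* A ρ r) K.≈ K.0#) → ∀ ρ → l ρ K.≈ K.0#

  module _ (1≉0 : ¬ (K.1# K.≈ K.0#)) (ψ : ℕ → Bijection (≡.setoid (Fin q)) K.setoid) where

    input : ℕ → ℕ → K.Carrier
    input n r = Bijection.to (ψ r) (digit r n)

    Solves : ∀ m {d} → (Fin d → ℕ → K.Carrier) → Vector K.Carrier d → ℕ → Set ℓ₁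
    Solves m A v n = ∀ ρ → linear m (A ρ) (input n) K.≈ v ρ

    solves? : ∀ m {d} (A : Fin d → ℕ → K.Carrier) v n → Dec (Solves m A v n)
    solves? m A v n = Fin.all? λ ρ → _ ≟K _

    solutions : ∀ m {d} → (Fin d → ℕ → K.Carrier) → Vector K.Carrier d → ℕ
    solutions m A v = Σℕ.sum {q ^ m} (λ n → 𝟙 (solves? m A v (toℕ n)))

    linear-low : ∀ m a (z : Fin q) (n : Fin (q ^ m)) →
                 linear m a (input (toℕ (combine z n))) K.≈ linear m a (input (toℕ n))
    linear-low m a z n = linear-cong m (λ _ → K.refl)
      λ {r} r<m → K.reflexive (≡.cong (Bijection.to (ψ r)) (digit-combine-low z n r<m))

    linear-high : ∀ m a (z : Fin q) (n : Fin (q ^ m)) → linear (suc m) a (input (toℕ (combine z n))) K.≈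
                  linear m a (input (toℕ n)) K.+ a m K.* Bijection.to (ψ m) z
    linear-high m a z n = K.+-cong (linear-low m a z n)
      (K.*-congˡ (K.reflexive (≡.cong (Bijection.to (ψ m)) (digit-combine-high m z n))))

    -- The leading digit does not enter the equations, so each of its `q` values is possible.
    free-column : ∀ m {d} (A : Fin d → ℕ → K.Carrier) v → (∀ ρ → A ρ m K.≈ K.0#) →
                  solutions (suc m) A v ≡ q ℕ.* solutions m A v
    free-column m A v Am≈0 = ≡.trans (sum-combine q (q ^ m) _)
      (≡.trans (Σℕ.sum-cong-≗ (λ z → Σℕ.sum-cong-≗ {q ^ m} (λ n → 𝟙-cong (solves? (suc m) A v _) (solves? m A v _)
        (λ s ρ → K.trans (K.sym (same z n ρ)) (s ρ)) (λ s ρ → K.trans (same z n ρ) (s ρ)))))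
        (sum-constant q (solutions m A v)))
      where
      same : ∀ z n ρ → linear (suc m) (A ρ) (input (toℕ (combine z n))) K.≈ linear m (A ρ) (input (toℕ n))
      same z n ρ = K.trans (linear-high m (A ρ) z n)
        (K.trans (K.+-congˡ (K.trans (K.*-congʳ (Am≈0 ρ)) (K.zeroˡ _))) (K.+-identityʳ _))

    -- A pivot in column m determines the digit m by the other digits.
    module Pivot m {d} (A : Fin (suc d) → ℕ → K.Carrier) (v : Vector K.Carrier (suc d)) p
                 (pivot≉0 : ¬ (A p m K.≈ K.0#)) where
      pivot⁻¹ = proj₁ (K-inverse pivot≉0)

      ratio : Vector K.Carrier d
      ratio ρ = A (punchIn p ρ) m K.* pivot⁻¹

      A′ : Fin d → ℕ → K.Carrier
      A′ ρ r = A (punchIn p ρ) r K.- ratio ρ K.* A p r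

      v′ : Vector K.Carrier d
      v′ ρ = v (punchIn p ρ) K.- ratio ρ K.* v p

      ratio-pivot : ∀ ρ → ratio ρ K.* A p m K.≈ A (punchIn p ρ) m
      ratio-pivot ρ = K.trans (K.*-assoc _ _ _) (K.trans (K.*-congˡ (proj₂ (K-inverse pivot≉0))) (K.*-identityʳ _))

      A′-last : ∀ ρ → A′ ρ m K.≈ K.0#
      A′-last ρ = K.trans (K.+-congˡ (K.-‿cong (ratio-pivot ρ))) (K.-‿inverseʳ _)

      module _ (n : Fin (q ^ m)) where
        x = input (toℕ n)

        last : K.Carrier
        last = pivot⁻¹ K.* (v p K.- linear m (A p) x)

        last-digit : Fin q
        last-digit = proj₁ (Bijection.surjective (ψ m) last)

        ψ-last : Bijection.to (ψ m) last-digit K.≈ last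
        ψ-last = proj₂ (Bijection.surjective (ψ m) last) ≡.refl

        module _ where
          open SetoidReasoning K.setoid
          open SolverK

          pivot-solved : linear m (A p) x K.+ A p m K.* last K.≈ v p
          pivot-solved = begin
            L K.+ A p m K.* (pivot⁻¹ K.* (v p K.- L))
              ≈⟨ solve 4 (λ L a b v → L :+ a :* (b :* (v :- L)) := L :+ (b :* a) :* (v :- L)) K.refl L (A p m) pivot⁻¹ (v p) ⟩
            L K.+ (pivot⁻¹ K.* A p m) K.* (v p K.- L)
              ≈⟨ K.+-congˡ (K.*-congʳ (proj₂ (K-inverse pivot≉0))) ⟩
            L K.+ K.1# K.* (v p K.- L)
              ≈⟨ solve 2 (λ L v → L :+ :1 :* (v :- L) := v) K.refl L (v p) ⟩
            v p ∎
            where L = linear m (A p) x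

          pivot-determined : ∀ {t} → linear m (A p) x K.+ A p m K.* t K.≈ v p → t K.≈ last
          pivot-determined {t} eq = begin
            t                                            ≈⟨ solve 1 (λ t → t := :1 :* t) K.refl t ⟩
            K.1# K.* t                                   ≈⟨ K.*-congʳ (proj₂ (K-inverse pivot≉0)) ⟨
            pivot⁻¹ K.* A p m K.* t                      ≈⟨ solve 4 (λ L a b t → b :* a :* t := b :* ((L :+ a :* t) :- L)) K.refl L (A p m) pivot⁻¹ t ⟩
            pivot⁻¹ K.* ((L K.+ A p m K.* t) K.- L)      ≈⟨ K.*-congˡ (K.+-congʳ eq) ⟩
            last                                         ∎
            where L = linear m (A p) x

          row-combination : ∀ ρ t → linear m (A′ ρ) x K.≈
            (linear m (A (punchIn p ρ)) x K.+ A (punchIn p ρ) m K.* t) K.-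
            ratio ρ K.* (linear m (A p) x K.+ A p m K.* t)
          row-combination ρ t = begin
            linear m (A′ ρ) x
              ≈⟨ linear-minus m (A (punchIn p ρ)) (ratio ρ) (A p) x ⟩
            L′ K.- ratio ρ K.* L
              ≈⟨ solve 5 (λ L′ s L a t → L′ :- s :* L := (L′ :+ (s :* a) :* t) :- s :* (L :+ a :* t)) K.refl L′ (ratio ρ) L (A p m) t ⟩
            (L′ K.+ (ratio ρ K.* A p m) K.* t) K.- ratio ρ K.* (L K.+ A p m K.* t)
              ≈⟨ K.+-congʳ (K.+-congˡ (K.*-congʳ (ratio-pivot ρ))) ⟩
            (L′ K.+ A (punchIn p ρ) m K.* t) K.- ratio ρ K.* (L K.+ A p m K.* t) ∎
            where
            L = linear m (A p) x
            L′ = linear m (A (punchIn p ρ)) x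

        solution⇒ : ∀ {z} → Solves (suc m) A v (toℕ (combine z n)) → Solves m A′ v′ (toℕ n) × z ≡ last-digit
        solution⇒ {z} s =
          (λ ρ → K.trans (row-combination ρ (Bijection.to (ψ m) z))
            (K.+-cong (row (punchIn p ρ)) (K.-‿cong (K.*-congˡ (row p))))) ,
          Bijection.injective (ψ m) (K.trans (pivot-determined (row p)) (K.sym ψ-last))
          where
          row : ∀ ρ → linear m (A ρ) x K.+ A ρ m K.* Bijection.to (ψ m) z K.≈ v ρ
          row ρ = K.trans (K.sym (linear-high m (A ρ) z n)) (s ρ)

        solution⇐ : Solves m A′ v′ (toℕ n) → Solves (suc m) A v (toℕ (combine last-digit n))
        solution⇐ s ρ = K.trans (linear-high m (A ρ) last-digit n) (K.trans (K.+-congˡ (K.*-congˡ ψ-last)) (row ρ))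
          where
          open SetoidReasoning K.setoid
          open SolverK
          other : ∀ ρ → linear m (A (punchIn p ρ)) x K.+ A (punchIn p ρ) m K.* last K.≈ v (punchIn p ρ)
          other ρ = begin
            y                                      ≈⟨ solve 3 (λ y s w → y := (y :- s :* w) :+ s :* w) K.refl y (ratio ρ) w ⟩
            (y K.- ratio ρ K.* w) K.+ ratio ρ K.* w ≈⟨ K.+-cong (K.trans (K.sym (row-combination ρ last)) (s ρ)) (K.*-congˡ pivot-solved) ⟩
            v′ ρ K.+ ratio ρ K.* v p               ≈⟨ solve 3 (λ y s w → (y :- s :* w) :+ s :* w := y) K.refl (v (punchIn p ρ)) (ratio ρ) (v p) ⟩
            v (punchIn p ρ)                        ∎
            where
            y = linear m (A (punchIn p ρ)) x K.+ A (punchIn p ρ) m K.* last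
            w = linear m (A p) x K.+ A p m K.* last
          row : ∀ ρ → linear m (A ρ) x K.+ A ρ m K.* last K.≈ v ρ
          row ρ with p Fin.≟ ρ
          ... | yes ≡.refl = pivot-solved
          ... | no p≢ρ     = ≡.subst (λ ρ → linear m (A ρ) x K.+ A ρ m K.* last K.≈ v ρ)
                  (Fin.punchIn-punchOut p≢ρ) (other (Fin.punchOut p≢ρ))

      -- After exchanging the sums, the inner one runs over the leading digits `z` for fixed `n`,
      -- and only `last-digit n` can contribute.
      pivot-column : solutions (suc m) A v ≡ solutions m A′ v′
      pivot-column = ≡.trans (sum-combine q (q ^ m) _) (≡.trans (Σℕ.∑-comm {q} {q ^ m} _)
        (Σℕ.sum-cong-≗ {q ^ m} λ n → sum-𝟙-unique (λ z → solves? (suc m) A v (toℕ (combine z n)))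
          (solves? m A′ v′ (toℕ n)) (last-digit n) (solution⇒ n) (solution⇐ n)))

      -- A relation between the reduced rows is one between the original rows, with `l₀` at the
      -- pivot row. It extends to column `m`, where the reduced rows are 0.
      A′-independent : RowsIndependent (suc m) A → RowsIndependent m A′
      A′-independent independent l relation ρ = K.trans (K.reflexive (≡.sym (Vector.insertAt-punchIn l p l₀ ρ)))
        (independent L (λ r r≤m → K.trans (L-relation r) (relation′ r (ℕ.m≤n⇒m<n∨m≡n (ℕ.s≤s⁻¹ r≤m)))) (punchIn p ρ))
        where
        open SetoidReasoning K.setoid
        open SolverK
        l₀ = K.- ΣK.sum (λ ρ → l ρ K.* ratio ρ)
        L = insertAt l p l₀
        relation′ : ∀ r → r < m ⊎ r ≡ m → ΣK.sum (λ ρ → l ρ K.* A′ ρ r) K.≈ K.0#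
        relation′ r (inj₁ r<m)    = relation r r<m
        relation′ r (inj₂ ≡.refl) = K.trans
          (ΣK.sum-cong-≋ λ ρ → K.trans (K.*-congˡ (A′-last ρ)) (K.zeroʳ (l ρ))) (ΣK.sum-replicate-zero d)
        distribute : ∀ {d} (l b s : Vector K.Carrier d) t →
          ΣK.sum (λ ρ → l ρ K.* (b ρ K.- s ρ K.* t)) K.≈ K.- ΣK.sum (λ ρ → l ρ K.* s ρ) K.* t K.+ ΣK.sum (λ ρ → l ρ K.* b ρ)
        distribute {zero} l b s t = solve 1 (λ t → :0 := :- :0 :* t :+ :0) K.refl t
        distribute {suc d} l b s t = K.trans (K.+-congˡ (distribute (l ∘ suc) (b ∘ suc) (s ∘ suc) t))
          (solve 6 (λ l b s t u w → l :* (b :- s :* t) :+ (:- u :* t :+ w) := :- (l :* s :+ u) :* t :+ (l :* b :+ w))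
            K.refl (l zero) (b zero) (s zero) t _ _)
        L-relation : ∀ r → ΣK.sum (λ ρ → L ρ K.* A ρ r) K.≈ ΣK.sum (λ ρ → l ρ K.* A′ ρ r)
        L-relation r = begin
          ΣK.sum (λ ρ → L ρ K.* A ρ r)
            ≈⟨ ΣK.sum-remove {i = p} (λ ρ → L ρ K.* A ρ r) ⟩
          L p K.* A p r K.+ ΣK.sum (λ ρ → L (punchIn p ρ) K.* A (punchIn p ρ) r)
            ≈⟨ K.+-cong (K.*-congʳ (K.reflexive (Vector.insertAt-lookup l p l₀)))
                 (ΣK.sum-cong-≋ (λ ρ → K.*-congʳ {A (punchIn p ρ) r} (K.reflexive (Vector.insertAt-punchIn l p l₀ ρ)))) ⟩
          l₀ K.* A p r K.+ ΣK.sum (λ ρ → l ρ K.* A (punchIn p ρ) r)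
            ≈⟨ distribute l (λ ρ → A (punchIn p ρ) r) ratio (A p r) ⟨
          ΣK.sum (λ ρ → l ρ K.* A′ ρ r) ∎

    -- From the last column on, a zero column yields a factor q, and a pivot fixes one digit and
    -- uses up one row. The factor `q ^ d` keeps the subtraction m - d out of the induction.
    -- Bijectivity of each `ψ r` is all that is used of the digit maps.
    solutions-count : ∀ m {d} (A : Fin d → ℕ → K.Carrier) v → RowsIndependent m A →
                      solutions m A v ℕ.* q ^ d ≡ q ^ m
    solutions-count zero {zero} A v independent = ≡.cong (λ n → (n ℕ.+ 0) ℕ.* 1) (𝟙-cong (solves? 0 A v 0) (yes (λ ())) id id)
    -- Without columns every coefficient vector is a relation, also the one consisting of ones.
    solutions-count zero {suc d} A v independent =
      contradiction (independent (λ _ → K.1#) (λ _ ()) zero) 1≉0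
    solutions-count (suc m) {d} A v independent with Fin.any? (λ ρ → ¬? (A ρ m ≟K K.0#))
    ... | no none = begin
      solutions (suc m) A v ℕ.* q ^ d     ≡⟨ ≡.cong (ℕ._* q ^ d) (free-column m A v Am≈0) ⟩
      q ℕ.* solutions m A v ℕ.* q ^ d     ≡⟨ ℕ.*-assoc q (solutions m A v) (q ^ d) ⟩
      q ℕ.* (solutions m A v ℕ.* q ^ d)   ≡⟨ ≡.cong (q ℕ.*_) (solutions-count m A v independent′) ⟩
      q ℕ.* q ^ m                         ∎
      where
      open ≡.≡-Reasoning
      Am≈0 : ∀ ρ → A ρ m K.≈ K.0#
      Am≈0 ρ = decidable-stable (_ ≟K _) λ ≉0 → none (ρ , ≉0)
      independent′ : RowsIndependent m A
      independent′ l relation = independent l λ r r≤m → extended r (ℕ.m≤n⇒m<n∨m≡n (ℕ.s≤s⁻¹ r≤m))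
        where
        extended : ∀ r → r < m ⊎ r ≡ m → ΣK.sum (λ ρ → l ρ K.* A ρ r) K.≈ K.0#
        extended r (inj₁ r<m)    = relation r r<m
        extended r (inj₂ ≡.refl) = K.trans
          (ΣK.sum-cong-≋ λ ρ → K.trans (K.*-congˡ (Am≈0 ρ)) (K.zeroʳ (l ρ))) (ΣK.sum-replicate-zero d)
    solutions-count (suc m) {suc d} A v independent | yes (p , pivot≉0) = begin
      solutions (suc m) A v ℕ.* (q ℕ.* q ^ d)   ≡⟨ ≡.cong (ℕ._* (q ℕ.* q ^ d)) pivot-column ⟩
      n ℕ.* (q ℕ.* q ^ d)                       ≡⟨ ℕ.*-assoc n q (q ^ d) ⟨
      n ℕ.* q ℕ.* q ^ d                         ≡⟨ ≡.cong (ℕ._* q ^ d) (ℕ.*-comm n q) ⟩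
      q ℕ.* n ℕ.* q ^ d                         ≡⟨ ℕ.*-assoc q n (q ^ d) ⟩
      q ℕ.* (n ℕ.* q ^ d)                       ≡⟨ ≡.cong (q ℕ.*_) (solutions-count m A′ v′ (A′-independent independent)) ⟩
      q ℕ.* q ^ m                               ∎
      where
      open ≡.≡-Reasoning
      open Pivot m A v p pivot≉0
      n = solutions m A′ v′

-- Fractions, digit expansions and intervals

module Fractions where

  -- Unnormalised rationals keep numerator and denominator as given, so that comparisons become
  -- cross multiplication.
  toℚᵘ-/ : ∀ n d .{{_ : NonZero d}} → ℚ.toℚᵘ (n ℚ./ d) ℚᵘ.≃ n ℚᵘ./ d
  toℚᵘ-/ n (suc d) = ℚ.toℚᵘ-fromℚᵘ (mkℚᵘ n d)

  module _ {a d h e : ℕ} .{{_ : NonZero d}} .{{_ : NonZero e}} where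

    private
      ≤ᵘ-intro : ∀ {d e} .{{_ : NonZero d}} .{{_ : NonZero e}} → a ℕ.* e ≤ h ℕ.* d → (+ a) ℚᵘ./ d ℚᵘ.≤ (+ h) ℚᵘ./ e
      ≤ᵘ-intro {suc d} {suc e} le = *≤* (≡.subst₂ ℤ._≤_ (ℤ.pos-* a (suc e)) (ℤ.pos-* h (suc d)) (ℤ.+≤+ le))

      ≤ᵘ-elim : ∀ {d e} .{{_ : NonZero d}} .{{_ : NonZero e}} → (+ a) ℚᵘ./ d ℚᵘ.≤ (+ h) ℚᵘ./ e → a ℕ.* e ≤ h ℕ.* d
      ≤ᵘ-elim {suc d} {suc e} (*≤* le) = ℤ.drop‿+≤+ (≡.subst₂ ℤ._≤_ (≡.sym (ℤ.pos-* a (suc e))) (≡.sym (ℤ.pos-* h (suc d))) le)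

      <ᵘ-intro : ∀ {d e} .{{_ : NonZero d}} .{{_ : NonZero e}} → a ℕ.* e < h ℕ.* d → (+ a) ℚᵘ./ d ℚᵘ.< (+ h) ℚᵘ./ e
      <ᵘ-intro {suc d} {suc e} lt = *<* (≡.subst₂ ℤ._<_ (ℤ.pos-* a (suc e)) (ℤ.pos-* h (suc d)) (ℤ.+<+ lt))

      <ᵘ-elim : ∀ {d e} .{{_ : NonZero d}} .{{_ : NonZero e}} → (+ a) ℚᵘ./ d ℚᵘ.< (+ h) ℚᵘ./ e → a ℕ.* e < h ℕ.* d
      <ᵘ-elim {suc d} {suc e} (*<* lt) = ℤ.drop‿+<+ (≡.subst₂ ℤ._<_ (≡.sym (ℤ.pos-* a (suc e))) (≡.sym (ℤ.pos-* h (suc d))) lt)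

    /-≤-intro : a ℕ.* e ≤ h ℕ.* d → (+ a) ℚ./ d ℚ.≤ (+ h) ℚ./ e
    /-≤-intro le = ℚ.toℚᵘ-cancel-≤ (ℚᵘ.≤-respˡ-≃ (ℚᵘ.≃-sym (toℚᵘ-/ (+ a) d))
      (ℚᵘ.≤-respʳ-≃ (ℚᵘ.≃-sym (toℚᵘ-/ (+ h) e)) (≤ᵘ-intro le)))

    /-≤-elim : (+ a) ℚ./ d ℚ.≤ (+ h) ℚ./ e → a ℕ.* e ≤ h ℕ.* d
    /-≤-elim le = ≤ᵘ-elim (ℚᵘ.≤-respˡ-≃ (toℚᵘ-/ (+ a) d) (ℚᵘ.≤-respʳ-≃ (toℚᵘ-/ (+ h) e) (ℚ.toℚᵘ-mono-≤ le)))

    /-<-intro : a ℕ.* e < h ℕ.* d → (+ a) ℚ./ d ℚ.< (+ h) ℚ./ e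
    /-<-intro lt = ℚ.toℚᵘ-cancel-< (ℚᵘ.<-respˡ-≃ (ℚᵘ.≃-sym (toℚᵘ-/ (+ a) d))
      (ℚᵘ.<-respʳ-≃ (ℚᵘ.≃-sym (toℚᵘ-/ (+ h) e)) (<ᵘ-intro lt)))

    /-<-elim : (+ a) ℚ./ d ℚ.< (+ h) ℚ./ e → a ℕ.* e < h ℕ.* d
    /-<-elim lt = <ᵘ-elim (ℚᵘ.<-respˡ-≃ (toℚᵘ-/ (+ a) d) (ℚᵘ.<-respʳ-≃ (toℚᵘ-/ (+ h) e) (ℚ.toℚᵘ-mono-< lt)))

  /-≡-intro : ∀ {a d h e} .{{_ : NonZero d}} .{{_ : NonZero e}} → a ℕ.* e ≡ h ℕ.* d → (+ a) ℚ./ d ≡ (+ h) ℚ./ e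
  /-≡-intro {a} {d} {h} {e} eq = ℚ.≤-antisym (/-≤-intro {a} {d} {h} {e} (ℕ.≤-reflexive eq)) (/-≤-intro {h} {e} {a} {d} (ℕ.≤-reflexive (≡.sym eq)))

  /-+ : ∀ a d h e .{{_ : NonZero d}} .{{_ : NonZero e}} .{{_ : NonZero (d ℕ.* e)}} →
        (+ a) ℚ./ d ℚ.+ (+ h) ℚ./ e ≡ (+ (a ℕ.* e ℕ.+ h ℕ.* d)) ℚ./ (d ℕ.* e)
  /-+ a d h e = ℚ.toℚᵘ-injective (ℚᵘ.≃-trans (ℚ.toℚᵘ-homo-+ ((+ a) ℚ./ d) ((+ h) ℚ./ e)) (ℚᵘ.≃-trans
    (ℚᵘ.+-cong (toℚᵘ-/ (+ a) d) (toℚᵘ-/ (+ h) e)) (ℚᵘ.≃-trans (ℚᵘ.≃-reflexive (compute d e)) (ℚᵘ.≃-sym (toℚᵘ-/ _ (d ℕ.* e))))))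
    where
    compute : ∀ d e .{{_ : NonZero d}} .{{_ : NonZero e}} .{{_ : NonZero (d ℕ.* e)}} →
              (+ a) ℚᵘ./ d ℚᵘ.+ (+ h) ℚᵘ./ e ≡ (+ (a ℕ.* e ℕ.+ h ℕ.* d)) ℚᵘ./ (d ℕ.* e)
    compute (suc d) (suc e) = ≡.cong (λ n → mkℚᵘ n _)
      (≡.cong₂ ℤ._+_ (≡.sym (ℤ.pos-* a (suc e))) (≡.sym (ℤ.pos-* h (suc d))))

  /-* : ∀ a d h e .{{_ : NonZero d}} .{{_ : NonZero e}} .{{_ : NonZero (d ℕ.* e)}} →
        ((+ a) ℚ./ d) ℚ.* ((+ h) ℚ./ e) ≡ (+ (a ℕ.* h)) ℚ./ (d ℕ.* e)
  /-* a d h e = ℚ.toℚᵘ-injective (ℚᵘ.≃-trans (ℚ.toℚᵘ-homo-* ((+ a) ℚ./ d) ((+ h) ℚ./ e)) (ℚᵘ.≃-trans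
    (ℚᵘ.*-cong (toℚᵘ-/ (+ a) d) (toℚᵘ-/ (+ h) e)) (ℚᵘ.≃-trans (ℚᵘ.≃-reflexive (compute d e)) (ℚᵘ.≃-sym (toℚᵘ-/ _ (d ℕ.* e))))))
    where
    compute : ∀ d e .{{_ : NonZero d}} .{{_ : NonZero e}} .{{_ : NonZero (d ℕ.* e)}} →
              ((+ a) ℚᵘ./ d) ℚᵘ.* ((+ h) ℚᵘ./ e) ≡ (+ (a ℕ.* h)) ℚᵘ./ (d ℕ.* e)
    compute (suc d) (suc e) = ≡.cong (λ n → mkℚᵘ n _) (≡.sym (ℤ.pos-* a h))

module Digits (b : ℕ) .{{b-nonTrivial : NonTrivial b}} where

  open NetsAndSequences b
  open Fractions
  module Σℚ = MonoidSum ℚ.+-0-commutativeMonoid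

  private instance
    b≢0 : NonZero b
    b≢0 = nonTrivial⇒nonZero b

  b^≢0 : ∀ m → NonZero (b ^ m)
  b^≢0 m = ℕ.m^n≢0 b m

  -- The first digit is the most significant one.
  horner : ℕ → (ℕ → Fin b) → ℕ
  horner zero    x = 0
  horner (suc m) x = horner m x ℕ.* b ℕ.+ toℕ (x m)

  horner-bound : ∀ m x → horner m x < b ^ m
  horner-bound zero x = s≤s z≤n
  horner-bound (suc m) x = begin-strict
    horner m x ℕ.* b ℕ.+ toℕ (x m)   <⟨ ℕ.+-monoʳ-< (horner m x ℕ.* b) (Fin.toℕ<n (x m)) ⟩
    horner m x ℕ.* b ℕ.+ b           ≡⟨ ℕ.+-comm _ b ⟩
    suc (horner m x) ℕ.* b           ≤⟨ ℕ.*-monoˡ-≤ b (horner-bound m x) ⟩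
    b ^ m ℕ.* b                      ≡⟨ ℕ.*-comm (b ^ m) b ⟩
    b ℕ.* b ^ m                      ∎
    where open ℕ.≤-Reasoning

  horner-cong : ∀ m {x y} → (∀ j → j < m → x j ≡ y j) → horner m x ≡ horner m y
  horner-cong zero    eq = ≡.refl
  horner-cong (suc m) eq = ≡.cong₂ (λ u v → u ℕ.* b ℕ.+ toℕ v)
    (horner-cong m (λ j j< → eq j (ℕ.m≤n⇒m≤1+n j<))) (eq m ℕ.≤-refl)

  quotient-unique : ∀ {u u′ : ℕ} (v v′ : Fin b) → u ℕ.* b ℕ.+ toℕ v ≡ u′ ℕ.* b ℕ.+ toℕ v′ → u ≡ u′ × v ≡ v′
  quotient-unique {u} {u′} v v′ eq = u≡u′ , Fin.toℕ-injective
    (ℕ.+-cancelˡ-≡ (u ℕ.* b) _ _ (≡.trans eq (≡.cong (λ u → u ℕ.* b ℕ.+ toℕ v′) (≡.sym u≡u′))))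
    where
    quotient : ∀ u (v : Fin b) → (u ℕ.* b ℕ.+ toℕ v) ℕ./ b ≡ u
    quotient u v = ≡.trans (ℕ.+-distrib-/-∣ˡ {u ℕ.* b} (toℕ v) (ℕ.n∣m*n u))
      (≡.trans (≡.cong₂ ℕ._+_ (ℕ.m*n/n≡m u b) (ℕ.m<n⇒m/n≡0 (Fin.toℕ<n v))) (ℕ.+-identityʳ u))
    u≡u′ : u ≡ u′
    u≡u′ = ≡.trans (≡.sym (quotient u v)) (≡.trans (≡.cong (ℕ._/ b) eq) (quotient u′ v′))

  horner-injective : ∀ m {x y} → horner m x ≡ horner m y → ∀ j → j < m → x j ≡ y j
  horner-injective (suc m) {x} {y} eq j j≤m with quotient-unique (x m) (y m) eq | ℕ.m≤n⇒m<n∨m≡n (ℕ.s≤s⁻¹ j≤m)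
  ... | heads , _ | inj₁ j<m    = horner-injective m heads j j<m
  ... | _ , last  | inj₂ ≡.refl = last

  digits : ℕ → ℕ → ℕ → Fin b
  -- A default value, reached only at positions beyond the requested digits.
  digits zero    a j = a ℕ.mod b
  digits (suc m) a j with j ℕ.≟ m
  ... | yes _ = a ℕ.mod b
  ... | no _  = digits m (a ℕ./ b) j

  horner-digits : ∀ m a → a < b ^ m → horner m (digits m a) ≡ a
  horner-digits zero    a a< = ≡.sym (ℕ.n<1⇒n≡0 a<)
  horner-digits (suc m) a a< = begin
    horner m (digits (suc m) a) ℕ.* b ℕ.+ toℕ (digits (suc m) a m)
      ≡⟨ ≡.cong₂ (λ u v → u ℕ.* b ℕ.+ v)
           (≡.trans (horner-cong m (λ j j<m → lower j (ℕ.<⇒≢ j<m))) (horner-digits m (a ℕ./ b) (ℕ.m<n*o⇒m/o<n (≡.subst (a <_) (ℕ.*-comm b (b ^ m)) a<))))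
           last ⟩
    a ℕ./ b ℕ.* b ℕ.+ a ℕ.% b  ≡⟨ ℕ.+-comm _ (a ℕ.% b) ⟩
    a ℕ.% b ℕ.+ a ℕ./ b ℕ.* b  ≡⟨ ℕ.m≡m%n+[m/n]*n a b ⟨
    a                          ∎
    where
    open ≡.≡-Reasoning
    lower : ∀ j → j ≢ m → digits (suc m) a j ≡ digits m (a ℕ./ b) j
    lower j j≢m with j ℕ.≟ m
    ... | yes j≡m = contradiction j≡m j≢m
    ... | no _    = ≡.refl
    last : toℕ (digits (suc m) a m) ≡ a ℕ.% b
    last with m ℕ.≟ m
    ... | yes _  = Fin.toℕ-fromℕ< _
    ... | no m≢m = contradiction ≡.refl m≢m

  horner-prefix : ∀ d o x → ∃ λ t → t < b ^ o × horner (d ℕ.+ o) x ≡ horner d x ℕ.* b ^ o ℕ.+ t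
  horner-prefix d zero x = 0 , s≤s z≤n , ≡.trans (≡.cong (λ m → horner m x) (ℕ.+-identityʳ d))
    (≡.sym (≡.trans (ℕ.+-identityʳ _) (ℕ.*-identityʳ _)))
  horner-prefix d (suc o) x with horner-prefix d o x
  ... | t , t< , eq = t ℕ.* b ℕ.+ toℕ v , bound , ≡.trans (≡.cong (λ m → horner m x) (ℕ.+-suc d o)) (begin
    horner (d ℕ.+ o) x ℕ.* b ℕ.+ toℕ v                 ≡⟨ ≡.cong (λ u → u ℕ.* b ℕ.+ toℕ v) eq ⟩
    (horner d x ℕ.* b ^ o ℕ.+ t) ℕ.* b ℕ.+ toℕ v       ≡⟨ solve 5 (λ h p t b v → (h :* p :+ t) :* b :+ v := h :* (b :* p) :+ (t :* b :+ v)) ≡.refl (horner d x) (b ^ o) t b (toℕ v) ⟩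
    horner d x ℕ.* (b ℕ.* b ^ o) ℕ.+ (t ℕ.* b ℕ.+ toℕ v) ∎)
    where
    open ≡.≡-Reasoning
    open +-*-Solver
    v = x (d ℕ.+ o)
    bound : t ℕ.* b ℕ.+ toℕ v < b ℕ.* b ^ o
    bound = ℕ.<-≤-trans (ℕ.+-monoʳ-< (t ℕ.* b) (Fin.toℕ<n v))
      (ℕ.≤-trans (ℕ.≤-reflexive (ℕ.+-comm (t ℕ.* b) b)) (ℕ.≤-trans (ℕ.*-monoˡ-≤ b t<) (ℕ.≤-reflexive (ℕ.*-comm (b ^ o) b))))

  truncate≡horner : ∀ m x → truncate m x ≡ horner m x /b^ m
  truncate≡horner zero x = ≡.refl
  truncate≡horner (suc m) x = begin
    truncate (suc m) x
      ≡⟨ Σℚ.sum-init-last {m} (λ j → toℕ (x (toℕ j)) /b^ suc (toℕ j)) ⟩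
    Σℚ.sum {m} (λ j → toℕ (x (toℕ (Fin.inject₁ j))) /b^ suc (toℕ (Fin.inject₁ j))) ℚ.+ toℕ (x (toℕ (Fin.fromℕ m))) /b^ suc (toℕ (Fin.fromℕ m))
      ≡⟨ ≡.cong₂ ℚ._+_ (Σℚ.sum-cong-≗ {m} (λ j → ≡.cong (λ j → toℕ (x j) /b^ suc j) (Fin.toℕ-inject₁ j)))
           (≡.cong (λ j → toℕ (x j) /b^ suc j) (Fin.toℕ-fromℕ m)) ⟩
    truncate m x ℚ.+ toℕ (x m) /b^ suc m
      ≡⟨ ≡.cong (ℚ._+ toℕ (x m) /b^ suc m) (truncate≡horner m x) ⟩
    horner m x /b^ m ℚ.+ toℕ (x m) /b^ suc m
      ≡⟨ /-+ (horner m x) (b ^ m) (toℕ (x m)) (b ^ suc m) ⟩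
    _
      ≡⟨ /-≡-intro {horner m x ℕ.* b ^ suc m ℕ.+ toℕ (x m) ℕ.* b ^ m} {b ^ m ℕ.* b ^ suc m} {horner (suc m) x} {b ^ suc m}
           (solve 4 (λ h b p v → (h :* (b :* p) :+ v :* p) :* (b :* p) := (h :* b :+ v) :* (p :* (b :* p))) ≡.refl (horner m x) b (b ^ m) (toℕ (x m))) ⟩
    horner (suc m) x /b^ suc m ∎
    where
    open ≡.≡-Reasoning
    open +-*-Solver
    instance
      b^m≢0 : NonZero (b ^ m)
      b^m≢0 = b^≢0 m
      b^sm≢0 : NonZero (b ^ suc m)
      b^sm≢0 = b^≢0 (suc m)
      product≢0 : NonZero (b ^ m ℕ.* b ^ suc m)
      product≢0 = ℕ.m*n≢0 (b ^ m) (b ^ suc m)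

  truncate-bounds : ∀ m x → 0ℚ ℚ.≤ truncate m x × truncate m x ℚ.< 1ℚ
  truncate-bounds m x rewrite truncate≡horner m x =
    /-≤-intro {0} {1} {horner m x} {b ^ m} z≤n ,
    /-<-intro {horner m x} {b ^ m} {1} {1} (≡.subst₂ _<_ (≡.sym (ℕ.*-identityʳ _)) (≡.sym (ℕ.*-identityˡ _)) (horner-bound m x))
    where
    instance
      b^m≢0 : NonZero (b ^ m)
      b^m≢0 = b^≢0 m

  module _ {a d m : ℕ} (d≤m : d ≤ m) (x : ℕ → Fin b) where
    private
      instance
        b^m≢0 : NonZero (b ^ m)
        b^m≢0 = b^≢0 m
        b^d≢0 : NonZero (b ^ d)
        b^d≢0 = b^≢0 d
      o = proj₁ (ℕ.m≤n⇒∃[o]m+o≡n d≤m)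
      d+o≡m = proj₂ (ℕ.m≤n⇒∃[o]m+o≡n d≤m)
      t = proj₁ (horner-prefix d o x)
      t< = proj₁ (proj₂ (horner-prefix d o x))
      instance
        b^o≢0 : NonZero (b ^ o)
        b^o≢0 = b^≢0 o
      horner≡ : horner m x ≡ horner d x ℕ.* b ^ o ℕ.+ t
      horner≡ = ≡.trans (≡.cong (λ m → horner m x) (≡.sym d+o≡m)) (proj₂ (proj₂ (horner-prefix d o x)))
      scale : ∀ u → u ℕ.* b ^ m ≡ u ℕ.* b ^ o ℕ.* b ^ d
      scale u = ≡.trans (≡.cong (λ m → u ℕ.* b ^ m) (≡.sym d+o≡m)) (≡.trans (≡.cong (u ℕ.*_)
        (≡.trans (ℕ.^-distribˡ-+-* b d o) (ℕ.*-comm (b ^ d) (b ^ o)))) (≡.sym (ℕ.*-assoc u (b ^ o) (b ^ d))))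

    -- The truncation is (H b^o + t) / b^m with H = `horner d x`, t < b^o and d + o = m. Clearing
    -- denominators, the two bounds leave a < H + 1 and H < a + 1.
    interval⇒horner : a /b^ d ℚ.≤ truncate m x → truncate m x ℚ.< suc a /b^ d → horner d x ≡ a
    interval⇒horner lower upper rewrite truncate≡horner m x = ℕ.≤-antisym
      (ℕ.s≤s⁻¹ (ℕ.*-cancelʳ-< (b ^ o) (horner d x) (suc a) (ℕ.≤-<-trans (ℕ.≤-trans (ℕ.m≤m+n _ t) (ℕ.≤-reflexive (≡.sym horner≡)))
        (ℕ.*-cancelʳ-< (b ^ d) _ _ (≡.subst (horner m x ℕ.* b ^ d <_) (scale (suc a)) (/-<-elim {horner m x} {b ^ m} {suc a} {b ^ d} upper))))))
      (ℕ.s≤s⁻¹ (ℕ.*-cancelʳ-< (b ^ o) a (suc (horner d x)) (ℕ.≤-<-trans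
        (ℕ.*-cancelʳ-≤ _ _ (b ^ d) (≡.subst (_≤ horner m x ℕ.* b ^ d) (scale a) (/-≤-elim {a} {b ^ d} {horner m x} {b ^ m} lower)))
        (≡.subst₂ _<_ (≡.sym horner≡) (ℕ.+-comm (horner d x ℕ.* b ^ o) (b ^ o)) (ℕ.+-monoʳ-< (horner d x ℕ.* b ^ o) t<)))))

    horner⇒interval : horner d x ≡ a → a /b^ d ℚ.≤ truncate m x × truncate m x ℚ.< suc a /b^ d
    horner⇒interval ≡.refl rewrite truncate≡horner m x =
      /-≤-intro {a} {b ^ d} {horner m x} {b ^ m} (≡.subst (_≤ horner m x ℕ.* b ^ d) (≡.sym (scale a))
        (ℕ.*-monoˡ-≤ (b ^ d) (≡.subst (a ℕ.* b ^ o ≤_) (≡.sym horner≡) (ℕ.m≤m+n _ t)))) ,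
      /-<-intro {horner m x} {b ^ m} {suc a} {b ^ d} (≡.subst (horner m x ℕ.* b ^ d <_) (≡.sym (scale (suc a)))
        (ℕ.*-monoˡ-< (b ^ d) (≡.subst₂ _<_ (≡.sym horner≡) (ℕ.+-comm (a ℕ.* b ^ o) (b ^ o)) (ℕ.+-monoʳ-< (a ℕ.* b ^ o) t<))))

-- Finitely many double negations can be removed at once, which provides inverses of all local
-- parameters simultaneously.
¬¬-Fin : ∀ {a n} {A : Fin n → Set a} → (∀ i → (A i → ⊥) → ⊥) → ((∀ i → A i) → ⊥) → ⊥
¬¬-Fin {n = zero}  f k = k λ ()
¬¬-Fin {n = suc n} f k = f zero λ x → ¬¬-Fin (f ∘ suc) λ xs → k λ { zero → x ; (suc i) → xs i }

≤-total-sum : ∀ {s} (d : Vector ℕ s) i → d i ≤ total d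
≤-total-sum d zero    = ℕ.m≤m+n (d zero) _
≤-total-sum d (suc i) = ℕ.≤-trans (≤-total-sum (d ∘ suc) i) (ℕ.m≤n+m _ (d zero))

total-cong : ∀ {s} {D E : Vector ℕ s} → (∀ i → D i ≡ E i) → total D ≡ total E
total-cong {zero}  eq = ≡.refl
total-cong {suc s} eq = ≡.cong₂ ℕ._+_ (eq zero) (total-cong (eq ∘ suc))

module Volumes (b : ℕ) .{{_ : NonTrivial b}} where

  open NetsAndSequences b
  open Digits b using (b^≢0)
  open Fractions
  open RawSemiringDefs ℚ.+-*-rawSemiring using (product)

  product≡ : ∀ {s} (d : Vector ℕ s) → product (λ i → 1 /b^ d i) ≡ 1 /b^ total d
  product≡ {zero}  d = ≡.refl
  product≡ {suc s} d = begin
    (1 /b^ d zero) ℚ.* product (λ i → 1 /b^ d (suc i))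
      ≡⟨ ≡.cong ((1 /b^ d zero) ℚ.*_) (product≡ (d ∘ suc)) ⟩
    (1 /b^ d zero) ℚ.* (1 /b^ T)
      ≡⟨ /-* 1 (b ^ d zero) 1 (b ^ T) ⟩
    (+ 1) ℚ./ (b ^ d zero ℕ.* b ^ T)
      ≡⟨ /-≡-intro {1} {b ^ d zero ℕ.* b ^ T} {1} {b ^ (d zero ℕ.+ T)} (≡.cong (1 ℕ.*_) (ℕ.^-distribˡ-+-* b (d zero) T)) ⟩
    1 /b^ (d zero ℕ.+ T) ∎
    where
    open ≡.≡-Reasoning
    T = total (d ∘ suc)
    instance
      d₀≢0 : NonZero (b ^ d zero)
      d₀≢0 = b^≢0 (d zero)
      T≢0 : NonZero (b ^ T)
      T≢0 = b^≢0 T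
      sum≢0 : NonZero (b ^ (d zero ℕ.+ T))
      sum≢0 = b^≢0 (d zero ℕ.+ T)
      product≢0 : NonZero (b ^ d zero ℕ.* b ^ T)
      product≢0 = ℕ.m*n≢0 (b ^ d zero) (b ^ T)

  unit-fraction-≤ : ∀ {m n} → 1 /b^ m ℚ.≤ 1 /b^ n → n ≤ m
  unit-fraction-≤ {m} {n} le = ℕ.≮⇒≥ λ m<n → ℕ.<⇒≱ (ℕ.^-monoʳ-< b (ℕ.nonTrivial⇒n>1 b) m<n)
    (≡.subst₂ _≤_ (ℕ.*-identityˡ _) (ℕ.*-identityˡ _) (/-≤-elim {1} {b ^ m} {1} {b ^ n} le))
    where
    instance
      m≢0 : NonZero (b ^ m)
      m≢0 = b^≢0 m
      n≢0 : NonZero (b ^ n)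
      n≢0 = b^≢0 n

  count-volume : ∀ n m T → n ℕ.* b ^ T ≡ b ^ m → fromℕ n ≡ fromℕ (b ^ m) ℚ.* (1 /b^ T)
  count-volume n m T eq = ≡.trans
    (/-≡-intro {n} {1} {b ^ m ℕ.* 1} {1 ℕ.* b ^ T} (≡.trans (≡.cong (n ℕ.*_) (ℕ.*-identityˡ (b ^ T)))
      (≡.trans eq (≡.sym (≡.trans (ℕ.*-identityʳ _) (ℕ.*-identityʳ _))))))
    (≡.sym (/-* (b ^ m) 1 1 (b ^ T)))
    where
    instance
      T≢0 : NonZero (b ^ T)
      T≢0 = b^≢0 T
      1*T≢0 : NonZero (1 ℕ.* b ^ T)
      1*T≢0 = ℕ.m*n≢0 1 (b ^ T)

-- Inverses up to double negation

module Invertibility {q : ℕ} {c ℓ₁ ℓ₂ : Level} (G : GlobalFunctionField q c ℓ₁ ℓ₂) where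

  open RowIndependence G
  open F using (_≈_; _*_; 0#; 1#)
  private module HF = HeytingField functionField

  -- From tightness as in `K-inverse`; but F is infinite, so no search can remove the double
  -- negation.
  nonzero⇒¬¬invertible : ∀ {f} → ¬ (f ≈ 0#) → ((∃ λ f⁻¹ → f * f⁻¹ ≈ 1#) → ⊥) → ⊥
  nonzero⇒¬¬invertible {f} f≉0 k = f≉0 (proj₁ (HF.tight f 0#) λ f#0 →
    let f⁻¹ , _ , right = HF.#⇒invertible f#0
    in k (f⁻¹ , F.trans (F.*-congʳ (F.sym (x-0≈x f))) right))

  module _ {s} {P∞ : Place} {P : Fin s → Place} {e : Fin s → ℕ} (C : ColumnwiseConstruction P∞ P e)
           (degree∞ : HasDegree P∞ 1) (degree : ∀ i → HasDegree (P i) (e i))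
           {g : ℕ} (genus : IsGenus g)
           (P∞≉P : ∀ i → ¬ (P∞ ≈ᴾ P i)) (P≉P : ∀ i j → i ≢ j → ¬ (P i ≈ᴾ P j)) where

    open ColumnwiseConstruction C
    open Coefficients e

    -- The same as `column`, but outside the scope of the assumed inverses.
    entry : ℕ → Index → K.Carrier
    entry r (i , k , h) = matrix i (k ℕ.* e i ℕ.+ toℕ h) r

    -- Equality in K is decidable, so inverses of the local parameters may be assumed while refuting
    -- `lρ≉0`.
    relation-zero : ∀ M {m} → g ℕ.+ size M ≤ m → (l : Vector K.Carrier (size M)) →
                    (∀ r → r < m → ΣK.sum (λ ρ → l ρ K.* entry r (index M ρ)) K.≈ K.0#) → ∀ ρ → l ρ K.≈ K.0#
    relation-zero M m-large l relation ρ = decidable-stable (l ρ ≟K K.0#) λ lρ≉0 →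
      let t , νt = Place.ν-normal P∞ in
      nonzero⇒¬¬invertible (exact⇒≉0 P∞ νt) λ (t⁻¹ , tt⁻¹≈1) →
      ¬¬-Fin (λ i → nonzero⇒¬¬invertible (exact⇒≉0 (P i) (z-local i))) λ z-inverse →
      lρ≉0 (Rows.relation-trivial C degree∞ degree genus P∞≉P P≉P (hasOrders P∞ νt tt⁻¹≈1) z-inverse
        M l m-large relation ρ)

-- From independent rows to the sequence

module Sequence {q : ℕ} {c ℓ₁ ℓ₂ : Level} .{{_ : NonTrivial q}} (G : GlobalFunctionField q c ℓ₁ ℓ₂) where

  open RowIndependence G
  open Invertibility G
  open DigitalMethod G
  open NetsAndSequences q
  open Digits q
  open Counting G
  open Volumes q

  private instance
    q≢0 : NonZero q
    q≢0 = nonTrivial⇒nonZero q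

  n<q^n : ∀ n → n < q ^ n
  n<q^n zero    = s≤s z≤n
  n<q^n (suc n) = begin-strict
    suc n          ≤⟨ n<q^n n ⟩
    q ^ n          <⟨ ℕ.^-monoʳ-< q (ℕ.nonTrivial⇒n>1 q) (ℕ.n<1+n n) ⟩
    q ^ suc n      ∎
    where open ℕ.≤-Reasoning

  digit-zero : ∀ {r n} → n ≤ r → digit r n ≡ 0 ℕ.mod q
  digit-zero {r} {n} n≤r = ≡.cong (ℕ._mod q) (ℕ.m<n⇒m/n≡0 {{ℕ.m^n≢0 q r}} (ℕ.≤-<-trans n≤r (n<q^n r)))

  linear-split : ∀ m o a x → linear (m ℕ.+ o) a x K.≈ linear m a x K.+ linear o (a ∘ (m ℕ.+_)) (x ∘ (m ℕ.+_))
  linear-split m zero a x = K.trans (K.reflexive (≡.cong (λ m → linear m a x) (ℕ.+-identityʳ m))) (K.sym (K.+-identityʳ _))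
  linear-split m (suc o) a x = K.trans (K.reflexive (≡.cong (λ m → linear m a x) (ℕ.+-suc m o)))
    (K.trans (K.+-congʳ (linear-split m o a x)) (K.+-assoc _ _ _))

  linear-zero : ∀ m {a x} → (∀ r → x r K.≈ K.0#) → linear m a x K.≈ K.0#
  linear-zero zero    x≈0 = K.refl
  linear-zero (suc m) x≈0 = K.trans
    (K.+-cong (linear-zero m x≈0) (K.trans (K.*-congˡ (x≈0 m)) (K.zeroʳ _))) (K.+-identityˡ _)

  module _ {s} (maps : DigitMaps s) (A : Fin s → ℕ → ℕ → K.Carrier) where
    open DigitMaps maps

    private
      ψ-to : ∀ r → Fin q → K.Carrier
      ψ-to r = Bijection.to (ψ r)

    -- The length of the sum in `output` depends on `n`. Padding with zero terms permits a common
    -- length for a whole block.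
    output-extend : ∀ n o i j → output maps A n i j K.≈
                    linear (bound ℕ.+ n ℕ.+ o) (A i j) (λ r → ψ-to r (digit r n))
    output-extend n o i j = K.trans (sum≈linear (bound ℕ.+ n) (A i j) (λ r → ψ-to r (digit r n)))
      (K.sym (K.trans (linear-split (bound ℕ.+ n) o (A i j) _) (K.trans (K.+-congˡ (linear-zero o vanish)) (K.+-identityʳ _))))
      where
      vanish : ∀ r → ψ-to (bound ℕ.+ n ℕ.+ r) (digit (bound ℕ.+ n ℕ.+ r) n) K.≈ K.0#
      vanish r = K.trans
        (K.reflexive (≡.cong (ψ-to (bound ℕ.+ n ℕ.+ r)) (digit-zero (ℕ.≤-trans (ℕ.m≤n+m n bound) (ℕ.m≤m+n (bound ℕ.+ n) r)))))
        (ψ-zero _ (ℕ.≤-trans (ℕ.m≤m+n bound n) (ℕ.m≤m+n (bound ℕ.+ n) r)))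

    -- The part of an output contributed by the digits of k in k q^m + n.
    offset : ℕ → ℕ → Fin s → ℕ → K.Carrier
    offset k m i j = linear (bound ℕ.+ suc k ℕ.* q ^ m) (A i j ∘ (m ℕ.+_)) (λ r → ψ-to (m ℕ.+ r) (digit r k))

    output-block : ∀ k m (n : Fin (q ^ m)) i j → output maps A (k ℕ.* q ^ m ℕ.+ toℕ n) i j K.≈
                   linear m (A i j) (λ r → ψ-to r (digit r (toℕ n))) K.+ offset k m i j
    output-block k m n i j = begin
      output maps A N i j
        ≈⟨ output-extend N o i j ⟩
      linear (bound ℕ.+ N ℕ.+ o) (A i j) x
        ≈⟨ K.reflexive (≡.cong (λ L → linear L (A i j) x) length≡) ⟩
      linear (m ℕ.+ L) (A i j) x
        ≈⟨ linear-split m L (A i j) x ⟩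
      linear m (A i j) x K.+ linear L (A i j ∘ (m ℕ.+_)) (x ∘ (m ℕ.+_))
        ≈⟨ K.+-cong
             (linear-cong m (λ _ → K.refl) (λ {r} r<m → K.reflexive (≡.cong (ψ-to r) (digit-low k (toℕ n) r<m))))
             (linear-cong L (λ _ → K.refl) (λ {r} _ → K.reflexive (≡.cong (ψ-to (m ℕ.+ r)) (digit-high m r k (Fin.toℕ<n n))))) ⟩
      linear m (A i j) (λ r → ψ-to r (digit r (toℕ n))) K.+ offset k m i j ∎
      where
      open SetoidReasoning K.setoid
      N = k ℕ.* q ^ m ℕ.+ toℕ n
      -- At least bound + N for every `N` in the block, so that the offset is the same for all `n`.
      L = bound ℕ.+ suc k ℕ.* q ^ m
      x : ℕ → K.Carrier
      x r = ψ-to r (digit r N)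
      N≤ : N ≤ suc k ℕ.* q ^ m
      N≤ = ℕ.≤-trans (ℕ.+-monoʳ-≤ (k ℕ.* q ^ m) (ℕ.<⇒≤ (Fin.toℕ<n n))) (ℕ.≤-reflexive (ℕ.+-comm (k ℕ.* q ^ m) (q ^ m)))
      rest = ℕ.m≤n⇒∃[o]m+o≡n (ℕ.≤-trans (ℕ.+-monoʳ-≤ bound N≤) (ℕ.m≤n+m L m))
      o = proj₁ rest
      length≡ : bound ℕ.+ N ℕ.+ o ≡ m ℕ.+ L
      length≡ = proj₂ rest

  module _ {s} {P∞ : Place} {P : Fin s → Place} {e : Fin s → ℕ} (C : ColumnwiseConstruction P∞ P e)
           (degree∞ : HasDegree P∞ 1) (degree : ∀ i → HasDegree (P i) (e i))
           {g : ℕ} (genus : IsGenus g)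
           (P∞≉P : ∀ i → ¬ (P∞ ≈ᴾ P i)) (P≉P : ∀ i j → i ≢ j → ¬ (P i ≈ᴾ P j))
           (maps : DigitMaps s) (k m : ℕ) (g<m : g < m) where

    open ColumnwiseConstruction C
    open Coefficients e
    open DigitMaps maps

    private
      X : ℕ → Fin s → ℕ → Fin q
      X = generatedSequence maps matrix

      point : Fin (q ^ m) → Fin s → ℚ
      point n i = truncate m (X (k ℕ.* q ^ m ℕ.+ toℕ n) i)

    module _ (J : Interval e) (large : 1 /b^ (m ∸ g) ℚ.≤ Interval.volume J) where
      open Interval J

      private
        -- As e_i divides d_i, the first d_i rows are exactly the coordinates of `M i` complete
        -- digits.
        M : Fin s → ℕ
        M i = ℕ.quotient (e∣d i)

        d≡ : ∀ i → d i ≡ M i ℕ.* e i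
        d≡ i = ℕ.m∣n⇒n≡quotient*m (e∣d i)

        total-d≤ : total d ≤ m ∸ g
        total-d≤ = unit-fraction-≤ (≡.subst (1 /b^ (m ∸ g) ℚ.≤_) (product≡ d) large)

        d≤m : ∀ i → d i ≤ m
        d≤m i = ℕ.≤-trans (≤-total-sum d i) (ℕ.≤-trans total-d≤ (ℕ.m∸n≤m m g))

        m-large : g ℕ.+ size M ≤ m
        m-large = ℕ.≤-trans (ℕ.+-monoʳ-≤ g (ℕ.≤-trans (ℕ.≤-reflexive (≡.sym (total-cong d≡))) total-d≤))
          (ℕ.≤-reflexive (ℕ.m+[n∸m]≡n (ℕ.<⇒≤ g<m)))

        -- The preimage of the prescribed digit under `Λ i j`, minus the contribution of `k`:
        -- belonging to the interval becomes an inhomogeneous linear system.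
        target : Fin s → ℕ → K.Carrier
        target i j = proj₁ (Bijection.surjective (Λ i j) (digits (d i) (a i) j)) K.- offset maps matrix k m i j

        A : Fin (size M) → ℕ → K.Carrier
        A ρ r = entry C degree∞ degree genus P∞≉P P≉P r (index M ρ)

        v : Vector K.Carrier (size M)
        v ρ = let i , k , h = index M ρ in target i (k ℕ.* e i ℕ.+ toℕ h)

        1≉0 : ¬ (K.1# K.≈ K.0#)
        1≉0 = K-nontrivial P∞

      module _ (n : Fin (q ^ m)) where
        private
          N = k ℕ.* q ^ m ℕ.+ toℕ n
          value : Fin s → ℕ → K.Carrier
          value i j = linear m (matrix i j) (input 1≉0 ψ (toℕ n))

        digit⇒value : ∀ i j → X N i j ≡ digits (d i) (a i) j → value i j K.≈ target i j
        digit⇒value i j eq = begin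
          value i j                                     ≈⟨ solve 2 (λ v o → v := (v :+ o) :- o) K.refl (value i j) w ⟩
          (value i j K.+ w) K.- w                       ≈⟨ K.+-congʳ (output-block maps matrix k m n i j) ⟨
          output maps matrix N i j K.- w                ≈⟨ K.+-congʳ (Bijection.injective (Λ i j) (≡.trans eq (≡.sym
                                                             (proj₂ (Bijection.surjective (Λ i j) (digits (d i) (a i) j)) K.refl)))) ⟩
          target i j                                    ∎
          where
          open SetoidReasoning K.setoid
          open SolverK
          w = offset maps matrix k m i j

        value⇒digit : ∀ i j → value i j K.≈ target i j → X N i j ≡ digits (d i) (a i) j
        value⇒digit i j eq = proj₂ (Bijection.surjective (Λ i j) (digits (d i) (a i) j)) (begin
          output maps matrix N i j    ≈⟨ output-block maps matrix k m n i j ⟩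
          value i j K.+ w             ≈⟨ K.+-congʳ eq ⟩
          target i j K.+ w            ≈⟨ solve 2 (λ t o → (t :- o) :+ o := t) K.refl _ w ⟩
          proj₁ (Bijection.surjective (Λ i j) (digits (d i) (a i) j)) ∎)
          where
          open SetoidReasoning K.setoid
          open SolverK
          w = offset maps matrix k m i j

        contains⇒solves : Contains (point n) → Solves 1≉0 ψ m A v (toℕ n)
        contains⇒solves inside ρ = let i , k , h = index M ρ in
          digit⇒value i _ (horner-injective (d i)
            (≡.trans (interval⇒horner (d≤m i) (X N i) (proj₁ (inside i)) (proj₂ (inside i))) (≡.sym (horner-digits (d i) (a i) (a< i))))
            _ (≡.subst (k ℕ.* e i ℕ.+ toℕ h <_) (≡.sym (d≡ i)) (row-bound k h (index-bounded M ρ))))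
          where
          row-bound : ∀ {i} k (h : Fin (e i)) → k < M i → k ℕ.* e i ℕ.+ toℕ h < M i ℕ.* e i
          row-bound {i} k h k<M = ℕ.<-≤-trans (ℕ.+-monoʳ-< (k ℕ.* e i) (Fin.toℕ<n h))
            (ℕ.≤-trans (ℕ.≤-reflexive (ℕ.+-comm (k ℕ.* e i) (e i))) (ℕ.*-monoˡ-≤ (e i) k<M))

        solves⇒contains : Solves 1≉0 ψ m A v (toℕ n) → Contains (point n)
        solves⇒contains solved i = horner⇒interval (d≤m i) (X N i)
          (≡.trans (horner-cong (d i) λ j j<d → value⇒digit i j (solved-row j (≡.subst (j <_) (d≡ i) j<d)))
            (horner-digits (d i) (a i) (a< i)))
          where
          -- Division of `j` by `e i` yields the digit and the coordinate to which row `j` belongs.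
          solved-row : ∀ j → j < M i ℕ.* e i → value i j K.≈ target i j
          solved-row j j< = ≡.subst (λ j → value i j K.≈ target i j) j≡
            (≡.subst (λ (i , k , h) → value i (k ℕ.* e i ℕ.+ toℕ h) K.≈ target i (k ℕ.* e i ℕ.+ toℕ h)) (proj₂ covered) (solved (proj₁ covered)))
            where
            κ = proj₁ (remQuot {M i} (e i) (Fin.fromℕ< j<))
            h = proj₂ (remQuot {M i} (e i) (Fin.fromℕ< j<))
            covered = index-covers M i (toℕ κ) h (Fin.toℕ<n κ)
            j≡ : toℕ κ ℕ.* e i ℕ.+ toℕ h ≡ j
            j≡ = begin
              toℕ κ ℕ.* e i ℕ.+ toℕ h    ≡⟨ ≡.cong (ℕ._+ toℕ h) (ℕ.*-comm (toℕ κ) (e i)) ⟩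
              e i ℕ.* toℕ κ ℕ.+ toℕ h    ≡⟨ Fin.toℕ-combine κ h ⟨
              toℕ (combine κ h)          ≡⟨ ≡.cong toℕ (Fin.combine-remQuot {M i} (e i) (Fin.fromℕ< j<)) ⟩
              toℕ (Fin.fromℕ< j<)        ≡⟨ Fin.toℕ-fromℕ< j< ⟩
              j                          ∎
              where open ≡.≡-Reasoning

      interval-count : fromℕ (Interval.count J point) ≡ fromℕ (q ^ m) ℚ.* volume
      interval-count = begin
        fromℕ (Interval.count J point)             ≡⟨ ≡.cong fromℕ count≡ ⟩
        fromℕ (solutions 1≉0 ψ m A v)              ≡⟨ count-volume (solutions 1≉0 ψ m A v) m (size M) (solutions-count 1≉0 ψ m A v
                                                        (relation-zero C degree∞ degree genus P∞≉P P≉P M m-large)) ⟩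
        fromℕ (q ^ m) ℚ.* (1 /b^ size M)           ≡⟨ ≡.cong (λ T → fromℕ (q ^ m) ℚ.* (1 /b^ T)) (total-cong d≡) ⟨
        fromℕ (q ^ m) ℚ.* (1 /b^ total d)           ≡⟨ ≡.cong (fromℕ (q ^ m) ℚ.*_) (product≡ d) ⟨
        fromℕ (q ^ m) ℚ.* volume                   ∎
        where
        open ≡.≡-Reasoning
        count≡ : Interval.count J point ≡ solutions 1≉0 ψ m A v
        count≡ = ≡.trans (length-filter-tabulate (λ n → contains? (point n)) id)
          (Σℕ.sum-cong-≗ {q ^ m} λ n → 𝟙-cong (contains? (point n)) (solves? 1≉0 ψ m A v (toℕ n))
            (contains⇒solves n) (solves⇒contains n))

    net : IsNet g m e point
    net = ℕ.<⇒≤ g<m , (λ n i → truncate-bounds m (X (k ℕ.* q ^ m ℕ.+ toℕ n) i)) , interval-count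

theorem1 :
    ∀ {c ℓ₁ ℓ₂ : Level} (q : ℕ) .{{_ : NonTrivial q}} → IsPrimePower q →
    (s : ℕ) → 1 ≤ s →
    (G : GlobalFunctionField q c ℓ₁ ℓ₂) →
    let open FunctionFieldTheory G
        open DigitalMethod G
        open NetsAndSequences q
    in
    (g : ℕ) → IsGenus g →
    (P∞ : Place) (P : Fin s → Place) →
    (∀ i → ¬ (P∞ ≈ᴾ P i)) →
    (∀ i j → i ≢ j → ¬ (P i ≈ᴾ P j)) →
    HasDegree P∞ 1 →
    (e : Fin s → ℕ) → (∀ i → HasDegree (P i) (e i)) →
    (C : ColumnwiseConstruction P∞ P e) (maps : DigitMaps s) →
    IsSequence g e (generatedSequence maps (ColumnwiseConstruction.matrix C))
theorem1 q _ s _ G g genus P∞ P P∞≉P P≉P degree∞ e degree C maps =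
  Sequence.net G C degree∞ degree genus P∞≉P P≉P maps
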